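{- Let $n\geq 2$, $M\geq 3$, and $0\leq y\leq n$. Then $(n-y,y)\in\mathrm{HWP}(C_M[n];M,Mn)$, except possibly when at least one of the following conditions holds: (1) $y=1$ and $(n,(-1)^M)\neq(2,-1)$; (2) $y=2<n$, $n\equiv 2\pmod 4$, and $M$ is odd; (3) $(y,n)\in\{(0,2),(0,6)\}$ and $M$ is odd.
   Context: For a graph $G$ and positive integer $n$, $G[n]$ denotes the lexicographic product of $G$ with the empty graph on $n$ vertices (vertex set $V(G)\times\mathbb{Z}_n$, with $(x,i)(y,j)$ an edge iff $xy\in E(G)$); $C_M$ is a cycle of length $M$. A $C_\ell$-factor of a graph $G$ is a spanning subgraph of $G$ that is a vertex-disjoint union of $\ell$-cycles. $\mathrm{HWP}(G;M,N)$ denotes the set of pairs $(\alpha,\beta)$ of non-negative integers for which $E(G)$ can be partitioned into $\alpha$ $C_M$-factors and $\beta$ $C_N$-factors. -}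

module Defs where

open import Data.Nat using (ℕ; zero; suc; _*_)
open import Data.Fin using (Fin; zero; suc)
open import Data.Product using (Σ; _×_; _,_; ∃; ∃-syntax)
open import Data.Sum using (_⊎_; inj₁; inj₂)
open import Relation.Binary.PropositionalEquality using (_≡_)
open import Function.Definitions using (Injective)

record Graph : Set₁ where
  field
    V   : Set
    Adj : V → V → Set
open Graph public

-- cyclic successor on Fin ℓ:  k ↦ k + 1 (mod ℓ)
next′ : ∀ {m} → Fin (suc m) → Fin (suc m)
next′ {zero} zero = zero
next′ {suc m} zero = suc zero
next′ {suc m} (suc k) with next′ {m} k
... | zero = zero
... | suc j = suc (suc j)

next : ∀ {ℓ} → Fin ℓ → Fin ℓ
next {suc m} k = next′ {m} k

Cyc : ℕ → Graph
Cyc M = record { V = Fin M ; Adj = λ x y → (y ≡ next x) ⊎ (x ≡ next y) }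

lex : Graph → ℕ → Graph
lex G n = record
  { V = V G × Fin n
  ; Adj = λ p q → Adj G (Data.Product.proj₁ p) (Data.Product.proj₁ q) }

record Cycle (G : Graph) (ℓ : ℕ) : Set where
  field
    vert : Fin ℓ → V G
    inj  : Injective _≡_ _≡_ vert
    adj  : ∀ k → Adj G (vert k) (vert (next k))
open Cycle public

EdgeOfCycle : ∀ {G ℓ} → Cycle G ℓ → V G → V G → Set
EdgeOfCycle C u w =
  ∃[ k ] ((vert C k ≡ u × vert C (next k) ≡ w) ⊎ (vert C k ≡ w × vert C (next k) ≡ u))

record Factor (G : Graph) (ℓ : ℕ) : Set₁ where
  field
    count    : ℕ
    cycles   : Fin count → Cycle G ℓ
    covers   : ∀ v → ∃[ i ] ∃[ k ] (vert (cycles i) k ≡ v)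
    disjoint : ∀ i j k l → vert (cycles i) k ≡ vert (cycles j) l → i ≡ j
open Factor public

EdgeOfFactor : ∀ {G ℓ} → Factor G ℓ → V G → V G → Set
EdgeOfFactor F u w = ∃[ i ] EdgeOfCycle (cycles F i) u w

InHWP : Graph → ℕ → ℕ → ℕ × ℕ → Set₁
InHWP G M N (α , β) =
  Σ (Fin α → Factor G M) λ FM →
  Σ (Fin β → Factor G N) λ FN →
    let EdgeIn : Fin α ⊎ Fin β → V G → V G → Set
        EdgeIn = λ { (inj₁ a) → EdgeOfFactor (FM a) ; (inj₂ b) → EdgeOfFactor (FN b) }
    in ∀ u w → Adj G u w →
         (∃[ t ] EdgeIn t u w) × (∀ s t → EdgeIn s u w → EdgeIn t u w → s ≡ t)

{-# OPTIONS --safe #-}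
module Submission where

-- A 2-factor winding around C_M is a permutation of ℤ_n between each two consecutive columns;
-- its cycles are those of the composite permutation.  If every permutation is a translation,
-- row r (the r-th factor) is a C_M-factor when its shifts add up to 0 and a Hamiltonian cycle
-- when they add up to a unit, and the rows partition the edges when the shifts between any two
-- consecutive columns are distinct.  A good arrangement for y = 0 is altered by permuting the
-- shifts of one layer among y rows, in transpositions of neighbours and at most one 3-cycle.
--
-- For even n the total of all shifts is prescribed mod n and may force a row sum s that is not
-- a unit.  Then two rows exchange edges around two adjacent vertices 0, 1 of column 0.  In each
-- row this reverses one of the two paths between the four end points (a 2-opt move): it keeps
-- a Hamiltonian cycle Hamiltonian and merges the two cycles of a row with gcd (s, n) = 2.
--
-- For y = 0, n even and M odd no translation scheme exists; a C_M-factorisation is obtained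
-- from two orthogonal Latin squares of order n, which exist for even n ∉ {2, 6}: Wilson's
-- construction reduces 3 t + u to t coprime to 6 and odd u, up to the orders 4, 8, 10, 14.

open import Defs
open import Data.Nat as ℕ using (ℕ; zero; suc; NonZero; z≤n; s≤s; s≤s⁻¹; _≤_; _<_; _<?_; _∸_; _%_; >-nonZero)
import Data.Nat.Properties as ℕₚ
open import Data.Nat.DivMod using (_mod_; _divMod_; result; [m+kn]%n≡m%n; m*n%n≡0)
import Data.Nat.Tactic.RingSolver as ℕSolver
open import Data.Integer as ℤ using (ℤ; +_; 0ℤ; 1ℤ; ∣_∣)
import Data.Integer.Properties as ℤₚ
open import Data.Integer.DivMod using (_%ℕ_; _/ℕ_; n%ℕd<d; a≡a%ℕn+[a/ℕn]*n)
open import Data.Integer.Tactic.RingSolver using (solve-∀)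
open import Data.Fin using (Fin; zero; suc; toℕ; fromℕ; fromℕ<; inject₁; inject≤; combine; remQuot; opposite; punchOut; _≟_)
open import Data.Fin.Patterns using (0F; 1F; 2F; 3F; 4F; 5F; 6F; 7F; 8F)
import Data.Fin.Properties as Fₚ
open import Data.Vec using (Vec; []; _∷_; lookup)
open import Data.Product using (_×_; _,_; ∃-syntax; proj₁; proj₂)
open import Data.Product.Properties using (,-injectiveˡ; ,-injectiveʳ)
open import Data.Sum as Sum using (_⊎_; inj₁; inj₂)
open import Data.Sum.Properties using (inj₁-injective; inj₂-injective)
open import Data.Sum.Function.Propositional using (_⊎-↔_)
open import Data.Empty using (⊥; ⊥-elim)
open import Relation.Nullary using (¬_; Dec; yes; no; True; toWitness; _×-dec_; _⊎-dec_)
open import Relation.Binary.Definitions using (tri<; tri≈; tri>)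
open import Relation.Binary.PropositionalEquality
open import Function using (_∘_; case_of_; _⇔_; mk⇔; Equivalence; _↔_; Inverse)
open import Function.Construct.Composition using (_↔-∘_; _⇔-∘_)
open import Function.Construct.Identity using (↔-id)
open import Function.Construct.Symmetry using (↔-sym)
open import Function.Definitions using (Injective)

-- Cycles and factors of C_M[n]

-- The n shifts of one layer are all the residues, so for even n they add up to n/2, and all M
-- layers to M n/2 mod n. With y units, which are odd, and n - y zeros this is impossible if M is
-- even and y is odd, or if M is odd and y and n/2 differ in parity; y = 0 with M odd fails because
-- n/2 is not 0. A transposition of neighbours gives the row sums -1 and 1, the 3-cycle gives -1, -1
-- and 2. The 2 is a unit for odd n; for even n its row is one of the two that trade. For n even, M
-- odd and y ≥ 2, row 0 absorbs the defect n/2 and has the sum n/2 - 1, a unit or of gcd 2 with n;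
-- it trades in both cases. Two rows can trade if their shifts are t, t + 1 from column 0 to column
-- 1 and t′, t′ + 1 from the last column to column 0. For u and w = u + 1 in column 0, R = w + t in
-- column 1 and L = u - t′ in the last column, the edges u R, R w, w L, L u form a 4-cycle on which
-- the two rows alternate. Exchanging them leaves u with two neighbours in column 1 and w with two
-- in the last column, or vice versa, so a cycle changes its direction there.

next-step : ∀ {n} (i : Fin n) →
  (suc (toℕ i) < n × toℕ (next i) ≡ suc (toℕ i)) ⊎ (suc (toℕ i) ≡ n × toℕ (next i) ≡ 0)
next-step {suc zero} zero = inj₂ (refl , refl)
next-step {suc (suc n)} zero = inj₁ (s≤s (s≤s z≤n) , refl)
next-step {suc (suc n)} (suc i) with next′ {n} i | next-step {suc n} i
... | zero  | inj₁ (_ , ())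
... | zero  | inj₂ (e , _) = inj₂ (cong suc e , refl)
... | suc j | inj₁ (l , e) = inj₁ (s≤s l , cong suc e)
... | suc j | inj₂ (_ , ())

next-< : ∀ {n} (i : Fin n) → suc (toℕ i) < n → toℕ (next i) ≡ suc (toℕ i)
next-< i l with next-step i
... | inj₁ (_ , e) = e
... | inj₂ (e , _) = ⊥-elim (ℕₚ.<-irrefl e l)

next-last : ∀ {n} (i : Fin n) → suc (toℕ i) ≡ n → toℕ (next i) ≡ 0
next-last i l with next-step i
... | inj₁ (l′ , _) = ⊥-elim (ℕₚ.<-irrefl l l′)
... | inj₂ (_ , e) = e

last? : ∀ {n} (i : Fin n) → suc (toℕ i) < n ⊎ suc (toℕ i) ≡ n
last? i with next-step i
... | inj₁ (l , _) = inj₁ l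
... | inj₂ (e , _) = inj₂ e

next-injective : ∀ {n} → Injective _≡_ _≡_ (next {n})
next-injective {n} {i} {j} eq with next-step i | next-step j
... | inj₁ (_ , e) | inj₁ (_ , e′) = Fₚ.toℕ-injective (ℕₚ.suc-injective (trans (sym e) (trans (cong toℕ eq) e′)))
... | inj₁ (_ , e) | inj₂ (_ , e′) = case trans (sym e) (trans (cong toℕ eq) e′) of λ ()
... | inj₂ (_ , e) | inj₁ (_ , e′) = case trans (sym e) (trans (cong toℕ eq) e′) of λ ()
... | inj₂ (l , _) | inj₂ (l′ , _) = Fₚ.toℕ-injective (ℕₚ.suc-injective (trans l (sym l′)))

next²≢ : ∀ {n} → 3 ≤ n → (i : Fin n) → next (next i) ≢ i
next²≢ n≥3 i eq with next-step i | next-step (next i)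
... | inj₁ (_ , e) | inj₁ (_ , e′) =
  ℕₚ.<-irrefl (trans (cong toℕ (sym eq)) (trans e′ (cong suc e))) (ℕₚ.m≤n⇒m≤1+n ℕₚ.≤-refl)
... | inj₁ (_ , e) | inj₂ (l , e′) = ℕₚ.<-irrefl (trans (cong (λ z → suc (suc z)) (sym i≡0)) (trans (cong suc (sym e)) l)) n≥3
  where i≡0 = trans (cong toℕ (sym eq)) e′
... | inj₂ (l , e) | inj₁ (_ , e′) =
  ℕₚ.<-irrefl (trans (cong suc (sym (trans (cong toℕ (sym eq)) (trans e′ (cong suc e))))) l) n≥3
... | inj₂ (_ , e) | inj₂ (l , _) = ℕₚ.<-irrefl (trans (sym (cong suc e)) l) (ℕₚ.≤-trans (s≤s (s≤s z≤n)) n≥3)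

abstract
  -- Pigeonhole: if y were missed, `punchOut` at y would inject `Fin (suc n)` into `Fin n`.
  injective⇒inverseʳ : ∀ {n} (f : Fin n → Fin n) → Injective _≡_ _≡_ f → ∀ y → ∃[ x ] f x ≡ y
  injective⇒inverseʳ {suc n} f inj y with Fₚ.any? (λ x → f x Fₚ.≟ y)
  ... | yes p = p
  ... | no ¬p = ⊥-elim (ℕₚ.<-irrefl refl (Fₚ.injective⇒≤ {f = λ x → punchOut (λ e → ¬p (x , sym e))}
                  (λ {a} {b} e → inj (Fₚ.punchOut-injective (λ e′ → ¬p (a , sym e′)) (λ e′ → ¬p (b , sym e′)) e))))

module _ {n} (f : Fin n → Fin n) (inj : Injective _≡_ _≡_ f) where
  inv : Fin n → Fin n
  inv y = proj₁ (injective⇒inverseʳ f inj y)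

  inv-right : ∀ y → f (inv y) ≡ y
  inv-right y = proj₂ (injective⇒inverseʳ f inj y)

  inv-left : ∀ x → inv (f x) ≡ x
  inv-left x = inj (inv-right (f x))

-- For M ≥ 3 exactly one reading of an edge leads from a column x to `next x`, so a factor is known
-- from one relation per column.
EdgeRel : ℕ → ℕ → Set₁
EdgeRel M n = Fin M → Fin n → Fin n → Set

record FactorOn (M n ℓ : ℕ) (E : EdgeRel M n) : Set₁ where
  field
    factor : Factor (lex (Cyc M) n) ℓ
    edges  : ∀ x a b → EdgeOfFactor factor (x , a) (next x , b) ⇔ E x a b
open FactorOn public

mapEdges : ∀ {M n ℓ E E′} → (∀ x a b → E x a b ⇔ E′ x a b) → FactorOn M n ℓ E → FactorOn M n ℓ E′
mapEdges e F = record
  { factor = factor F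
  ; edges = λ x a b → mk⇔ (Equivalence.to (e x a b) ∘ Equivalence.to (edges F x a b))
                          (Equivalence.from (edges F x a b) ∘ Equivalence.from (e x a b)) }

module _ {M n : ℕ} (M≥3 : 3 ≤ M) (κ : Fin M → Fin n → Fin n) (κ-inj : ∀ x → Injective _≡_ _≡_ (κ x)) where

  private
    G = lex (Cyc M) n
    ρ : Fin M → Fin n → Fin n
    ρ x = inv (κ x) (κ-inj x)

    κρ : ∀ x q → κ x (ρ x q) ≡ q
    κρ x = inv-right (κ x) (κ-inj x)

    ρκ : ∀ x a → ρ x (κ x a) ≡ a
    ρκ x = inv-left (κ x) (κ-inj x)

    κ⇐ : ∀ {x y q a} → (x , ρ x q) ≡ (y , a) → x ≡ y × q ≡ κ y a
    κ⇐ {x} {q = q} refl = refl , sym (κρ x q)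

  -- Cycle q takes the one vertex labelled q from every column.
  labelFactor : FactorOn M n M (λ x a b → κ x a ≡ κ (next x) b)
  labelFactor = record
    { factor = F
    ; edges = λ x a b → mk⇔ (to x a b) (λ e → κ x a , x , inj₁ (cong (x ,_) (ρκ x a) ,
                cong (next x ,_) (trans (cong (ρ (next x)) e) (ρκ (next x) b))))
    }
    where
    F : Factor G M
    F = record
      { count = n
      ; cycles = λ q → record
        { vert = λ x → x , ρ x q
        ; inj = cong proj₁
        ; adj = λ x → inj₁ refl }
      ; covers = λ { (x , a) → κ x a , x , cong (x ,_) (ρκ x a) }
      ; disjoint = λ q r x y e → trans (proj₂ (κ⇐ e)) (κρ y r)
      }
    to : ∀ x a b → EdgeOfFactor F (x , a) (next x , b) → κ x a ≡ κ (next x) b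
    to x a b (q , y , inj₁ (e , e′)) = trans (sym (proj₂ (κ⇐ e))) (proj₂ (κ⇐ e′))
    to x a b (q , y , inj₂ (e , e′)) with κ⇐ e | κ⇐ e′
    ... | y≡ , _ | ny≡ , _ = ⊥-elim (next²≢ M≥3 x (trans (cong next (sym y≡)) ny≡))

-- x ↦ - x (mod M)
mirror : ∀ {M} → Fin M → Fin M
mirror zero = zero
mirror (suc j) = suc (opposite j)

mirror-involutive : ∀ {M} (x : Fin M) → mirror (mirror x) ≡ x
mirror-involutive zero = refl
mirror-involutive (suc j) = cong suc (Fₚ.opposite-involutive j)

toℕ-mirror : ∀ {m} (x : Fin (suc m)) → 0 < toℕ x → toℕ x ℕ.+ toℕ (mirror x) ≡ suc m
toℕ-mirror {m} (suc j) _ = cong suc (begin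
  toℕ j ℕ.+ suc (toℕ (opposite j))  ≡⟨ cong (λ z → toℕ j ℕ.+ suc z) (Fₚ.opposite-prop j) ⟩
  toℕ j ℕ.+ suc (m ∸ suc (toℕ j))   ≡⟨ ℕₚ.+-suc (toℕ j) _ ⟩
  suc (toℕ j) ℕ.+ (m ∸ suc (toℕ j)) ≡⟨ ℕₚ.m+[n∸m]≡n (Fₚ.toℕ<n j) ⟩
  m ∎)
  where open ≡-Reasoning

next-mirror-next : ∀ {M} → 2 ≤ M → (x : Fin M) → next (mirror (next x)) ≡ mirror x
next-mirror-next {suc m} M≥2 x with next-step x
... | inj₁ (l , e) = Fₚ.toℕ-injective (case zero⊎pos x of λ
      { (inj₁ refl) → next-last y (trans (cong (ℕ._+ toℕ y) (sym e)) y≡)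
      ; (inj₂ x>0) → ℕₚ.+-cancelˡ-≡ (toℕ x) _ _ (trans (cong (toℕ x ℕ.+_) (next-< y (lt x>0)))
           (trans (ℕₚ.+-suc (toℕ x) _) (trans (cong (ℕ._+ toℕ y) (sym e)) (trans y≡ (sym (toℕ-mirror x x>0)))))) })
  where
  y = mirror (next x)
  y≡ : toℕ (next x) ℕ.+ toℕ y ≡ suc m
  y≡ = toℕ-mirror (next x) (subst (0 <_) (sym e) (s≤s z≤n))
  zero⊎pos : ∀ {k} (z : Fin (suc k)) → z ≡ zero ⊎ 0 < toℕ z
  zero⊎pos zero = inj₁ refl
  zero⊎pos (suc z) = inj₂ (s≤s z≤n)
  lt : 0 < toℕ x → suc (toℕ y) < suc m
  lt x>0 = subst (suc (suc (toℕ y)) ≤_) (trans (cong (ℕ._+ toℕ y) (sym e)) y≡) (s≤s (ℕₚ.+-monoˡ-≤ (toℕ y) x>0))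
... | inj₂ (l , e) = Fₚ.toℕ-injective (begin
  toℕ (next (mirror (next x))) ≡⟨ cong (λ z → toℕ (next (mirror z))) (Fₚ.toℕ-injective {i = next x} {zero} e) ⟩
  toℕ (next {suc m} zero)      ≡⟨ next-< {suc m} zero M≥2 ⟩
  1                            ≡⟨ ℕₚ.+-cancelˡ-≡ (toℕ x) _ _ (trans (ℕₚ.+-comm (toℕ x) 1) (trans l (sym (toℕ-mirror x x>0)))) ⟩
  toℕ (mirror x) ∎)
  where
  open ≡-Reasoning
  x>0 : 0 < toℕ x
  x>0 = s≤s⁻¹ (subst (2 ≤_) (sym l) M≥2)

-- The block that follows position x of block q.
carry : ∀ {M n} → Fin M → Fin n → Fin n
carry x q with last? x
... | inj₁ _ = q
... | inj₂ _ = next q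

carry-< : ∀ {M n} {x : Fin M} (q : Fin n) → suc (toℕ x) < M → carry x q ≡ q
carry-< {x = x} q l with last? x
... | inj₁ _ = refl
... | inj₂ e = ⊥-elim (ℕₚ.<-irrefl e l)

carry-last : ∀ {M n} {x : Fin M} (q : Fin n) → suc (toℕ x) ≡ M → carry x q ≡ next q
carry-last {x = x} q e with last? x
... | inj₁ l = ⊥-elim (ℕₚ.<-irrefl e l)
... | inj₂ _ = refl

next-combine : ∀ {M n} (q : Fin n) (x : Fin M) → next (combine q x) ≡ combine (carry x q) (next x)
next-combine {M} {n} q x = Fₚ.toℕ-injective (lemma (next-step x))
  where
  open ≡-Reasoning
  c≡ : toℕ (combine q x) ≡ M ℕ.* toℕ q ℕ.+ toℕ x
  c≡ = Fₚ.toℕ-combine q x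
  lemma : _ → toℕ (next (combine q x)) ≡ toℕ (combine (carry x q) (next x))
  lemma (inj₁ (l , e)) = begin
    toℕ (next (combine q x)) ≡⟨ next-< (combine q x) (ℕₚ.<-≤-trans (subst (_< M ℕ.* suc (toℕ q)) (cong suc (sym c≡))
                                   (subst₂ _<_ (ℕₚ.+-suc _ _) (trans (ℕₚ.+-comm _ M) (sym (ℕₚ.*-suc M (toℕ q)))) (ℕₚ.+-monoʳ-< (M ℕ.* toℕ q) l)))
                                   (ℕₚ.≤-trans (ℕₚ.*-monoʳ-≤ M (Fₚ.toℕ<n q)) (ℕₚ.≤-reflexive (ℕₚ.*-comm M n)))) ⟩
    suc (toℕ (combine q x))  ≡⟨ cong suc c≡ ⟩
    suc (M ℕ.* toℕ q ℕ.+ toℕ x)  ≡⟨ ℕₚ.+-suc (M ℕ.* toℕ q) (toℕ x) ⟨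
    M ℕ.* toℕ q ℕ.+ suc (toℕ x)  ≡⟨ cong₂ (λ r z → M ℕ.* toℕ r ℕ.+ z) (carry-< q l) e ⟨
    M ℕ.* toℕ (carry x q) ℕ.+ toℕ (next x) ≡⟨ Fₚ.toℕ-combine (carry x q) (next x) ⟨
    toℕ (combine (carry x q) (next x)) ∎
  lemma (inj₂ (l , e)) = trans (go (next-step q)) (begin
    M ℕ.* toℕ (next q) ≡⟨ ℕₚ.+-identityʳ _ ⟨
    M ℕ.* toℕ (next q) ℕ.+ 0 ≡⟨ cong₂ (λ r z → M ℕ.* toℕ r ℕ.+ z) (carry-last q l) e ⟨
    M ℕ.* toℕ (carry x q) ℕ.+ toℕ (next x) ≡⟨ Fₚ.toℕ-combine (carry x q) (next x) ⟨
    toℕ (combine (carry x q) (next x)) ∎)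
    where
    c+1≡ : suc (toℕ (combine q x)) ≡ M ℕ.* suc (toℕ q)
    c+1≡ = begin
      suc (toℕ (combine q x)) ≡⟨ cong suc c≡ ⟩
      suc (M ℕ.* toℕ q ℕ.+ toℕ x)  ≡⟨ ℕₚ.+-suc (M ℕ.* toℕ q) (toℕ x) ⟨
      M ℕ.* toℕ q ℕ.+ suc (toℕ x)  ≡⟨ cong (M ℕ.* toℕ q ℕ.+_) l ⟩
      M ℕ.* toℕ q ℕ.+ M            ≡⟨ ℕₚ.+-comm _ M ⟩
      M ℕ.+ M ℕ.* toℕ q            ≡⟨ ℕₚ.*-suc M (toℕ q) ⟨
      M ℕ.* suc (toℕ q) ∎
    go : _ → toℕ (next (combine q x)) ≡ M ℕ.* toℕ (next q)
    go (inj₁ (l′ , e′)) = begin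
      toℕ (next (combine q x)) ≡⟨ next-< (combine q x) (subst₂ _<_ (sym c+1≡) (ℕₚ.*-comm M n)
                                    (ℕₚ.*-monoʳ-< M {{>-nonZero (ℕₚ.≤-trans (s≤s z≤n) (Fₚ.toℕ<n x))}} l′)) ⟩
      suc (toℕ (combine q x))  ≡⟨ c+1≡ ⟩
      M ℕ.* suc (toℕ q)          ≡⟨ cong (M ℕ.*_) e′ ⟨
      M ℕ.* toℕ (next q) ∎
    go (inj₂ (l′ , e′)) = begin
      toℕ (next (combine q x)) ≡⟨ next-last (combine q x) (trans c+1≡ (trans (cong (M ℕ.*_) l′) (ℕₚ.*-comm M n))) ⟩
      0                        ≡⟨ ℕₚ.*-zeroʳ M ⟨
      M ℕ.* 0                    ≡⟨ cong (M ℕ.*_) e′ ⟨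
      M ℕ.* toℕ (next q) ∎

-- The same for a block r traversed backwards, when it moves from column next x to column x.
carryBack : ∀ {M n} → Fin M → Fin n → Fin n
carryBack zero r = next r
carryBack (suc _) r = r

carry-mirror-next : ∀ {M n} → 2 ≤ M → (x : Fin M) (r : Fin n) → carry (mirror (next x)) r ≡ carryBack x r
carry-mirror-next {M} M≥2 x r with x | next-mirror-next M≥2 x
... | zero | e = carry-last r (case last? y of λ
        { (inj₁ l) → case trans (sym (next-< y l)) (cong toℕ e) of λ ()
        ; (inj₂ l) → l })
      where y = mirror (next zero)
... | suc j | e = carry-< r (case last? y of λ
        { (inj₁ l) → l
        ; (inj₂ l) → case trans (sym (next-last y l)) (cong toℕ e) of λ () })
      where y = mirror (next (suc j))

-- The two alternatives are the two directions in which the cycle may use the edge. The block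
-- compared with m is the one that the step leaves, and `carry` or `carryBack` gives the one that it
-- enters.
HamRel : ∀ {M n} (m : ℕ) (κ : Fin M → Fin n → Fin n) → EdgeRel M n
HamRel m κ x a b = (toℕ q < m × carry x q ≡ r) ⊎ (m ≤ toℕ r × carryBack x r ≡ q)
  where
  q = κ x a
  r = κ (next x) b

-- Block q of the Hamiltonian cycle visits the vertices with label q, through the columns
-- 0, 1, …, M - 1 if q < m and through 0, M - 1, …, 1 if m ≤ q.
module _ {M n : ℕ} (M≥3 : 3 ≤ M)
         (κ : Fin M → Fin n → Fin n) (κ-inj : ∀ x → Injective _≡_ _≡_ (κ x)) (m : ℕ) where
  private
    G = lex (Cyc M) n
    M≥2 : 2 ≤ M
    M≥2 = ℕₚ.≤-trans (s≤s (s≤s z≤n)) M≥3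

    ρ : Fin M → Fin n → Fin n
    ρ x = inv (κ x) (κ-inj x)

    κρ : ∀ x q → κ x (ρ x q) ≡ q
    κρ x = inv-right (κ x) (κ-inj x)

    ρκ : ∀ x a → ρ x (κ x a) ≡ a
    ρκ x = inv-left (κ x) (κ-inj x)

    dir : Fin n → Fin M → Fin M
    dir q x with toℕ q <? m
    ... | yes _ = x
    ... | no _ = mirror x

    dir-< : ∀ q x → toℕ q < m → dir q x ≡ x
    dir-< q x l with toℕ q <? m
    ... | yes _ = refl
    ... | no ¬l = ⊥-elim (¬l l)

    dir-≥ : ∀ q x → m ≤ toℕ q → dir q x ≡ mirror x
    dir-≥ q x l with toℕ q <? m
    ... | yes l′ = ⊥-elim (ℕₚ.<-irrefl refl (ℕₚ.<-≤-trans l′ l))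
    ... | no _ = refl

    dir-involutive : ∀ q x → dir q (dir q x) ≡ x
    dir-involutive q x with toℕ q <? m
    ... | yes _ = refl
    ... | no _ = mirror-involutive x

    dir-zero : ∀ q x → toℕ x ≡ 0 → dir q x ≡ x
    dir-zero q zero _ with toℕ q <? m
    ... | yes _ = refl
    ... | no _ = refl

    -- The block changes only on reaching column 0, which `mirror` fixes. This is why the direction
    -- may be reversed from one block to the next.
    dir-carry : ∀ q x → dir (carry x q) (next x) ≡ dir q (next x)
    dir-carry q x = case next-step x of λ
      { (inj₁ (l , _)) → cong (λ r → dir r (next x)) (carry-< q l)
      ; (inj₂ (_ , e)) → trans (dir-zero (carry x q) (next x) e) (sym (dir-zero q (next x) e)) }

    at : Fin n → Fin M → V G
    at q x = dir q x , ρ (dir q x) q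

    walk : Fin (n ℕ.* M) → V G
    walk k = at (proj₁ (remQuot {n} M k)) (proj₂ (remQuot {n} M k))

    walk-combine : ∀ q x → walk (combine q x) ≡ at q x
    walk-combine q x = cong (λ p → at (proj₁ p) (proj₂ p)) (Fₚ.remQuot-combine q x)

    walk-next : ∀ q x → walk (next (combine q x)) ≡ at (carry x q) (next x)
    walk-next q x = trans (cong walk (next-combine q x)) (walk-combine (carry x q) (next x))

    at⇒ : ∀ {q x y a} → at q x ≡ (y , a) → dir q x ≡ y × q ≡ κ y a
    at⇒ refl = refl , sym (κρ _ _)

    ⇒at : ∀ {q x y a} → dir q x ≡ y → q ≡ κ y a → at q x ≡ (y , a)
    ⇒at refl e = cong (_ ,_) (trans (cong (ρ _) e) (ρκ _ _))

    at-injective : ∀ {q x r y} → at q x ≡ at r y → combine q x ≡ combine r y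
    at-injective {q} {x} {r} {y} e with at⇒ e
    ... | d , q≡ with trans q≡ (κρ (dir r y) r)
    ...   | refl = cong (combine q) (trans (sym (dir-involutive q x)) (trans (cong (dir q) d) (dir-involutive q y)))

    walk-injective : Injective _≡_ _≡_ walk
    walk-injective {k} {l} e = trans (sym (Fₚ.combine-remQuot {n} M k)) (trans (at-injective {x = proj₂ (remQuot {n} M k)} {y = proj₂ (remQuot {n} M l)} e) (Fₚ.combine-remQuot {n} M l))

    at-adj : ∀ q x → Adj G (at q x) (at (carry x q) (next x))
    at-adj q x with toℕ q <? m
    ... | yes l = inj₁ (trans (dir-carry q x) (dir-< q (next x) l))
    ... | no ¬l = inj₂ (sym (trans (cong next (trans (dir-carry q x) (dir-≥ q (next x) (ℕₚ.≮⇒≥ ¬l)))) (next-mirror-next M≥2 x)))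

    hamCycle : Cycle G (n ℕ.* M)
    hamCycle = record
      { vert = walk
      ; inj = walk-injective
      ; adj = λ k → case Fₚ.combine-surjective {n} {M} k of λ
          { (q , x , refl) → subst₂ (Adj G) (sym (walk-combine q x)) (sym (walk-next q x)) (at-adj q x) } }

    F : Factor G (n ℕ.* M)
    F = record
      { count = 1
      ; cycles = λ _ → hamCycle
      ; covers = λ { (x , a) → zero , combine (κ x a) (dir (κ x a) x) ,
                     trans (walk-combine _ _) (⇒at (dir-involutive (κ x a) x) refl) }
      ; disjoint = λ { zero zero _ _ _ → refl } }

    module _ (x : Fin M) (a b : Fin n) where
      q = κ x a
      r = κ (next x) b

      from : HamRel m κ x a b → EdgeOfFactor F (x , a) (next x , b)
      from (inj₁ (q<m , e)) = zero , combine q x , inj₁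
        ( trans (walk-combine q x) (⇒at (dir-< q x q<m) refl)
        , trans (walk-next q x) (⇒at (trans (dir-carry q x) (dir-< q (next x) q<m)) e) )
      from (inj₂ (m≤r , e)) = zero , combine r y , inj₂
        ( trans (walk-combine r y) (⇒at (trans (dir-≥ r y m≤r) (mirror-involutive (next x))) refl)
        , trans (walk-next r y) (⇒at (trans (dir-carry r y) (trans (dir-≥ r (next y) m≤r)
             (trans (cong mirror (next-mirror-next M≥2 x)) (mirror-involutive x))))
             (trans (carry-mirror-next M≥2 x r) e)) )
        where y = mirror (next x)

      to-at : ∀ s z → Dec (toℕ s < m) → (at s z ≡ (x , a) × at (carry z s) (next z) ≡ (next x , b)) ⊎
                      (at s z ≡ (next x , b) × at (carry z s) (next z) ≡ (x , a)) → HamRel m κ x a b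
      to-at s z (yes l) (inj₁ (e , e′)) with at⇒ e | at⇒ e′
      ... | d , s≡ | _ , r≡ with trans (sym (dir-< s z l)) d
      ...   | refl = inj₁ (subst (λ w → toℕ w < m) s≡ l , trans (cong (carry z) (sym s≡)) r≡)
      to-at s z (yes l) (inj₂ (e , e′)) with at⇒ e | at⇒ e′
      ... | d , _ | d′ , _ = ⊥-elim (next²≢ M≥3 x (trans (cong next (sym (trans (sym (dir-< s z l)) d)))
                  (trans (sym (trans (dir-carry s z) (dir-< s (next z) l))) d′)))
      to-at s z (no ¬l) (inj₁ (e , e′)) with at⇒ e | at⇒ e′
      ... | d , _ | d′ , _ = ⊥-elim (next²≢ M≥3 x (trans (cong next (sym (trans (sym (trans (dir-carry s z) (dir-≥ s (next z) l))) d′)))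
                  (trans (next-mirror-next M≥2 z) (trans (sym (dir-≥ s z l)) d))))
        where l = ℕₚ.≮⇒≥ ¬l
      to-at s z (no ¬l) (inj₂ (e , e′)) with at⇒ e | at⇒ e′
      ... | d , s≡ | _ , q≡ with trans (cong mirror (sym (trans (sym (dir-≥ s z (ℕₚ.≮⇒≥ ¬l))) d))) (mirror-involutive z)
      ...   | refl = inj₂ (subst (λ w → m ≤ toℕ w) s≡ (ℕₚ.≮⇒≥ ¬l) ,
                 trans (cong (carryBack x) (sym s≡)) (trans (sym (carry-mirror-next M≥2 x s)) q≡))

      to : EdgeOfFactor F (x , a) (next x , b) → HamRel m κ x a b
      to (i , k , h) with Fₚ.combine-surjective {n} {M} k
      ... | s , z , refl = to-at s z (toℕ s <? m) (subst₂ (λ v w → (v ≡ (x , a) × w ≡ (next x , b)) ⊎ (v ≡ (next x , b) × w ≡ (x , a)))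
              (walk-combine s z) (walk-next s z) h)

  hamFactor : FactorOn M n (M ℕ.* n) (HamRel m κ)
  hamFactor = subst (λ ℓ → FactorOn M n ℓ (HamRel m κ)) (ℕₚ.*-comm n M)
    (record { factor = F ; edges = λ x a b → mk⇔ (to x a b) (from x a b) })

EdgeOfFactor-sym : ∀ {G ℓ} (F : Factor G ℓ) {u w} → EdgeOfFactor F u w → EdgeOfFactor F w u
EdgeOfFactor-sym F (i , k , h) = i , k , Sum.swap h

ExactlyOne : ∀ {A : Set} → (A → Set) → Set
ExactlyOne P = ∃[ t ] (P t × (∀ s → P s → s ≡ t))

module _ {M n y : ℕ} (y≤n : y ≤ n) (E : Fin n → EdgeRel M n)
         (one : ∀ x a b → ExactlyOne (λ f → E f x a b))
         (closed : ∀ f → y ≤ toℕ f → FactorOn M n M (E f))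
         (ham : ∀ f → toℕ f < y → FactorOn M n (M ℕ.* n) (E f)) where
  private
    G = lex (Cyc M) n

    Row = Fin (n ∸ y) ⊎ Fin y

    y+i<n : (i : Fin (n ∸ y)) → y ℕ.+ toℕ i < n
    y+i<n i = ℕₚ.<-≤-trans (ℕₚ.+-monoʳ-< y (Fₚ.toℕ<n i)) (ℕₚ.≤-reflexive (ℕₚ.m+[n∸m]≡n y≤n))

    colour : Row → Fin n
    colour (inj₁ i) = fromℕ< (y+i<n i)
    colour (inj₂ j) = inject≤ j y≤n

    closed-colour : ∀ i → y ≤ toℕ (colour (inj₁ i))
    closed-colour i = subst (y ≤_) (sym (Fₚ.toℕ-fromℕ< (y+i<n i))) (ℕₚ.m≤m+n y (toℕ i))

    ham-colour : ∀ j → toℕ (colour (inj₂ j)) < y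
    ham-colour j = subst (_< y) (sym (Fₚ.toℕ-inject≤ j y≤n)) (Fₚ.toℕ<n j)

    colour-injective : ∀ s t → colour s ≡ colour t → s ≡ t
    colour-injective (inj₁ i) (inj₁ i′) e = cong inj₁ (Fₚ.toℕ-injective (ℕₚ.+-cancelˡ-≡ y _ _
      (Fₚ.fromℕ<-injective _ _ (y+i<n i) (y+i<n i′) e)))
    colour-injective (inj₁ i) (inj₂ j) e = ⊥-elim (ℕₚ.<⇒≱ (ham-colour j) (subst (λ f → y ≤ toℕ f) e (closed-colour i)))
    colour-injective (inj₂ j) (inj₁ i) e = ⊥-elim (ℕₚ.<⇒≱ (ham-colour j) (subst (λ f → y ≤ toℕ f) (sym e) (closed-colour i)))
    colour-injective (inj₂ j) (inj₂ j′) e = cong inj₂ (Fₚ.inject≤-injective y≤n y≤n j j′ e)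

    colour-surjective : ∀ f → ∃[ t ] colour t ≡ f
    colour-surjective f with toℕ f <? y
    ... | yes l = inj₂ (fromℕ< l) , Fₚ.toℕ-injective (trans (Fₚ.toℕ-inject≤ _ y≤n) (Fₚ.toℕ-fromℕ< l))
    ... | no ¬l = inj₁ (fromℕ< d) , Fₚ.toℕ-injective (trans (Fₚ.toℕ-fromℕ< _)
            (trans (cong (y ℕ.+_) (Fₚ.toℕ-fromℕ< d)) (ℕₚ.m+[n∸m]≡n y≤f)))
      where
      y≤f = ℕₚ.≮⇒≥ ¬l
      d : toℕ f ∸ y < n ∸ y
      d = ℕₚ.∸-monoˡ-< (Fₚ.toℕ<n f) y≤f

    FM : Fin (n ∸ y) → Factor G M
    FM i = factor (closed _ (closed-colour i))

    FN : Fin y → Factor G (M ℕ.* n)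
    FN j = factor (ham _ (ham-colour j))

    EdgeIn : Row → V G → V G → Set
    EdgeIn (inj₁ i) = EdgeOfFactor (FM i)
    EdgeIn (inj₂ j) = EdgeOfFactor (FN j)

    EdgeIn-sym : ∀ t {u w} → EdgeIn t u w → EdgeIn t w u
    EdgeIn-sym (inj₁ i) = EdgeOfFactor-sym (FM i)
    EdgeIn-sym (inj₂ j) = EdgeOfFactor-sym (FN j)

    EdgeIn⇔ : ∀ t x a b → EdgeIn t (x , a) (next x , b) ⇔ E (colour t) x a b
    EdgeIn⇔ (inj₁ i) = edges (closed _ (closed-colour i))
    EdgeIn⇔ (inj₂ j) = edges (ham _ (ham-colour j))

    Exact : V G → V G → Set
    Exact u w = (∃[ t ] EdgeIn t u w) × (∀ s t → EdgeIn s u w → EdgeIn t u w → s ≡ t)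

    exact-next : ∀ x a b → Exact (x , a) (next x , b)
    exact-next x a b with one x a b
    ... | f , Ef , unique with colour-surjective f
    ...   | t , refl = (t , Equivalence.from (EdgeIn⇔ t x a b) Ef) ,
      λ s s′ h h′ → colour-injective s s′ (trans (unique _ (Equivalence.to (EdgeIn⇔ s x a b) h))
                                             (sym (unique _ (Equivalence.to (EdgeIn⇔ s′ x a b) h′))))

    exact : ∀ u w → Adj G u w → Exact u w
    exact (x , a) (x′ , b) (inj₁ refl) = exact-next x a b
    exact (x , a) (x′ , b) (inj₂ refl) with exact-next x′ b a
    ... | (t , h) , unique = (t , EdgeIn-sym t h) , λ s s′ h h′ → unique s s′ (EdgeIn-sym s h) (EdgeIn-sym s′ h′)

  -- The colours below y are the Hamiltonian rows, those from y on the closed ones; edges read from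
  -- `next x` to x are covered by symmetry.
  factors⇒InHWP : InHWP G M (M ℕ.* n) (n ∸ y , y)
  factors⇒InHWP = FM , FN , λ u w uw →
    -- `InHWP` states its edge relation by an anonymous function defined by cases, which agrees with
    -- `EdgeIn` only once the row has been split.
    (case proj₁ (exact u w uw) of λ { (inj₁ i , h) → inj₁ i , h ; (inj₂ j , h) → inj₂ j , h }) ,
    λ { s@(inj₁ _) t@(inj₁ _) → proj₂ (exact u w uw) s t
      ; s@(inj₁ _) t@(inj₂ _) → proj₂ (exact u w uw) s t
      ; s@(inj₂ _) t@(inj₁ _) → proj₂ (exact u w uw) s t
      ; s@(inj₂ _) t@(inj₂ _) → proj₂ (exact u w uw) s t }

-- Arithmetic modulo n

module _ where
  open import Data.Integer using (_+_; _-_; _*_; -_)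

  module Residues (n : ℕ) where

    infix 4 _≈_
    record _≈_ (i j : ℤ) : Set where
      constructor mod
      field
        quot : ℤ
        difference : i - j ≡ quot * + n
    open _≈_ public

    ≡⇒≈ : ∀ {i j} → i ≡ j → i ≈ j
    ≡⇒≈ {i} refl = mod 0ℤ (ℤₚ.+-inverseʳ i)

    -- Congruences are proved by certificates: i - j is a combination, with chosen coefficients, of
    -- the known differences and n. What remains is an identity for the ring solver.
    lin₂ : ∀ c d k {a b a′ b′ i j} → a ≈ b → a′ ≈ b′ → i - j ≡ c * (a - b) + d * (a′ - b′) + k * + n → i ≈ j
    lin₂ c d k (mod q e) (mod q′ e′) h = mod (c * q + d * q′ + k)
      (trans h (trans (cong₂ (λ u v → c * u + d * v + k * + n) e e′) (factorise c d k q q′ (+ n))))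
      where
      factorise : ∀ c d k q q′ N → c * (q * N) + d * (q′ * N) + k * N ≡ (c * q + d * q′ + k) * N
      factorise = solve-∀

    lin₁ : ∀ c k {a b i j} → a ≈ b → i - j ≡ c * (a - b) + k * + n → i ≈ j
    lin₁ c k (mod q e) h = mod (c * q + k)
      (trans h (trans (cong (λ u → c * u + k * + n) e) (factorise c k q (+ n))))
      where
      factorise : ∀ c k q N → c * (q * N) + k * N ≡ (c * q + k) * N
      factorise = solve-∀

    ≈-refl : ∀ {i} → i ≈ i
    ≈-refl = ≡⇒≈ refl

    ≈-sym : ∀ {i j} → i ≈ j → j ≈ i
    ≈-sym {i} {j} p = lin₁ (- 1ℤ) 0ℤ p (lemma i j (+ n))
      where
      lemma : ∀ i j N → j - i ≡ (- 1ℤ) * (i - j) + 0ℤ * N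
      lemma = solve-∀

    ≈-trans : ∀ {i j k} → i ≈ j → j ≈ k → i ≈ k
    ≈-trans {i} {j} {k} p q = lin₂ 1ℤ 1ℤ 0ℤ p q (lemma i j k (+ n))
      where
      lemma : ∀ i j k N → i - k ≡ 1ℤ * (i - j) + 1ℤ * (j - k) + 0ℤ * N
      lemma = solve-∀

    ≈-+ : ∀ {a b c d} → a ≈ b → c ≈ d → a + c ≈ b + d
    ≈-+ {a} {b} {c} {d} p q = lin₂ 1ℤ 1ℤ 0ℤ p q (lemma a b c d (+ n))
      where
      lemma : ∀ a b c d N → a + c - (b + d) ≡ 1ℤ * (a - b) + 1ℤ * (c - d) + 0ℤ * N
      lemma = solve-∀

    ≈-neg : ∀ {a b} → a ≈ b → - a ≈ - b
    ≈-neg {a} {b} p = lin₁ (- 1ℤ) 0ℤ p (lemma a b (+ n))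
      where
      lemma : ∀ a b N → - a - - b ≡ (- 1ℤ) * (a - b) + 0ℤ * N
      lemma = solve-∀

    ≈-- : ∀ {a b c d} → a ≈ b → c ≈ d → a - c ≈ b - d
    ≈-- p q = ≈-+ p (≈-neg q)

    ≈-*ˡ : ∀ c {a b} → a ≈ b → c * a ≈ c * b
    ≈-*ˡ c {a} {b} p = lin₁ c 0ℤ p (lemma a b c (+ n))
      where
      lemma : ∀ a b c N → c * a - c * b ≡ c * (a - b) + 0ℤ * N
      lemma = solve-∀

    n≈0 : + n ≈ 0ℤ
    n≈0 = mod 1ℤ (lemma (+ n))
      where
      lemma : ∀ N → N - 0ℤ ≡ 1ℤ * N
      lemma = solve-∀

    unit-cancel : ∀ c c⁻¹ {a b} → c⁻¹ * c ≈ 1ℤ → c * a ≈ c * b → a ≈ b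
    unit-cancel c c⁻¹ {a} {b} u p = lin₂ (b - a) c⁻¹ 0ℤ u p (lemma c c⁻¹ a b (+ n))
      where
      lemma : ∀ c d a b N → a - b ≡ (b - a) * (d * c - 1ℤ) + d * (c * a - c * b) + 0ℤ * N
      lemma = solve-∀

    -- If i - j = q n, then |q| n < n leaves only q = 0.
    +-injective : ∀ {i j} → i ℕ.< n → j ℕ.< n → + i ≈ + j → i ≡ j
    +-injective {i} {j} i<n j<n (mod q e) = ℤₚ.+-injective (ℤₚ.i-j≡0⇒i≡j (+ i) (+ j) (trans e (cong (_* + n) q≡0)))
      where
      bound : ∣ q ∣ ℕ.* n ℕ.< n
      bound = subst (ℕ._< n) (trans (cong ∣_∣ (trans (sym (ℤₚ.m-n≡m⊖n i j)) e)) (ℤₚ.abs-* q (+ n)))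
                (ℕₚ.≤-<-trans (ℤₚ.∣m⊝n∣≤m⊔n i j) (ℕₚ.⊔-lub i<n j<n))
      small : ∀ k → k ℕ.* n ℕ.< n → k ≡ 0
      small zero _ = refl
      small (suc k) l = ⊥-elim (ℕₚ.m+n≮m n (k ℕ.* n) l)
      q≡0 : q ≡ 0ℤ
      q≡0 = ℤₚ.∣i∣≡0⇒i≡0 (small ∣ q ∣ bound)

    +≢≈0 : ∀ {i} → 0 ℕ.< i → i ℕ.< n → ¬ (+ i ≈ 0ℤ)
    +≢≈0 0<i i<n e = ℕₚ.<⇒≢ 0<i (sym (+-injective i<n (ℕₚ.<-trans 0<i i<n) e))

    ι : Fin n → ℤ
    ι a = + toℕ a

    ι-injective : ∀ {a b} → ι a ≈ ι b → a ≡ b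
    ι-injective {a} {b} e = Fₚ.toℕ-injective (+-injective (Fₚ.toℕ<n a) (Fₚ.toℕ<n b) e)

    module _ {{_ : NonZero n}} where

      abstract
        res : ℤ → Fin n
        res i = fromℕ< (n%ℕd<d i n)

        ι-res : ∀ i → ι (res i) ≈ i
        ι-res i = ≈-trans (≡⇒≈ (cong +_ (Fₚ.toℕ-fromℕ< (n%ℕd<d i n))))
          (≈-sym (mod (i /ℕ n) (trans (cong (λ z → z - + (i %ℕ n)) (a≡a%ℕn+[a/ℕn]*n i n)) (lemma (+ (i %ℕ n)) (i /ℕ n * + n)))))
          where
          lemma : ∀ r q → r + q - r ≡ q
          lemma = solve-∀

      res-cong : ∀ {i j} → i ≈ j → res i ≡ res j
      res-cong {i} {j} e = ι-injective (≈-trans (ι-res i) (≈-trans e (≈-sym (ι-res j))))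

      res-injective : ∀ {i j} → res i ≡ res j → i ≈ j
      res-injective {i} {j} e = ≈-trans (≈-sym (ι-res i)) (≈-trans (≡⇒≈ (cong ι e)) (ι-res j))

      res-shift-injective : ∀ u c → (∀ {a b} → u * a ≈ u * b → a ≈ b) → Injective _≡_ _≡_ (λ a → res (u * (ι a - c)))
      res-shift-injective u c cancel {a} {b} e = ι-injective (lin₁ 1ℤ 0ℤ (cancel (res-injective e)) (lemma (ι a) (ι b) c (+ n)))
        where
        lemma : ∀ a b c N → a - b ≡ 1ℤ * ((a - c) - (b - c)) + 0ℤ * N
        lemma = solve-∀

-- Orthogonal Latin squares

-- A transversal design with k groups, each identified with X; for k = 4 this is a pair of
-- orthogonal Latin squares indexed by X.
record TD (k : ℕ) (X : Set) : Set₁ where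
  field
    Block  : Set
    pt     : Block → Fin k → X
    block  : ∀ c d → c ≢ d → ∀ x y → ∃[ B ] (pt B c ≡ x × pt B d ≡ y)
    unique : ∀ c d → c ≢ d → ∀ B B′ → pt B c ≡ pt B′ c → pt B d ≡ pt B′ d → ∀ e → pt B e ≡ pt B′ e
open TD public

mapTD : ∀ {k X Y} → X ↔ Y → TD k X → TD k Y
mapTD X↔Y T = record
  { Block = Block T
  ; pt = λ B c → to (pt T B c)
  ; block = λ c d c≢d x y → case block T c d c≢d (from x) (from y) of λ
      { (B , e , e′) → B , trans (cong to e) (strictlyInverseˡ x) , trans (cong to e′) (strictlyInverseˡ y) }
  ; unique = λ c d c≢d B B′ e e′ f → cong to (unique T c d c≢d B B′ (to-injective e) (to-injective e′) f)
  }
  where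
  open Inverse X↔Y
  to-injective : Injective _≡_ _≡_ to
  to-injective {x} {y} e = trans (sym (strictlyInverseʳ x)) (trans (cong from e) (strictlyInverseʳ y))

productTD : ∀ {k X Y} → TD k X → TD k Y → TD k (X × Y)
productTD S T = record
  { Block = Block S × Block T
  ; pt = λ (B , C) c → pt S B c , pt T C c
  ; block = λ c d c≢d (x , x′) (y , y′) → case (block S c d c≢d x y , block T c d c≢d x′ y′) of λ
      { ((B , e , e′) , (C , f , f′)) → (B , C) , cong₂ _,_ e f , cong₂ _,_ e′ f′ }
  ; unique = λ c d c≢d (B , C) (B′ , C′) e e′ f → cong₂ _,_
      (unique S c d c≢d B B′ (,-injectiveˡ e) (,-injectiveˡ e′) f)
      (unique T c d c≢d C C′ (,-injectiveʳ e) (,-injectiveʳ e′) f)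
  }

-- A right inverse g of f is injective, hence onto by pigeonhole, hence two-sided.
surjective⇒injective : ∀ {n} (f : Fin n → Fin n) → (∀ y → ∃[ x ] f x ≡ y) → Injective _≡_ _≡_ f
surjective⇒injective f surj {x} {x′} e = trans (sym (gf x)) (trans (cong g e) (gf x′))
  where
  g = proj₁ ∘ surj
  fg = proj₂ ∘ surj
  g-inj : Injective _≡_ _≡_ g
  g-inj {y} {y′} e = trans (sym (fg y)) (trans (cong f e) (fg y′))
  gf : ∀ x → g (f x) ≡ x
  gf x with injective⇒inverseʳ g g-inj x
  ... | y , refl = cong g (fg y)

module _ {n : ℕ} (f : Fin n × Fin n → Fin n × Fin n) where
  private
    open Inverse (Fₚ.*↔× {n} {n})
    f′ : Fin (n ℕ.* n) → Fin (n ℕ.* n)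
    f′ = from ∘ f ∘ to

    from-injective : Injective _≡_ _≡_ from
    from-injective {x} {y} e = trans (sym (strictlyInverseˡ x)) (trans (cong to e) (strictlyInverseˡ y))

  ×-injective⇒surjective : Injective _≡_ _≡_ f → ∀ p → ∃[ q ] f q ≡ p
  ×-injective⇒surjective inj p with injective⇒inverseʳ f′
      (λ {x} {y} e → trans (sym (strictlyInverseʳ x)) (trans (cong from (inj (from-injective e))) (strictlyInverseʳ y))) (from p)
  ... | k , e = to k , from-injective e

  ×-surjective⇒injective : (∀ p → ∃[ q ] f q ≡ p) → Injective _≡_ _≡_ f
  ×-surjective⇒injective surj {p} {q} e = from-injective (surjective⇒injective f′
    (λ k → case surj (to k) of λ { (r , e′) → from r ,
       trans (cong (from ∘ f) (strictlyInverseˡ r)) (trans (cong from e′) (strictlyInverseʳ k)) })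
    (cong from (trans (cong f (strictlyInverseˡ p)) (trans e (cong f (sym (strictlyInverseˡ q)))))))

module _ {k n : ℕ} (p : Fin n × Fin n → Fin k → Fin n) where

  injective⇒TD : (∀ c d → c ≢ d → ∀ B B′ → p B c ≡ p B′ c → p B d ≡ p B′ d → B ≡ B′) → TD k (Fin n)
  injective⇒TD inj = record
    { Block = Fin n × Fin n
    ; pt = p
    ; block = λ c d c≢d x y → case ×-injective⇒surjective (λ B → p B c , p B d)
        (λ {B} {B′} e → inj c d c≢d B B′ (,-injectiveˡ e) (,-injectiveʳ e)) (x , y) of λ
        { (B , e) → B , ,-injectiveˡ e , ,-injectiveʳ e }
    ; unique = λ c d c≢d B B′ e e′ f → cong (λ C → p C f) (inj c d c≢d B B′ e e′)
    }

  -- Surjectivity is what a finite search through a table establishes; counting the n² blocks turns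
  -- it into uniqueness.
  surjective⇒TD : (∀ c d → c ≢ d → ∀ x y → ∃[ B ] (p B c ≡ x × p B d ≡ y)) → TD k (Fin n)
  surjective⇒TD surj = injective⇒TD (λ c d c≢d B B′ e e′ →
    ×-surjective⇒injective (λ C → p C c , p C d)
      (λ (x , y) → case surj c d c≢d x y of λ { (B , f , f′) → B , cong₂ _,_ f f′ })
      (cong₂ _,_ e e′))

-- Group 0 records the slope j of the line c ↦ i + c j, group c + 1 its value at c.
module _ (n : ℕ) {{_ : NonZero n}} where
  open Residues n

  cyclicTD : ∀ k → (∀ d → 1 ≤ d → d < k → ∃[ w ] w ℤ.* + d ≈ 1ℤ) → TD (suc k) (Fin n)
  cyclicTD k unit = injective⇒TD pt′ determined
    where
    value : ℤ → ℤ → ℤ → ℤ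
    value i j c = i ℤ.+ c ℤ.* j
    pt′ : Fin n × Fin n → Fin (suc k) → Fin n
    pt′ (i , j) zero = j
    pt′ (i , j) (suc c) = res (value (ι i) (ι j) (+ toℕ c))

    base-eq : ∀ {i i′ j} c → res (value (ι i) (ι j) c) ≡ res (value (ι i′) (ι j) c) → i ≡ i′
    base-eq {i} {i′} {j} c e = ι-injective (lin₁ 1ℤ 0ℤ (res-injective e) (lemma (ι i) (ι i′) (c ℤ.* ι j) (+ n)))
      where
      lemma : ∀ i i′ x N → i ℤ.- i′ ≡ 1ℤ ℤ.* ((i ℤ.+ x) ℤ.- (i′ ℤ.+ x)) ℤ.+ 0ℤ ℤ.* N
      lemma = solve-∀

    -- Subtracting the two equations gives (d - c) (j - j′) ≈ 0, where d - c is a unit.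
    slope-eq : ∀ {i i′ j j′} (c d : ℕ) → c < d → d < k →
      res (value (ι i) (ι j) (+ c)) ≡ res (value (ι i′) (ι j′) (+ c)) →
      res (value (ι i) (ι j) (+ d)) ≡ res (value (ι i′) (ι j′) (+ d)) → j ≡ j′
    slope-eq {i} {i′} {j} {j′} c d c<d d<k e e′ with unit (d ℕ.∸ c) (ℕₚ.m<n⇒0<n∸m c<d) (ℕₚ.≤-<-trans (ℕₚ.m∸n≤m d c) d<k)
    ... | w , u = ι-injective (unit-cancel (+ (d ℕ.∸ c)) w u (lin₂ 1ℤ (ℤ.- 1ℤ) 0ℤ (res-injective e′) (res-injective e)
          (trans (lemma (ι i) (ι i′) (ι j) (ι j′) (+ c) (+ (d ℕ.∸ c)) (+ n))
             (cong (λ z → 1ℤ ℤ.* (value (ι i) (ι j) z ℤ.- value (ι i′) (ι j′) z) ℤ.+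
                          ℤ.- 1ℤ ℤ.* (value (ι i) (ι j) (+ c) ℤ.- value (ι i′) (ι j′) (+ c)) ℤ.+ 0ℤ ℤ.* + n)
                   (cong +_ (ℕₚ.m+[n∸m]≡n (ℕₚ.<⇒≤ c<d)))))))
      where
      lemma : ∀ i i′ j j′ c e N → e ℤ.* j ℤ.- e ℤ.* j′ ≡
        1ℤ ℤ.* ((i ℤ.+ (c ℤ.+ e) ℤ.* j) ℤ.- (i′ ℤ.+ (c ℤ.+ e) ℤ.* j′)) ℤ.+
        ℤ.- 1ℤ ℤ.* ((i ℤ.+ c ℤ.* j) ℤ.- (i′ ℤ.+ c ℤ.* j′)) ℤ.+ 0ℤ ℤ.* N
      lemma = solve-∀

    determined : ∀ c d → c ≢ d → ∀ B B′ → pt′ B c ≡ pt′ B′ c → pt′ B d ≡ pt′ B′ d → B ≡ B′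
    determined zero zero c≢d _ _ _ _ = ⊥-elim (c≢d refl)
    determined zero (suc d) _ (i , j) (i′ , _) refl e = cong (_, j) (base-eq (+ toℕ d) e)
    determined (suc c) zero _ (i , j) (i′ , _) e refl = cong (_, j) (base-eq (+ toℕ c) e)
    determined (suc c) (suc d) c≢d (i , j) (i′ , j′) e e′ with j≡j′
      where
      j≡j′ : j ≡ j′
      j≡j′ with ℕₚ.<-cmp (toℕ c) (toℕ d)
      ... | tri< l _ _ = slope-eq {i} {i′} (toℕ c) (toℕ d) l (Fₚ.toℕ<n d) e e′
      ... | tri≈ _ q _ = ⊥-elim (c≢d (cong suc (Fₚ.toℕ-injective q)))
      ... | tri> _ _ l = slope-eq {i} {i′} (toℕ d) (toℕ c) l (Fₚ.toℕ<n c) e′ e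
    ... | refl = cong (_, j) (base-eq (+ toℕ c) e)

-- The three positions 0, 1, 2 differ by 1 or 2 only, both units modulo an odd number.
oddMOLS : ∀ k → TD 4 (Fin (suc (2 ℕ.* k)))
oddMOLS k = cyclicTD (suc (2 ℕ.* k)) 3 units
  where
  open Residues (suc (2 ℕ.* k))
  half : ∀ k → (1ℤ ℤ.+ k) ℤ.* + 2 ℤ.- 1ℤ ≡ 1ℤ ℤ.* (1ℤ ℤ.+ (+ 2) ℤ.* k)
  half = solve-∀
  units : ∀ d → 1 ≤ d → d < 3 → ∃[ w ] w ℤ.* + d ≈ 1ℤ
  units 1 _ _ = 1ℤ , ≈-refl
  units 2 _ _ = + suc k , mod 1ℤ (trans (half (+ k)) (cong (λ z → 1ℤ ℤ.* (1ℤ ℤ.+ z)) (sym (ℤₚ.pos-* 2 k))))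
  units (suc (suc (suc d))) _ l = ⊥-elim (ℕₚ.<⇒≱ l (s≤s (s≤s (s≤s z≤n))))

Table : ℕ → Set
Table n = Vec (Vec ℕ n) n

module _ {n : ℕ} {{_ : NonZero n}} (L M : Table n) where
  private
    entry : Table n → Fin n → Fin n → Fin n
    entry T x y = lookup (lookup T x) y mod n

    p : Fin n × Fin n → Fin 4 → Fin n
    p (x , y) 0F = x
    p (x , y) 1F = y
    p (x , y) 2F = entry L x y
    p (x , y) 3F = entry M x y

    RowsFull ColumnsFull : Table n → Set
    RowsFull T = ∀ x v → ∃[ y ] entry T x y ≡ v
    ColumnsFull T = ∀ y v → ∃[ x ] entry T x y ≡ v

    rowsFull? : ∀ T → Dec (RowsFull T)
    rowsFull? T = Fₚ.all? λ x → Fₚ.all? λ v → Fₚ.any? λ y → entry T x y ≟ v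

    columnsFull? : ∀ T → Dec (ColumnsFull T)
    columnsFull? T = Fₚ.all? λ y → Fₚ.all? λ v → Fₚ.any? λ x → entry T x y ≟ v

    Orthogonal : Set
    Orthogonal = ∀ v w → ∃[ x ] ∃[ y ] (entry L x y ≡ v × entry M x y ≡ w)

    orthogonal? : Dec Orthogonal
    orthogonal? = Fₚ.all? λ v → Fₚ.all? λ w → Fₚ.any? λ x → Fₚ.any? λ y → (entry L x y ≟ v) ×-dec (entry M x y ≟ w)

  tableTD : {_ : True (rowsFull? L)} {_ : True (columnsFull? L)} {_ : True (rowsFull? M)} {_ : True (columnsFull? M)}
            {_ : True orthogonal?} → TD 4 (Fin n)
  tableTD {rl} {cl} {rm} {cm} {o} = surjective⇒TD p hit
    where
    Hit : Fin 4 → Fin 4 → Set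
    Hit c d = ∀ x y → ∃[ B ] (p B c ≡ x × p B d ≡ y)

    flip-hit : ∀ c d → Hit c d → Hit d c
    flip-hit c d h x y with h y x
    ... | B , e , e′ = B , e′ , e

    hit₀₁ : Hit 0F 1F
    hit₀₁ x y = (x , y) , refl , refl
    hit₀₂ : Hit 0F 2F
    hit₀₂ x v with toWitness {a? = rowsFull? L} rl x v
    ... | y , e = (x , y) , refl , e
    hit₀₃ : Hit 0F 3F
    hit₀₃ x v with toWitness {a? = rowsFull? M} rm x v
    ... | y , e = (x , y) , refl , e
    hit₁₂ : Hit 1F 2F
    hit₁₂ y v with toWitness {a? = columnsFull? L} cl y v
    ... | x , e = (x , y) , refl , e
    hit₁₃ : Hit 1F 3F
    hit₁₃ y v with toWitness {a? = columnsFull? M} cm y v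
    ... | x , e = (x , y) , refl , e
    hit₂₃ : Hit 2F 3F
    hit₂₃ v w with toWitness {a? = orthogonal?} o v w
    ... | x , y , e , e′ = (x , y) , e , e′

    hit : ∀ c d → c ≢ d → Hit c d
    hit 0F 0F c≢d = ⊥-elim (c≢d refl)
    hit 0F 1F _ = hit₀₁
    hit 0F 2F _ = hit₀₂
    hit 0F 3F _ = hit₀₃
    hit 1F 0F _ = flip-hit 0F 1F hit₀₁
    hit 1F 1F c≢d = ⊥-elim (c≢d refl)
    hit 1F 2F _ = hit₁₂
    hit 1F 3F _ = hit₁₃
    hit 2F 0F _ = flip-hit 0F 2F hit₀₂
    hit 2F 1F _ = flip-hit 1F 2F hit₁₂
    hit 2F 2F c≢d = ⊥-elim (c≢d refl)
    hit 2F 3F _ = hit₂₃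
    hit 3F 0F _ = flip-hit 0F 3F hit₀₃
    hit 3F 1F _ = flip-hit 1F 3F hit₁₃
    hit 3F 2F _ = flip-hit 2F 3F hit₂₃
    hit 3F 3F c≢d = ⊥-elim (c≢d refl)

-- Over the field of order 4, in binary notation with α = 2 and α² = α + 1: the square is x + y, its
-- mate x + α y.
square4 : Table 4
square4 =
  (0 ∷ 1 ∷ 2 ∷ 3 ∷ []) ∷
  (1 ∷ 0 ∷ 3 ∷ 2 ∷ []) ∷
  (2 ∷ 3 ∷ 0 ∷ 1 ∷ []) ∷
  (3 ∷ 2 ∷ 1 ∷ 0 ∷ []) ∷ []

mate4 : Table 4
mate4 =
  (0 ∷ 2 ∷ 3 ∷ 1 ∷ []) ∷
  (1 ∷ 3 ∷ 2 ∷ 0 ∷ []) ∷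
  (2 ∷ 0 ∷ 1 ∷ 3 ∷ []) ∷
  (3 ∷ 1 ∷ 0 ∷ 2 ∷ []) ∷ []

mols4 : TD 4 (Fin 4)
mols4 = tableTD square4 mate4

-- As for order 4: x + y and x + α y over the field of order 8, with α = 2 and α³ = α + 1.
square8 : Table 8
square8 =
  (0 ∷ 1 ∷ 2 ∷ 3 ∷ 4 ∷ 5 ∷ 6 ∷ 7 ∷ []) ∷
  (1 ∷ 0 ∷ 3 ∷ 2 ∷ 5 ∷ 4 ∷ 7 ∷ 6 ∷ []) ∷
  (2 ∷ 3 ∷ 0 ∷ 1 ∷ 6 ∷ 7 ∷ 4 ∷ 5 ∷ []) ∷
  (3 ∷ 2 ∷ 1 ∷ 0 ∷ 7 ∷ 6 ∷ 5 ∷ 4 ∷ []) ∷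
  (4 ∷ 5 ∷ 6 ∷ 7 ∷ 0 ∷ 1 ∷ 2 ∷ 3 ∷ []) ∷
  (5 ∷ 4 ∷ 7 ∷ 6 ∷ 1 ∷ 0 ∷ 3 ∷ 2 ∷ []) ∷
  (6 ∷ 7 ∷ 4 ∷ 5 ∷ 2 ∷ 3 ∷ 0 ∷ 1 ∷ []) ∷
  (7 ∷ 6 ∷ 5 ∷ 4 ∷ 3 ∷ 2 ∷ 1 ∷ 0 ∷ []) ∷ []

mate8 : Table 8
mate8 =
  (0 ∷ 2 ∷ 4 ∷ 6 ∷ 3 ∷ 1 ∷ 7 ∷ 5 ∷ []) ∷
  (1 ∷ 3 ∷ 5 ∷ 7 ∷ 2 ∷ 0 ∷ 6 ∷ 4 ∷ []) ∷
  (2 ∷ 0 ∷ 6 ∷ 4 ∷ 1 ∷ 3 ∷ 5 ∷ 7 ∷ []) ∷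
  (3 ∷ 1 ∷ 7 ∷ 5 ∷ 0 ∷ 2 ∷ 4 ∷ 6 ∷ []) ∷
  (4 ∷ 6 ∷ 0 ∷ 2 ∷ 7 ∷ 5 ∷ 3 ∷ 1 ∷ []) ∷
  (5 ∷ 7 ∷ 1 ∷ 3 ∷ 6 ∷ 4 ∷ 2 ∷ 0 ∷ []) ∷
  (6 ∷ 4 ∷ 2 ∷ 0 ∷ 5 ∷ 7 ∷ 1 ∷ 3 ∷ []) ∷
  (7 ∷ 5 ∷ 3 ∷ 1 ∷ 4 ∷ 6 ∷ 0 ∷ 2 ∷ []) ∷ []

mols8 : TD 4 (Fin 8)
mols8 = tableTD square8 mate8

-- Order 7 + 3: adding 1 mod 7 to rows, columns and symbols below 7, with 7, 8, 9 fixed, is a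
-- symmetry of the square. `mate10` is the transpose except in the last 3 by 3 corner, which is
-- filled by an orthogonal mate of the corner here.
square10 : Table 10
square10 =
  (0 ∷ 6 ∷ 5 ∷ 4 ∷ 9 ∷ 8 ∷ 7 ∷ 1 ∷ 2 ∷ 3 ∷ []) ∷
  (7 ∷ 1 ∷ 0 ∷ 6 ∷ 5 ∷ 9 ∷ 8 ∷ 2 ∷ 3 ∷ 4 ∷ []) ∷
  (8 ∷ 7 ∷ 2 ∷ 1 ∷ 0 ∷ 6 ∷ 9 ∷ 3 ∷ 4 ∷ 5 ∷ []) ∷
  (9 ∷ 8 ∷ 7 ∷ 3 ∷ 2 ∷ 1 ∷ 0 ∷ 4 ∷ 5 ∷ 6 ∷ []) ∷
  (1 ∷ 9 ∷ 8 ∷ 7 ∷ 4 ∷ 3 ∷ 2 ∷ 5 ∷ 6 ∷ 0 ∷ []) ∷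
  (3 ∷ 2 ∷ 9 ∷ 8 ∷ 7 ∷ 5 ∷ 4 ∷ 6 ∷ 0 ∷ 1 ∷ []) ∷
  (5 ∷ 4 ∷ 3 ∷ 9 ∷ 8 ∷ 7 ∷ 6 ∷ 0 ∷ 1 ∷ 2 ∷ []) ∷
  (2 ∷ 3 ∷ 4 ∷ 5 ∷ 6 ∷ 0 ∷ 1 ∷ 7 ∷ 8 ∷ 9 ∷ []) ∷
  (4 ∷ 5 ∷ 6 ∷ 0 ∷ 1 ∷ 2 ∷ 3 ∷ 8 ∷ 9 ∷ 7 ∷ []) ∷
  (6 ∷ 0 ∷ 1 ∷ 2 ∷ 3 ∷ 4 ∷ 5 ∷ 9 ∷ 7 ∷ 8 ∷ []) ∷ []

mate10 : Table 10
mate10 =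
  (0 ∷ 7 ∷ 8 ∷ 9 ∷ 1 ∷ 3 ∷ 5 ∷ 2 ∷ 4 ∷ 6 ∷ []) ∷
  (6 ∷ 1 ∷ 7 ∷ 8 ∷ 9 ∷ 2 ∷ 4 ∷ 3 ∷ 5 ∷ 0 ∷ []) ∷
  (5 ∷ 0 ∷ 2 ∷ 7 ∷ 8 ∷ 9 ∷ 3 ∷ 4 ∷ 6 ∷ 1 ∷ []) ∷
  (4 ∷ 6 ∷ 1 ∷ 3 ∷ 7 ∷ 8 ∷ 9 ∷ 5 ∷ 0 ∷ 2 ∷ []) ∷
  (9 ∷ 5 ∷ 0 ∷ 2 ∷ 4 ∷ 7 ∷ 8 ∷ 6 ∷ 1 ∷ 3 ∷ []) ∷
  (8 ∷ 9 ∷ 6 ∷ 1 ∷ 3 ∷ 5 ∷ 7 ∷ 0 ∷ 2 ∷ 4 ∷ []) ∷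
  (7 ∷ 8 ∷ 9 ∷ 0 ∷ 2 ∷ 4 ∷ 6 ∷ 1 ∷ 3 ∷ 5 ∷ []) ∷
  (1 ∷ 2 ∷ 3 ∷ 4 ∷ 5 ∷ 6 ∷ 0 ∷ 7 ∷ 9 ∷ 8 ∷ []) ∷
  (2 ∷ 3 ∷ 4 ∷ 5 ∷ 6 ∷ 0 ∷ 1 ∷ 8 ∷ 7 ∷ 9 ∷ []) ∷
  (3 ∷ 4 ∷ 5 ∷ 6 ∷ 0 ∷ 1 ∷ 2 ∷ 9 ∷ 8 ∷ 7 ∷ []) ∷ []

mols10 : TD 4 (Fin 10)
mols10 = tableTD square10 mate10

-- Order 11 + 3: this square and `mate14` are both invariant under adding 1 mod 11 to rows, columns
-- and symbols below 11, with 11, 12, 13 fixed.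
square14 : Table 14
square14 =
  (0 ∷ 3 ∷ 11 ∷ 10 ∷ 9 ∷ 13 ∷ 4 ∷ 12 ∷ 7 ∷ 6 ∷ 5 ∷ 8 ∷ 1 ∷ 2 ∷ []) ∷
  (6 ∷ 1 ∷ 4 ∷ 11 ∷ 0 ∷ 10 ∷ 13 ∷ 5 ∷ 12 ∷ 8 ∷ 7 ∷ 9 ∷ 2 ∷ 3 ∷ []) ∷
  (8 ∷ 7 ∷ 2 ∷ 5 ∷ 11 ∷ 1 ∷ 0 ∷ 13 ∷ 6 ∷ 12 ∷ 9 ∷ 10 ∷ 3 ∷ 4 ∷ []) ∷
  (10 ∷ 9 ∷ 8 ∷ 3 ∷ 6 ∷ 11 ∷ 2 ∷ 1 ∷ 13 ∷ 7 ∷ 12 ∷ 0 ∷ 4 ∷ 5 ∷ []) ∷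
  (12 ∷ 0 ∷ 10 ∷ 9 ∷ 4 ∷ 7 ∷ 11 ∷ 3 ∷ 2 ∷ 13 ∷ 8 ∷ 1 ∷ 5 ∷ 6 ∷ []) ∷
  (9 ∷ 12 ∷ 1 ∷ 0 ∷ 10 ∷ 5 ∷ 8 ∷ 11 ∷ 4 ∷ 3 ∷ 13 ∷ 2 ∷ 6 ∷ 7 ∷ []) ∷
  (13 ∷ 10 ∷ 12 ∷ 2 ∷ 1 ∷ 0 ∷ 6 ∷ 9 ∷ 11 ∷ 5 ∷ 4 ∷ 3 ∷ 7 ∷ 8 ∷ []) ∷
  (5 ∷ 13 ∷ 0 ∷ 12 ∷ 3 ∷ 2 ∷ 1 ∷ 7 ∷ 10 ∷ 11 ∷ 6 ∷ 4 ∷ 8 ∷ 9 ∷ []) ∷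
  (7 ∷ 6 ∷ 13 ∷ 1 ∷ 12 ∷ 4 ∷ 3 ∷ 2 ∷ 8 ∷ 0 ∷ 11 ∷ 5 ∷ 9 ∷ 10 ∷ []) ∷
  (11 ∷ 8 ∷ 7 ∷ 13 ∷ 2 ∷ 12 ∷ 5 ∷ 4 ∷ 3 ∷ 9 ∷ 1 ∷ 6 ∷ 10 ∷ 0 ∷ []) ∷
  (2 ∷ 11 ∷ 9 ∷ 8 ∷ 13 ∷ 3 ∷ 12 ∷ 6 ∷ 5 ∷ 4 ∷ 10 ∷ 7 ∷ 0 ∷ 1 ∷ []) ∷
  (1 ∷ 2 ∷ 3 ∷ 4 ∷ 5 ∷ 6 ∷ 7 ∷ 8 ∷ 9 ∷ 10 ∷ 0 ∷ 11 ∷ 12 ∷ 13 ∷ []) ∷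
  (3 ∷ 4 ∷ 5 ∷ 6 ∷ 7 ∷ 8 ∷ 9 ∷ 10 ∷ 0 ∷ 1 ∷ 2 ∷ 12 ∷ 13 ∷ 11 ∷ []) ∷
  (4 ∷ 5 ∷ 6 ∷ 7 ∷ 8 ∷ 9 ∷ 10 ∷ 0 ∷ 1 ∷ 2 ∷ 3 ∷ 13 ∷ 11 ∷ 12 ∷ []) ∷ []

mate14 : Table 14
mate14 =
  (0 ∷ 11 ∷ 10 ∷ 12 ∷ 13 ∷ 7 ∷ 1 ∷ 8 ∷ 2 ∷ 5 ∷ 3 ∷ 9 ∷ 4 ∷ 6 ∷ []) ∷
  (4 ∷ 1 ∷ 11 ∷ 0 ∷ 12 ∷ 13 ∷ 8 ∷ 2 ∷ 9 ∷ 3 ∷ 6 ∷ 10 ∷ 5 ∷ 7 ∷ []) ∷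
  (7 ∷ 5 ∷ 2 ∷ 11 ∷ 1 ∷ 12 ∷ 13 ∷ 9 ∷ 3 ∷ 10 ∷ 4 ∷ 0 ∷ 6 ∷ 8 ∷ []) ∷
  (5 ∷ 8 ∷ 6 ∷ 3 ∷ 11 ∷ 2 ∷ 12 ∷ 13 ∷ 10 ∷ 4 ∷ 0 ∷ 1 ∷ 7 ∷ 9 ∷ []) ∷
  (1 ∷ 6 ∷ 9 ∷ 7 ∷ 4 ∷ 11 ∷ 3 ∷ 12 ∷ 13 ∷ 0 ∷ 5 ∷ 2 ∷ 8 ∷ 10 ∷ []) ∷
  (6 ∷ 2 ∷ 7 ∷ 10 ∷ 8 ∷ 5 ∷ 11 ∷ 4 ∷ 12 ∷ 13 ∷ 1 ∷ 3 ∷ 9 ∷ 0 ∷ []) ∷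
  (2 ∷ 7 ∷ 3 ∷ 8 ∷ 0 ∷ 9 ∷ 6 ∷ 11 ∷ 5 ∷ 12 ∷ 13 ∷ 4 ∷ 10 ∷ 1 ∷ []) ∷
  (13 ∷ 3 ∷ 8 ∷ 4 ∷ 9 ∷ 1 ∷ 10 ∷ 7 ∷ 11 ∷ 6 ∷ 12 ∷ 5 ∷ 0 ∷ 2 ∷ []) ∷
  (12 ∷ 13 ∷ 4 ∷ 9 ∷ 5 ∷ 10 ∷ 2 ∷ 0 ∷ 8 ∷ 11 ∷ 7 ∷ 6 ∷ 1 ∷ 3 ∷ []) ∷
  (8 ∷ 12 ∷ 13 ∷ 5 ∷ 10 ∷ 6 ∷ 0 ∷ 3 ∷ 1 ∷ 9 ∷ 11 ∷ 7 ∷ 2 ∷ 4 ∷ []) ∷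
  (11 ∷ 9 ∷ 12 ∷ 13 ∷ 6 ∷ 0 ∷ 7 ∷ 1 ∷ 4 ∷ 2 ∷ 10 ∷ 8 ∷ 3 ∷ 5 ∷ []) ∷
  (3 ∷ 4 ∷ 5 ∷ 6 ∷ 7 ∷ 8 ∷ 9 ∷ 10 ∷ 0 ∷ 1 ∷ 2 ∷ 11 ∷ 13 ∷ 12 ∷ []) ∷
  (10 ∷ 0 ∷ 1 ∷ 2 ∷ 3 ∷ 4 ∷ 5 ∷ 6 ∷ 7 ∷ 8 ∷ 9 ∷ 12 ∷ 11 ∷ 13 ∷ []) ∷
  (9 ∷ 10 ∷ 0 ∷ 1 ∷ 2 ∷ 3 ∷ 4 ∷ 5 ∷ 6 ∷ 7 ∷ 8 ∷ 13 ∷ 12 ∷ 11 ∷ []) ∷ []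

mols14 : TD 4 (Fin 14)
mols14 = tableTD square14 mate14

zeroBlock4 : ∃[ B ] (∀ c → pt mols4 B c ≡ zero)
zeroBlock4 = (zero , zero) , λ { 0F → refl ; 1F → refl ; 2F → refl ; 3F → refl }

-- Wilson's construction.  Give weight m to the first k groups of S and keep only the points
-- below u in its last group.  A block missing these u points is replaced by a copy of T; a
-- block through such a point z by a copy of T′ minus a block, with 0 in the role of z.
module _ {k t m u : ℕ} (S : TD (suc k) (Fin t)) (T : TD k (Fin m)) (T′ : TD k (Fin (suc m)))
         (zeroBlock : ∃[ B ] (∀ c → pt T′ B c ≡ zero)) (u≤t : u ≤ t) (U : TD k (Fin u)) where
  private
    apex : Block S → Fin t
    apex B = pt S B (fromℕ k)

    X : Set
    X = (Fin t × Fin m) ⊎ Fin u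

    -- The blocks carry proofs. As `unique` compares points and never blocks, equality of these
    -- proofs does not arise.
    data Block′ : Set where
      plain  : (B : Block S) → u ≤ toℕ (apex B) → Block T → Block′
      marked : (B : Block S) → toℕ (apex B) < u → (C : Block T′) → ¬ (∀ c → pt T′ C c ≡ zero) → Block′
      corner : Block U → Block′

    place : Fin t → Fin u → Fin (suc m) → X
    place i z zero = inj₂ z
    place i z (suc f) = inj₁ (i , f)

    base : Block S → Fin k → Fin t
    base B c = pt S B (inject₁ c)

    pt′ : Block′ → Fin k → X
    pt′ (plain B _ C) c = inj₁ (base B c , pt T C c)
    pt′ (marked B l C _) c = place (base B c) (fromℕ< l) (pt T′ C c)
    pt′ (corner C) c = inj₂ (pt U C c)

    c≢apex : ∀ {c : Fin k} → inject₁ c ≢ fromℕ k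
    c≢apex e = Fₚ.fromℕ≢inject₁ (sym e)

    lower : ∀ {c d : Fin k} → c ≢ d → inject₁ c ≢ inject₁ d
    lower c≢d = c≢d ∘ Fₚ.inject₁-injective

    place-place : ∀ {i j z w x y} → place i z x ≡ place j w y →
      (x ≡ zero × y ≡ zero × z ≡ w) ⊎ (x ≡ y × i ≡ j)
    place-place {x = zero} {zero} refl = inj₁ (refl , refl , refl)
    place-place {x = suc x} {suc y} refl = inj₂ (refl , refl)

    -- A block of `T′` with two zeros agrees with the deleted one. So no marked block joins two of
    -- the u extra points, and only the corner does.
    twoZeros : ∀ c d → c ≢ d → ∀ C → pt T′ C c ≡ zero → pt T′ C d ≡ zero → ∀ e → pt T′ C e ≡ zero
    twoZeros c d c≢d C p q e = trans (unique T′ c d c≢d C (proj₁ zeroBlock)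
      (trans p (sym (proj₂ zeroBlock c))) (trans q (sym (proj₂ zeroBlock d))) e) (proj₂ zeroBlock e)

    withApex : ∀ c d → c ≢ d → ∀ i f v → ∃[ B ] (pt′ B c ≡ inj₁ (i , f) × pt′ B d ≡ inj₂ v)
    withApex c d c≢d i f v with block S (inject₁ c) (fromℕ k) c≢apex i (inject≤ v u≤t) | block T′ c d c≢d (suc f) zero
    ... | B , e , z | C , g , h = marked B l C (λ all → case trans (sym (all c)) g of λ ()) ,
        trans (cong₂ (λ i x → place i (fromℕ< l) x) e g) refl ,
        trans (cong (place (base B d) (fromℕ< l)) h) (cong inj₂ (Fₚ.toℕ-injective (trans (Fₚ.toℕ-fromℕ< l) z≡)))
      where
      z≡ : toℕ (apex B) ≡ toℕ v
      z≡ = trans (cong toℕ z) (Fₚ.toℕ-inject≤ v u≤t)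
      l : toℕ (apex B) < u
      l = subst (_< u) (sym z≡) (Fₚ.toℕ<n v)

    block′ : ∀ c d → c ≢ d → ∀ x y → ∃[ B ] (pt′ B c ≡ x × pt′ B d ≡ y)
    block′ c d c≢d (inj₁ (i , f)) (inj₁ (j , g)) with block S (inject₁ c) (inject₁ d) (lower c≢d) i j
    ... | B , refl , refl with toℕ (apex B) <? u
    ...   | no ¬l = case block T c d c≢d f g of λ
            { (C , refl , refl) → plain B (ℕₚ.≮⇒≥ ¬l) C , refl , refl }
    ...   | yes l = case block T′ c d c≢d (suc f) (suc g) of λ
            { (C , e , e′) → marked B l C (λ all → case trans (sym (all c)) e of λ ()) , cong (place _ _) e , cong (place _ _) e′ }
    block′ c d c≢d (inj₁ (i , f)) (inj₂ w) = withApex c d c≢d i f w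
    block′ c d c≢d (inj₂ v) (inj₁ (j , g)) = case withApex d c (c≢d ∘ sym) j g v of λ { (B , e , e′) → B , e′ , e }
    block′ c d c≢d (inj₂ v) (inj₂ w) = case block U c d c≢d v w of λ { (C , e , e′) → corner C , cong inj₂ e , cong inj₂ e′ }

    place≡inj₁ : ∀ {i z x p} → place i z x ≡ inj₁ p → i ≡ proj₁ p
    place≡inj₁ {x = suc x} refl = refl

    place≡inj₂ : ∀ {i z x w} → place i z x ≡ inj₂ w → x ≡ zero
    place≡inj₂ {x = zero} _ = refl

    plain≢marked : ∀ c d → c ≢ d → ∀ {B l C B′ l′ C′ h} → pt′ (plain B l C) c ≡ pt′ (marked B′ l′ C′ h) c →
      pt′ (plain B l C) d ≡ pt′ (marked B′ l′ C′ h) d → ⊥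
    plain≢marked c d c≢d {B} {l} {B′ = B′} {l′ = l′} e e′ = ℕₚ.<⇒≱ l′ (subst (λ z → u ≤ toℕ z)
      (unique S (inject₁ c) (inject₁ d) (lower c≢d) B B′ (sym (place≡inj₁ (sym e))) (sym (place≡inj₁ (sym e′))) (fromℕ k)) l)

    marked≢corner : ∀ c d → c ≢ d → ∀ {B l C h D} → pt′ (marked B l C h) c ≡ pt′ (corner D) c →
      pt′ (marked B l C h) d ≡ pt′ (corner D) d → ⊥
    marked≢corner c d c≢d {C = C} {h} e e′ = h (twoZeros c d c≢d C (place≡inj₂ e) (place≡inj₂ e′))

    fromℕ<≡ : ∀ {i j} (l : i < u) (l′ : j < u) → fromℕ< l ≡ fromℕ< l′ → i ≡ j
    fromℕ<≡ l l′ = Fₚ.fromℕ<-injective _ _ l l′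

    marked-unique : ∀ c d → c ≢ d → ∀ {B l C h B′ l′ C′ h′} → pt′ (marked B l C h) c ≡ pt′ (marked B′ l′ C′ h′) c →
      pt′ (marked B l C h) d ≡ pt′ (marked B′ l′ C′ h′) d → (∀ e → pt T′ C e ≡ pt T′ C′ e) × (∀ e → pt S B e ≡ pt S B′ e)
    marked-unique c d c≢d {B} {l} {C} {h} {B′} {l′} {C′} e e′ with place-place e | place-place e′
    ... | inj₁ (x , _ , _) | inj₁ (y , _ , _) = ⊥-elim (h (twoZeros c d c≢d C x y))
    ... | inj₁ (x , x′ , z) | inj₂ (y , j) = unique T′ c d c≢d C C′ (trans x (sym x′)) y ,
        unique S (inject₁ d) (fromℕ k) c≢apex B B′ j (Fₚ.toℕ-injective (fromℕ<≡ l l′ z))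
    ... | inj₂ (x , i) | inj₁ (y , y′ , z) = unique T′ c d c≢d C C′ x (trans y (sym y′)) ,
        unique S (inject₁ c) (fromℕ k) c≢apex B B′ i (Fₚ.toℕ-injective (fromℕ<≡ l l′ z))
    ... | inj₂ (x , i) | inj₂ (y , j) = unique T′ c d c≢d C C′ x y , unique S (inject₁ c) (inject₁ d) (lower c≢d) B B′ i j

    unique′ : ∀ c d → c ≢ d → ∀ B B′ → pt′ B c ≡ pt′ B′ c → pt′ B d ≡ pt′ B′ d → ∀ e → pt′ B e ≡ pt′ B′ e
    unique′ c d c≢d (plain B _ C) (plain B′ _ C′) p q e = cong inj₁ (cong₂ _,_
      (unique S (inject₁ c) (inject₁ d) (lower c≢d) B B′ (,-injectiveˡ (inj₁-injective p)) (,-injectiveˡ (inj₁-injective q)) (inject₁ e))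
      (unique T c d c≢d C C′ (,-injectiveʳ (inj₁-injective p)) (,-injectiveʳ (inj₁-injective q)) e))
    unique′ c d c≢d (plain B l C) (marked B′ l′ C′ h) p q = ⊥-elim (plain≢marked c d c≢d {B} {l} {C} {B′} {l′} {C′} {h} p q)
    unique′ c d c≢d (marked B l C h) (plain B′ l′ C′) p q =
      ⊥-elim (plain≢marked c d c≢d {B′} {l′} {C′} {B} {l} {C} {h} (sym p) (sym q))
    unique′ c d c≢d (marked B l C h) (marked B′ l′ C′ h′) p q e
      with marked-unique c d c≢d {B} {l} {C} {h} {B′} {l′} {C′} {h′} p q
    ... | C≡ , B≡ = trans (cong₂ (λ i x → place i (fromℕ< l) x) (B≡ (inject₁ e)) (C≡ e))
        (cong (λ z → place (base B′ e) z (pt T′ C′ e)) (Fₚ.fromℕ<-cong _ _ (cong toℕ (B≡ (fromℕ k))) l l′))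
    unique′ c d c≢d (marked B l C h) (corner D) p q = ⊥-elim (marked≢corner c d c≢d {B} {l} {C} {h} {D} p q)
    unique′ c d c≢d (corner D) (marked B l C h) p q = ⊥-elim (marked≢corner c d c≢d {B} {l} {C} {h} {D} (sym p) (sym q))
    unique′ c d c≢d (corner D) (corner D′) p q e = cong inj₂ (unique U c d c≢d D D′ (inj₂-injective p) (inj₂-injective q) e)

  wilsonTD : TD k (Fin (t ℕ.* m ℕ.+ u))
  wilsonTD = mapTD (↔-sym Fₚ.+↔⊎ ↔-∘ (↔-sym Fₚ.*↔× ⊎-↔ ↔-id _)) record
    { Block = Block′ ; pt = pt′ ; block = block′ ; unique = unique′ }

MOLS : ℕ → Set₁
MOLS n = TD 4 (Fin n)

module _ (t′ : ℕ) where
  private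
    t : ℕ
    t = suc t′
  open Residues t

  cyclicTD₅ : ∃[ w ] w ℤ.* + 2 ≈ 1ℤ → ∃[ w ] w ℤ.* + 3 ≈ 1ℤ → TD 5 (Fin t)
  cyclicTD₅ half third = cyclicTD t 4 λ
    { 1 _ _ → 1ℤ , ≈-refl
    ; 2 _ _ → half
    ; 3 _ _ → third
    ; (suc (suc (suc (suc d)))) _ l → ⊥-elim (ℕₚ.<⇒≱ l (s≤s (s≤s (s≤s (s≤s z≤n))))) }

-- The four positions of a line differ by 1, 2 or 3. For t = 1 + 6 q the inverse of 2 is (t + 1)/2
-- and that of 3 is (1 - t)/3.
TD₅-1+6q : ∀ q → TD 5 (Fin (suc (q ℕ.* 6)))
TD₅-1+6q q = cyclicTD₅ (q ℕ.* 6)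
  (1ℤ ℤ.+ + 3 ℤ.* + q , mod 1ℤ (trans (half (+ q)) (cong (λ z → 1ℤ ℤ.* (1ℤ ℤ.+ z)) (sym (ℤₚ.pos-* q 6)))))
  (ℤ.- (+ 2 ℤ.* + q) , mod (ℤ.- 1ℤ) (trans (third (+ q)) (cong (λ z → ℤ.- 1ℤ ℤ.* (1ℤ ℤ.+ z)) (sym (ℤₚ.pos-* q 6)))))
  where
  open Residues (suc (q ℕ.* 6))
  half : ∀ q → (1ℤ ℤ.+ + 3 ℤ.* q) ℤ.* + 2 ℤ.- 1ℤ ≡ 1ℤ ℤ.* (1ℤ ℤ.+ q ℤ.* + 6)
  half = solve-∀
  third : ∀ q → (ℤ.- (+ 2 ℤ.* q)) ℤ.* + 3 ℤ.- 1ℤ ≡ ℤ.- 1ℤ ℤ.* (1ℤ ℤ.+ q ℤ.* + 6)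
  third = solve-∀

-- For t = 5 + 6 q the inverses of 2 and 3 are (t + 1)/2 and (t + 1)/3.
TD₅-5+6q : ∀ q → TD 5 (Fin (5 ℕ.+ q ℕ.* 6))
TD₅-5+6q q = cyclicTD₅ (4 ℕ.+ q ℕ.* 6)
  (+ 3 ℤ.+ + 3 ℤ.* + q , mod 1ℤ (trans (half (+ q)) (cong (λ z → 1ℤ ℤ.* (+ 5 ℤ.+ z)) (sym (ℤₚ.pos-* q 6)))))
  (+ 2 ℤ.+ + 2 ℤ.* + q , mod 1ℤ (trans (third (+ q)) (cong (λ z → 1ℤ ℤ.* (+ 5 ℤ.+ z)) (sym (ℤₚ.pos-* q 6)))))
  where
  open Residues (5 ℕ.+ q ℕ.* 6)
  half : ∀ q → (+ 3 ℤ.+ + 3 ℤ.* q) ℤ.* + 2 ℤ.- 1ℤ ≡ 1ℤ ℤ.* (+ 5 ℤ.+ q ℤ.* + 6)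
  half = solve-∀
  third : ∀ q → (+ 2 ℤ.+ + 2 ℤ.* q) ℤ.* + 3 ℤ.- 1ℤ ≡ 1ℤ ℤ.* (+ 5 ℤ.+ q ℤ.* + 6)
  third = solve-∀

-- With weight 3 the ingredients have the orders 3, 4 and the odd number u, all at hand.
tripleMOLS : ∀ {t} j → TD 5 (Fin t) → suc (2 ℕ.* j) ≤ t → MOLS (t ℕ.* 3 ℕ.+ suc (2 ℕ.* j))
tripleMOLS j S u≤t = wilsonTD S (oddMOLS 1) mols4 zeroBlock4 u≤t (oddMOLS j)

productMOLS : ∀ {m n} → MOLS m → MOLS n → MOLS (m ℕ.* n)
productMOLS S T = mapTD (↔-sym Fₚ.*↔×) (productTD S T)

mols-15+u+18q : ∀ q j → suc (2 ℕ.* j) ≤ 5 ℕ.+ q ℕ.* 6 → MOLS (15 ℕ.+ suc (2 ℕ.* j) ℕ.+ q ℕ.* 18)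
mols-15+u+18q q j l = subst MOLS (eq q (suc (2 ℕ.* j))) (tripleMOLS j (TD₅-5+6q q) l)
  where
  eq : ∀ q u → (5 ℕ.+ q ℕ.* 6) ℕ.* 3 ℕ.+ u ≡ 15 ℕ.+ u ℕ.+ q ℕ.* 18
  eq = ℕSolver.solve-∀

mols-3+u+18q : ∀ q j → suc (2 ℕ.* j) ≤ 1 ℕ.+ q ℕ.* 6 → MOLS (3 ℕ.+ suc (2 ℕ.* j) ℕ.+ q ℕ.* 18)
mols-3+u+18q q j l = subst MOLS (eq q (suc (2 ℕ.* j))) (tripleMOLS j (TD₅-1+6q q) l)
  where
  eq : ∀ q u → (1 ℕ.+ q ℕ.* 6) ℕ.* 3 ℕ.+ u ≡ 3 ℕ.+ u ℕ.+ q ℕ.* 18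
  eq = ℕSolver.solve-∀

-- n = 2 r + 18 q is written as 3 t + u with t coprime to 6 and u ∈ {1, 3, 5, 7, 9, 11}.
evenMOLS : ∀ q (r : Fin 9) → let n = toℕ r ℕ.* 2 ℕ.+ q ℕ.* 18 in n ≢ 0 → n ≢ 2 → n ≢ 6 → MOLS n
evenMOLS zero 0F h _ _ = ⊥-elim (h refl)
evenMOLS (suc q) 0F _ _ _ = mols-15+u+18q q 1 (ℕₚ.m≤m+n 3 (2 ℕ.+ q ℕ.* 6))
evenMOLS zero 1F _ h _ = ⊥-elim (h refl)
evenMOLS (suc q) 1F _ _ _ = mols-15+u+18q q 2 (ℕₚ.m≤m+n 5 (q ℕ.* 6))
evenMOLS q 2F _ _ _ = mols-3+u+18q q 0 (s≤s z≤n)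
evenMOLS zero 3F _ _ h = ⊥-elim (h refl)
evenMOLS (suc q) 3F _ _ _ = mols-3+u+18q (suc q) 1 (ℕₚ.m≤m+n 3 (4 ℕ.+ q ℕ.* 6))
evenMOLS zero 4F _ _ _ = mols8
evenMOLS (suc q) 4F _ _ _ = mols-3+u+18q (suc q) 2 (ℕₚ.m≤m+n 5 (2 ℕ.+ q ℕ.* 6))
evenMOLS zero 5F _ _ _ = mols10
evenMOLS (suc q) 5F _ _ _ = mols-3+u+18q (suc q) 3 (ℕₚ.m≤m+n 7 (q ℕ.* 6))
-- Here u = 9, and for the next residue u = 11, exceeds t = 1 and t = 7. Of the four orders
-- concerned, 12, 30 and 32 are products and 14 has its own table.
evenMOLS 0 6F _ _ _ = productMOLS (oddMOLS 1) mols4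
evenMOLS 1 6F _ _ _ = productMOLS (oddMOLS 1) mols10
evenMOLS (suc (suc q)) 6F _ _ _ = mols-3+u+18q (suc (suc q)) 4 (ℕₚ.m≤m+n 9 (4 ℕ.+ q ℕ.* 6))
evenMOLS 0 7F _ _ _ = mols14
evenMOLS 1 7F _ _ _ = productMOLS mols4 mols8
evenMOLS (suc (suc q)) 7F _ _ _ = mols-3+u+18q (suc (suc q)) 5 (ℕₚ.m≤m+n 11 (2 ℕ.+ q ℕ.* 6))
evenMOLS q 8F _ _ _ = mols-15+u+18q q 0 (s≤s z≤n)

-- C_M-factorisations from transversal designs

private
  alternating : ℕ → Fin 4
  alternating 0 = 1F
  alternating 1 = 2F
  alternating (suc (suc k)) = alternating k

  -- A proper colouring of C_M for either parity of M: colour 0 occurs in column 0 only, so the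
  -- cycle closes whether the last column has colour 1 or 2.
  group : ℕ → Fin 4
  group zero = 0F
  group (suc k) = alternating k

  alternating≢0 : ∀ k → alternating k ≢ 0F
  alternating≢0 (suc (suc k)) = alternating≢0 k

  alternating≢3 : ∀ k → alternating k ≢ 3F
  alternating≢3 (suc (suc k)) = alternating≢3 k

  alternating-step : ∀ k → alternating k ≢ alternating (suc k)
  alternating-step 0 ()
  alternating-step 1 ()
  alternating-step (suc (suc k)) = alternating-step k

  group≢3 : ∀ k → group k ≢ 3F
  group≢3 (suc k) = alternating≢3 k

  group-next : ∀ {M} → 2 ≤ M → (x : Fin M) → group (toℕ x) ≢ group (toℕ (next x))
  group-next M≥2 x e with toℕ x in x≡ | toℕ (next x) | next-step x
  ... | zero  | _ | inj₁ (_ , refl) = alternating≢0 0 (sym e)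
  ... | suc k | _ | inj₁ (_ , refl) = alternating-step k e
  ... | zero  | _ | inj₂ (l , _) = ℕₚ.<⇒≢ M≥2 l
  ... | suc k | _ | inj₂ (_ , refl) = alternating≢0 k e

-- The blocks through a point t of group 3 form a C_M-factor once the columns are spread
-- properly over groups 0, 1, 2; each block is labelled by its point in group 0.
module _ {M n : ℕ} (M≥3 : 3 ≤ M) (T : TD 4 (Fin n)) where
  private
    M≥2 : 2 ≤ M
    M≥2 = ℕₚ.≤-trans (ℕₚ.n≤1+n 2) M≥3

    g : Fin M → Fin 4
    g x = group (toℕ x)

    g≢3 : ∀ x → g x ≢ 3F
    g≢3 x = group≢3 (toℕ x)

    B : Fin n → (x : Fin M) → Fin n → Block T
    B t x a = proj₁ (block T (g x) 3F (g≢3 x) a t)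

    B-g : ∀ t x a → pt T (B t x a) (g x) ≡ a
    B-g t x a = proj₁ (proj₂ (block T (g x) 3F (g≢3 x) a t))

    B-3 : ∀ t x a → pt T (B t x a) 3F ≡ t
    B-3 t x a = proj₂ (proj₂ (block T (g x) 3F (g≢3 x) a t))

    κ : Fin n → Fin M → Fin n → Fin n
    κ t x a = pt T (B t x a) 0F

    κ-same : ∀ t x y {a b} → κ t x a ≡ κ t y b → ∀ e → pt T (B t x a) e ≡ pt T (B t y b) e
    κ-same t x y {a} {b} e = unique T 0F 3F (λ ()) (B t x a) (B t y b) e (trans (B-3 t x a) (sym (B-3 t y b)))

    κ-injective : ∀ t x → Injective _≡_ _≡_ (κ t x)
    κ-injective t x {a} {b} e = trans (sym (B-g t x a)) (trans (κ-same t x x e (g x)) (B-g t x b))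

    -- Points of two different groups lie on an essentially unique block, and its point in group 3
    -- is the factor.
    one : ∀ x a b → ExactlyOne (λ t → κ t x a ≡ κ t (next x) b)
    one x a b with block T (g x) (g (next x)) (group-next M≥2 x) a b
    ... | C , refl , refl = t , trans (same x refl 0F) (sym (same (next x) refl 0F)) , λ s e →
          trans (sym (B-3 s x a))
            (unique T (g x) (g (next x)) (group-next M≥2 x) (B s x a) C (B-g s x a)
              (trans (κ-same s x (next x) e (g (next x))) (B-g s (next x) b)) 3F)
      where
      t = pt T C 3F
      same : ∀ y {c} → c ≡ pt T C (g y) → ∀ e → pt T (B t y c) e ≡ pt T C e
      same y refl = unique T (g y) 3F (g≢3 y) (B t y _) C (B-g t y _) (B-3 t y _)

  TD⇒InHWP : InHWP (lex (Cyc M) n) M (M ℕ.* n) (n , 0)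
  TD⇒InHWP = factors⇒InHWP z≤n (λ t x a b → κ t x a ≡ κ t (next x) b) one
    (λ t _ → labelFactor M≥3 (κ t) (κ-injective t)) (λ t ())

evenInHWP : ∀ {M} k → 3 ≤ M → k ℕ.* 2 ≢ 0 → k ℕ.* 2 ≢ 2 → k ℕ.* 2 ≢ 6 → InHWP (lex (Cyc M) (k ℕ.* 2)) M (M ℕ.* (k ℕ.* 2)) (k ℕ.* 2 , 0)
evenInHWP k M≥3 with k divMod 9
... | result q r refl = λ h₀ h₂ h₆ → TD⇒InHWP M≥3 (subst MOLS (eq (toℕ r) q) (evenMOLS q r (h₀ ∘ trans (sym (eq (toℕ r) q))) (h₂ ∘ trans (sym (eq (toℕ r) q))) (h₆ ∘ trans (sym (eq (toℕ r) q)))))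
  where
  eq : ∀ r q → r ℕ.* 2 ℕ.+ q ℕ.* 18 ≡ (r ℕ.+ q ℕ.* 9) ℕ.* 2
  eq = ℕSolver.solve-∀

-- Translation schemes

module _ where
  open import Data.Integer using (_+_; _-_; _*_; -_)

  module _ (n : ℕ) where
    open Residues n

    ι-next : ∀ q → ι (next q) ≈ ι q + 1ℤ
    ι-next q with next-step q
    ... | inj₁ (_ , e) = ≡⇒≈ (trans (cong +_ e) (ℤₚ.+-comm 1ℤ (ι q)))
    ... | inj₂ (l , e) = mod (- 1ℤ) (trans (cong₂ _-_ (cong +_ e) (ℤₚ.+-comm (ι q) 1ℤ)) (trans (cong (λ z → 0ℤ - + z) l) (lemma (+ n))))
      where
      lemma : ∀ N → 0ℤ - N ≡ - 1ℤ * N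
      lemma = solve-∀

  -- One factor of a translation scheme: in column x it is shifted by P x against column 0, and
  -- one turn around the cycle shifts it by s.
  module Row {M n : ℕ} (M≥3 : 3 ≤ M) {{_ : NonZero n}} (P : Fin M → ℤ) (P0 : ∀ x → toℕ x ≡ 0 → P x ≡ 0ℤ) (s : ℤ) where
    open Residues n

    abstract
      shift : Fin M → ℤ
      shift x with last? x
      ... | inj₁ _ = P (next x) - P x
      ... | inj₂ _ = s - P x

      shift-< : ∀ x → suc (toℕ x) < M → shift x ≡ P (next x) - P x
      shift-< x l with last? x
      ... | inj₁ _ = refl
      ... | inj₂ e = ⊥-elim (ℕₚ.<-irrefl e l)

      shift-last : ∀ x → suc (toℕ x) ≡ M → shift x ≡ s - P x
      shift-last x e with last? x
      ... | inj₁ l = ⊥-elim (ℕₚ.<-irrefl e l)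
      ... | inj₂ _ = refl

    P-last : ∀ x → suc (toℕ x) ≡ M → P (next x) ≡ 0ℤ
    P-last x e = P0 (next x) (next-last x e)

    Translate : EdgeRel M n
    Translate x a b = ι b ≈ ι a + shift x

    translate-inner : ∀ x {a b} → suc (toℕ x) < M → (ι a - P x ≈ ι b - P (next x)) ⇔ Translate x a b
    translate-inner x {a} {b} l = mk⇔
      (λ e → lin₁ (- 1ℤ) 0ℤ e (trans (cong (λ z → ι b - (ι a + z)) (shift-< x l)) (fwd (ι a) (ι b) (P x) (P (next x)) (+ n))))
      (λ e → lin₁ (- 1ℤ) 0ℤ e (trans (bwd (ι a) (ι b) (P x) (P (next x)) (+ n)) (cong (λ z → - 1ℤ * (ι b - (ι a + z)) + 0ℤ * + n) (sym (shift-< x l)))))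
      where
      fwd : ∀ a b p q N → b - (a + (q - p)) ≡ - 1ℤ * ((a - p) - (b - q)) + 0ℤ * N
      fwd = solve-∀
      bwd : ∀ a b p q N → (a - p) - (b - q) ≡ - 1ℤ * (b - (a + (q - p))) + 0ℤ * N
      bwd = solve-∀

    translate-last : ∀ x {a b} → suc (toℕ x) ≡ M → ((ι a - P x) + s ≈ ι b - P (next x)) ⇔ Translate x a b
    translate-last x {a} {b} l = mk⇔
      (λ e → lin₁ (- 1ℤ) 0ℤ (subst (λ z → (ι a - P x) + s ≈ ι b - z) (P-last x l) e)
        (trans (cong (λ z → ι b - (ι a + z)) (shift-last x l)) (fwd (ι a) (ι b) (P x) s (+ n))))
      (λ e → subst (λ z → (ι a - P x) + s ≈ ι b - z) (sym (P-last x l))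
        (lin₁ (- 1ℤ) 0ℤ e (trans (bwd (ι a) (ι b) (P x) s (+ n)) (cong (λ z → - 1ℤ * (ι b - (ι a + z)) + 0ℤ * + n) (sym (shift-last x l))))))
      where
      fwd : ∀ a b p s N → b - (a + (s - p)) ≡ - 1ℤ * (((a - p) + s) - (b - 0ℤ)) + 0ℤ * N
      fwd = solve-∀
      bwd : ∀ a b p s N → ((a - p) + s) - (b - 0ℤ) ≡ - 1ℤ * (b - (a + (s - p))) + 0ℤ * N
      bwd = solve-∀

    res≡⇔ : ∀ {i j} → (res i ≡ res j) ⇔ (i ≈ j)
    res≡⇔ = mk⇔ res-injective res-cong

    private
      label : ℤ → Fin M → Fin n → Fin n
      label σ x a = res (σ * (ι a - P x))

    -- The label a - P x, the vertex of column 0 from which a is reached, survives a whole turn when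
    -- s ≈ 0.
    closedRow : s ≈ 0ℤ → FactorOn M n M Translate
    closedRow s≈0 = mapEdges
      (λ x a b → case last? x of λ
        { (inj₁ l) → translate-inner x l ⇔-∘ unscale x a b
        ; (inj₂ l) → translate-last x l ⇔-∘ (addS (ι a - P x) (ι b - P (next x)) ⇔-∘ unscale x a b) })
      (labelFactor M≥3 (label 1ℤ) (λ x → res-shift-injective 1ℤ (P x) cancel))
      where
      cancel : ∀ {a b} → 1ℤ * a ≈ 1ℤ * b → a ≈ b
      cancel {a} {b} = subst₂ _≈_ (ℤₚ.*-identityˡ a) (ℤₚ.*-identityˡ b)
      unscale : ∀ x a b → (label 1ℤ x a ≡ label 1ℤ (next x) b) ⇔ (ι a - P x ≈ ι b - P (next x))
      unscale x a b = mk⇔ (cancel ∘ res-injective) (res-cong ∘ subst₂ _≈_ (sym (ℤₚ.*-identityˡ _)) (sym (ℤₚ.*-identityˡ _)))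
      addS : ∀ i j → (i ≈ j) ⇔ (i + s ≈ j)
      addS i j = mk⇔ (λ e → lin₂ 1ℤ 1ℤ 0ℤ e s≈0 (fwd i j s (+ n))) (λ e → lin₂ 1ℤ (- 1ℤ) 0ℤ e s≈0 (bwd i j s (+ n)))
        where
        fwd : ∀ i j s N → i + s - j ≡ 1ℤ * (i - j) + 1ℤ * (s - 0ℤ) + 0ℤ * N
        fwd = solve-∀
        bwd : ∀ i j s N → i - j ≡ 1ℤ * (i + s - j) + - 1ℤ * (s - 0ℤ) + 0ℤ * N
        bwd = solve-∀

    -- Multiplied by the inverse of s, the label grows by exactly 1 per turn, so it numbers the
    -- blocks in their order along the cycle. The bound n for m makes every block a forward one.
    unitRow : ∀ σ → σ * s ≈ 1ℤ → FactorOn M n (M ℕ.* n) Translate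
    unitRow σ unit = mapEdges
      (λ x a b → case last? x of λ
        { (inj₁ l) → translate-inner x l ⇔-∘ (unscale (ι a - P x) (ι b - P (next x)) ⇔-∘ (inner x a b l ⇔-∘ forward x a b))
        ; (inj₂ l) → translate-last x l ⇔-∘ (step (ι a - P x) (ι b - P (next x)) ⇔-∘ (wrap x a b l ⇔-∘ forward x a b)) })
      (hamFactor M≥3 (label σ) (λ x → res-shift-injective σ (P x) cancel) n)
      where
      unit′ : s * σ ≈ 1ℤ
      unit′ = subst (_≈ 1ℤ) (ℤₚ.*-comm σ s) unit
      cancel : ∀ {a b} → σ * a ≈ σ * b → a ≈ b
      cancel = unit-cancel σ s unit′
      forward : ∀ x a b → HamRel n (label σ) x a b ⇔ (carry x (label σ x a) ≡ label σ (next x) b)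
      forward x a b = mk⇔ (λ { (inj₁ (_ , e)) → e ; (inj₂ (l , _)) → ⊥-elim (ℕₚ.<⇒≱ (Fₚ.toℕ<n _) l) })
                          (λ e → inj₁ (Fₚ.toℕ<n _ , e))
      inner : ∀ x a b → suc (toℕ x) < M → (carry x (label σ x a) ≡ label σ (next x) b) ⇔ (σ * (ι a - P x) ≈ σ * (ι b - P (next x)))
      inner x a b l rewrite carry-< (label σ x a) l = res≡⇔
      unscale : ∀ i j → (σ * i ≈ σ * j) ⇔ (i ≈ j)
      unscale i j = mk⇔ cancel (≈-*ˡ σ)
      wrap : ∀ x a b → suc (toℕ x) ≡ M → (carry x (label σ x a) ≡ label σ (next x) b) ⇔ (σ * (ι a - P x) + 1ℤ ≈ σ * (ι b - P (next x)))
      wrap x a b l rewrite carry-last (label σ x a) l = mk⇔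
        (λ e → ≈-trans (≈-sym next≈) (≈-trans (≡⇒≈ (cong ι e)) (ι-res _)))
        (λ e → ι-injective (≈-trans next≈ (≈-trans e (≈-sym (ι-res _)))))
        where
        next≈ : ι (next (label σ x a)) ≈ σ * (ι a - P x) + 1ℤ
        next≈ = ≈-trans (ι-next n (label σ x a)) (≈-+ {c = 1ℤ} (ι-res _) ≈-refl)
      step : ∀ i j → (σ * i + 1ℤ ≈ σ * j) ⇔ (i + s ≈ j)
      step i j = mk⇔ (λ e → cancel (lin₂ 1ℤ 1ℤ 0ℤ e unit (fwd σ s i j (+ n))))
                     (λ e → lin₂ σ (- 1ℤ) 0ℤ e unit (bwd σ s i j (+ n)))
        where
        fwd : ∀ σ s i j N → σ * (i + s) - σ * j ≡ 1ℤ * (σ * i + 1ℤ - σ * j) + 1ℤ * (σ * s - 1ℤ) + 0ℤ * N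
        fwd = solve-∀
        bwd : ∀ σ s i j N → σ * i + 1ℤ - σ * j ≡ σ * (i + s - j) + - 1ℤ * (σ * s - 1ℤ) + 0ℤ * N
        bwd = solve-∀

  -- Hamiltonian cycles with turning points

  ≡-substʳ : ∀ {A : Set} {x y z : A} → y ≡ z → (x ≡ y) ⇔ (x ≡ z)
  ≡-substʳ refl = mk⇔ (λ e → e) (λ e → e)

  data Position {M} (x : Fin M) : Set where
    first : toℕ x ≡ 0 → Position x
    inner : toℕ x ≢ 0 → suc (toℕ x) < M → Position x
    final : suc (toℕ x) ≡ M → Position x

  position : ∀ {M} (x : Fin M) → Position x
  position x with toℕ x ℕ.≟ 0 | last? x
  ... | yes e | _      = first e
  ... | no ¬e | inj₁ l = inner ¬e l
  ... | no ¬e | inj₂ l = final l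

  divert : ∀ {n} → Fin n → Fin n → Fin n → Fin n
  divert from to a with a ≟ from
  ... | yes _ = to
  ... | no _ = a

  divert-at : ∀ {n} {v w : Fin n} a → a ≡ v → divert v w a ≡ w
  divert-at {v = v} a e with a ≟ v
  ... | yes _ = refl
  ... | no ¬e = ⊥-elim (¬e e)

  divert-off : ∀ {n} {v w : Fin n} a → a ≢ v → divert v w a ≡ a
  divert-off {v = v} a ne with a ≟ v
  ... | yes e = ⊥-elim (ne e)
  ... | no _ = refl

  divert-fixed : ∀ {n} {v w : Fin n} a → a ≡ w → divert v w a ≡ w
  divert-fixed {v = v} a e with a ≟ v
  ... | yes _ = refl
  ... | no _ = e

  -- Orders the vertices of column 0 among the blocks of a turned Hamiltonian cycle: they are
  -- those of the enumeration θ, except that θ (n - 1) moves to the turning point m.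
  module Gap {n : ℕ} (m : ℕ) (0<m : 0 < m) (m<n : m < n) where

    data GapView (v : Fin n) (g : Fin n) : Set where
      below : toℕ v < m → g ≡ v → GapView v g
      above : m ≤ toℕ v → suc (toℕ v) < n → g ≡ next v → GapView v g
      end   : suc (toℕ v) ≡ n → g ≡ fromℕ< m<n → GapView v g

    gap : Fin n → Fin n
    gap v with toℕ v <? m | last? v
    ... | yes _ | _ = v
    ... | no _ | inj₁ _ = next v
    ... | no _ | inj₂ _ = fromℕ< m<n

    gapView : ∀ v → GapView v (gap v)
    gapView v with toℕ v <? m | last? v
    ... | yes l | _ = below l refl
    ... | no ¬l | inj₁ l′ = above (ℕₚ.≮⇒≥ ¬l) l′ refl
    ... | no ¬l | inj₂ e = end e refl

    private
      pred≢ : ∀ {v} → suc v ≡ n → ¬ (v < m)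
      pred≢ e l = ℕₚ.<⇒≱ m<n (ℕₚ.≤-trans (ℕₚ.≤-reflexive (sym e)) l)

      below≢above : ∀ {v w g} → toℕ v < m → g ≡ v → m ≤ toℕ w → suc (toℕ w) < n → g ≢ next w
      below≢above l refl l′ l″ e = ℕₚ.<⇒≱ l (ℕₚ.≤-trans l′ (ℕₚ.≤-trans (ℕₚ.n≤1+n _)
        (ℕₚ.≤-reflexive (sym (trans (cong toℕ e) (next-< _ l″))))))

      below≢end : ∀ {v g : Fin n} → toℕ v < m → g ≡ v → g ≢ fromℕ< m<n
      below≢end l refl e = ℕₚ.<⇒≢ l (trans (cong toℕ e) (Fₚ.toℕ-fromℕ< m<n))

      above≢end : ∀ {v g : Fin n} → m ≤ toℕ v → suc (toℕ v) < n → g ≡ next v → g ≢ fromℕ< m<n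
      above≢end {v} l l′ refl e = ℕₚ.<⇒≢ (s≤s l) (trans (sym (Fₚ.toℕ-fromℕ< m<n)) (trans (cong toℕ (sym e)) (next-< v l′)))

    gap-injective : Injective _≡_ _≡_ gap
    gap-injective {v} {w} e = go (gapView v) (gapView w) e
      where
      go : ∀ {g h} → GapView v g → GapView w h → g ≡ h → v ≡ w
      go (below _ refl) (below _ refl) e = e
      go (below l e₁) (above l′ l″ refl) e = ⊥-elim (below≢above l e₁ l′ l″ e)
      go (below l e₁) (end _ refl) e = ⊥-elim (below≢end l e₁ e)
      go (above l′ l″ refl) (below l e₂) e = ⊥-elim (below≢above l e₂ l′ l″ (sym e))
      go (above _ _ refl) (above _ _ refl) e = next-injective e
      go (above l l′ e₁) (end _ refl) e = ⊥-elim (above≢end l l′ e₁ e)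
      go (end _ refl) (below l e₂) e = ⊥-elim (below≢end l e₂ (sym e))
      go (end _ refl) (above l l′ e₂) e = ⊥-elim (above≢end l l′ e₂ (sym e))
      go (end l _) (end l′ _) _ = Fₚ.toℕ-injective (ℕₚ.suc-injective (trans l (sym l′)))

    gap-below : ∀ v → toℕ v < m → gap v ≡ v
    gap-below v l with gapView v
    ... | below _ e = e
    ... | above l′ _ _ = ⊥-elim (ℕₚ.<⇒≱ l l′)
    ... | end e _ = ⊥-elim (pred≢ e l)

    gap-above : ∀ v → m ≤ toℕ v → suc (toℕ v) < n → gap v ≡ next v
    gap-above v l l′ with gapView v
    ... | below l″ _ = ⊥-elim (ℕₚ.<⇒≱ l″ l)
    ... | above _ _ e = e
    ... | end e _ = ⊥-elim (ℕₚ.<-irrefl e l′)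

    gap-end : ∀ v → suc (toℕ v) ≡ n → gap v ≡ fromℕ< m<n
    gap-end v e with gapView v
    ... | below l _ = ⊥-elim (pred≢ e l)
    ... | above _ l _ = ⊥-elim (ℕₚ.<-irrefl e l)
    ... | end _ e′ = e′

  -- θ lists the return points of column 0 of the translation by s, ascending for the first m
  -- and descending afterwards, so that both turns happen at the extreme points u and w.
  record Turning (n : ℕ) {{_ : NonZero n}} (s : ℤ) (u w : Fin n) : Set where
    open Residues n
    field
      θ           : Fin n → Fin n
      θ-injective : Injective _≡_ _≡_ θ
      m           : ℕ
      0<m         : 0 < m
      m<n         : m < n
      θ-first     : ∀ q → toℕ q ≡ 0 → θ q ≡ u
      θ-last      : ∀ q → suc (toℕ q) ≡ n → θ q ≡ w
      ascend      : ∀ q → suc (toℕ q) < m → ι (θ (next q)) ≈ ι (θ q) + s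
      descend     : ∀ q → m ≤ toℕ q → suc (toℕ q) < n → ι (θ q) ≈ ι (θ (next q)) + s
      turn        : ∀ q → suc (toℕ q) ≡ m ⊎ toℕ q ≡ m → ι u ≈ ι (θ q) + s ⊎ ι w ≈ ι (θ q) + s

  module _ {n : ℕ} {{_ : NonZero n}} where
    open Residues n

    -- The edges of a turned Hamiltonian cycle, where t is the amount by which the untraded row
    -- shifts column x: column 0 is left from u in place of w, and entered at w in place of u.
    TurnedAt : Fin n → Fin n → ℤ → ∀ {M} {x : Fin M} → Position x → Fin n → Fin n → Set
    TurnedAt u w t (first _)   a b = a ≡ divert w u (res (ι b - t))
    TurnedAt u w t (inner _ _) a b = ι b ≈ ι a + t
    TurnedAt u w t (final _)   a b = b ≡ divert u w (res (ι a + t))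

  module TurnedRow {M n : ℕ} (M≥3 : 3 ≤ M) {{_ : NonZero n}} (P : Fin M → ℤ) (P0 : ∀ x → toℕ x ≡ 0 → P x ≡ 0ℤ)
    (s : ℤ) (u w : Fin n) (T : Turning n s u w) where
    open Residues n
    open Row {M} {n} M≥3 P P0 s
    open Turning T
    open Gap {n} m 0<m m<n

    private
      θ⁻¹ : Fin n → Fin n
      θ⁻¹ = inv θ θ-injective

      θθ⁻¹ : ∀ a → θ (θ⁻¹ a) ≡ a
      θθ⁻¹ = inv-right θ θ-injective

      θ⁻¹-injective : Injective _≡_ _≡_ θ⁻¹
      θ⁻¹-injective {a} {b} e = trans (sym (θθ⁻¹ a)) (trans (cong θ e) (θθ⁻¹ b))

      back : Fin M → Fin n → Fin n
      back x a = res (ι a - P x)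

      back-injective : ∀ x → Injective _≡_ _≡_ (back x)
      back-injective x {a} {b} e = ι-injective (lin₁ 1ℤ 0ℤ (res-injective e) (lemma (ι a) (ι b) (P x) (+ n)))
        where
        lemma : ∀ a b p N → a - b ≡ 1ℤ * ((a - p) - (b - p)) + 0ℤ * N
        lemma = solve-∀

      -- Outside column 0 block q consists of the vertices θ q + P x. In column 0 forward blocks
      -- begin and backward blocks end at their own point of θ, so the vertex stored in block q is
      -- shifted by `gap`.
      κ : Fin M → Fin n → Fin n
      κ x a with toℕ x ℕ.≟ 0
      ... | yes _ = gap (θ⁻¹ a)
      ... | no _ = θ⁻¹ (back x a)

      κ-0 : ∀ x a → toℕ x ≡ 0 → κ x a ≡ gap (θ⁻¹ a)
      κ-0 x a e with toℕ x ℕ.≟ 0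
      ... | yes _ = refl
      ... | no ¬e = ⊥-elim (¬e e)

      κ-+ : ∀ x a → toℕ x ≢ 0 → κ x a ≡ θ⁻¹ (back x a)
      κ-+ x a ne with toℕ x ℕ.≟ 0
      ... | yes e = ⊥-elim (ne e)
      ... | no _ = refl

      κ-injective : ∀ x → Injective _≡_ _≡_ (κ x)
      κ-injective x e with toℕ x ℕ.≟ 0
      ... | yes _ = θ⁻¹-injective (gap-injective e)
      ... | no _ = back-injective x (θ⁻¹-injective e)

      θ-solve : ∀ {a v} → (θ⁻¹ a ≡ v) ⇔ (a ≡ θ v)
      θ-solve {a} = mk⇔ (λ { refl → sym (θθ⁻¹ a) }) (λ { refl → inv-left θ θ-injective _ })

      carryBack-0 : ∀ {x : Fin M} {r : Fin n} → toℕ x ≡ 0 → carryBack x r ≡ next r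
      carryBack-0 {zero} _ = refl

      carryBack-+ : ∀ {x : Fin M} {r : Fin n} → toℕ x ≢ 0 → carryBack x r ≡ r
      carryBack-+ {zero} ne = ⊥-elim (ne refl)
      carryBack-+ {suc _} _ = refl

      Steps : ∀ (x : Fin M) → Fin n → Fin n → Set
      Steps x q r = (toℕ q < m × carry x q ≡ r) ⊎ (m ≤ toℕ r × carryBack x r ≡ q)

      first⇒< : ∀ {x : Fin M} → toℕ x ≡ 0 → suc (toℕ x) < M
      first⇒< e = subst (λ z → suc z < M) (sym e) (ℕₚ.≤-trans (s≤s (s≤s z≤n)) M≥3)

      final⇒≢0 : ∀ {x : Fin M} → suc (toℕ x) ≡ M → toℕ x ≢ 0
      final⇒≢0 l e = ℕₚ.<⇒≢ (first⇒< e) l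

      below-end : ∀ {r : Fin n} → toℕ r < m → suc (toℕ r) < n
      below-end l = ℕₚ.≤-<-trans l m<n

      ℓ : Fin n
      ℓ = fromℕ< (ℕₚ.≤-reflexive (ℕₚ.suc-pred n))

      ℓ-last : suc (toℕ ℓ) ≡ n
      ℓ-last = trans (cong suc (Fₚ.toℕ-fromℕ< _)) (ℕₚ.suc-pred n)

      θ≢w : ∀ r → suc (toℕ r) < n → θ r ≢ w
      θ≢w r l e = ℕₚ.<-irrefl (trans (cong (λ q → suc (toℕ q)) (θ-injective (trans e (sym (θ-last ℓ ℓ-last))))) ℓ-last) l

      θ≢u : ∀ q → 0 < toℕ q → θ q ≢ u
      θ≢u q 0<q e = ℕₚ.<⇒≢ 0<q (sym (trans (cong toℕ (θ-injective (trans e (sym (θ-first z z≡0))))) z≡0))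
        where
        0<n = ℕₚ.<-trans 0<m m<n
        z : Fin n
        z = fromℕ< 0<n
        z≡0 : toℕ z ≡ 0
        z≡0 = Fₚ.toℕ-fromℕ< 0<n

      -- The edge between columns 0 and 1 at block r: a forward block begins with it in its own
      -- column 0, a backward block leaves by it for the next block.
      entryBlock : Fin n → Fin n
      entryBlock r with toℕ r <? m
      ... | yes _ = r
      ... | no _ = next r

      entry-steps : ∀ x q r → toℕ x ≡ 0 → Steps x q r ⇔ (q ≡ entryBlock r)
      entry-steps x q r x≡0 with toℕ r <? m
      ... | yes l = mk⇔
        (λ { (inj₁ (_ , e)) → trans (sym (carry-< q (first⇒< x≡0))) e ; (inj₂ (l′ , _)) → ⊥-elim (ℕₚ.<⇒≱ l l′) })
        (λ { refl → inj₁ (l , carry-< q (first⇒< x≡0)) })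
      ... | no ¬l = mk⇔
        (λ { (inj₁ (l , e)) → ⊥-elim (¬l (subst (λ z → toℕ z < m) (trans (sym (carry-< q (first⇒< x≡0))) e) l))
           ; (inj₂ (_ , e)) → trans (sym e) (carryBack-0 x≡0) })
        (λ { refl → inj₂ (ℕₚ.≮⇒≥ ¬l , carryBack-0 x≡0) })

      -- Only r = n - 1 is diverted: its old neighbour is w = θ (n - 1), and the cycle closes up at
      -- u = θ 0 instead.
      entry-target : ∀ r → ∃[ v ] (θ v ≡ divert w u (θ r) × gap v ≡ entryBlock r)
      entry-target r with last? r | toℕ r <? m
      ... | inj₁ l | yes l′ = r , sym (divert-off (θ r) (θ≢w r l)) , gap-below r l′
      ... | inj₁ l | no ¬l′ = r , sym (divert-off (θ r) (θ≢w r l)) , gap-above r (ℕₚ.≮⇒≥ ¬l′) l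
      ... | inj₂ l | yes l′ = ⊥-elim (ℕₚ.<-irrefl l (below-end l′))
      ... | inj₂ l | no ¬l′ = next r , trans (θ-first (next r) (next-last r l)) (sym (divert-at (θ r) (θ-last r l))) ,
                              gap-below (next r) (subst (_< m) (sym (next-last r l)) 0<m)

      -- The same for columns M - 1 and 0, where forward blocks leave and backward blocks begin.
      exitBlock : Fin n → Fin n
      exitBlock q with toℕ q <? m
      ... | yes _ = next q
      ... | no _ = q

      exit-steps : ∀ x q r → suc (toℕ x) ≡ M → Steps x q r ⇔ (r ≡ exitBlock q)
      exit-steps x q r l with toℕ q <? m
      ... | yes q<m = mk⇔
        (λ { (inj₁ (_ , e)) → trans (sym e) (carry-last q l)
           ; (inj₂ (m≤r , e)) → ⊥-elim (ℕₚ.<⇒≱ q<m (subst (λ z → m ≤ toℕ z) (trans (sym (carryBack-+ (final⇒≢0 l))) e) m≤r)) })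
        (λ { refl → inj₁ (q<m , carry-last q l) })
      ... | no ¬q<m = mk⇔
        (λ { (inj₁ (q<m , _)) → ⊥-elim (¬q<m q<m)
           ; (inj₂ (_ , e)) → trans (sym (carryBack-+ (final⇒≢0 l))) e })
        (λ { refl → inj₂ (ℕₚ.≮⇒≥ ¬q<m , carryBack-+ (final⇒≢0 l)) })

      res-unique : ∀ {a i} → ι a ≈ i → a ≡ res i
      res-unique e = ι-injective (≈-trans e (≈-sym (ι-res _)))

      exit-below : ∀ q → toℕ q < m → exitBlock q ≡ next q
      exit-below q l with toℕ q <? m
      ... | yes _ = refl
      ... | no ¬l = ⊥-elim (¬l l)

      exit-above : ∀ q → m ≤ toℕ q → exitBlock q ≡ q
      exit-above q l with toℕ q <? m
      ... | yes l′ = ⊥-elim (ℕₚ.<⇒≱ l′ l)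
      ... | no _ = refl

      ExitTarget : Fin n → Set
      ExitTarget q = ∃[ v ] (θ v ≡ divert u w (res (ι (θ q) + s)) × gap v ≡ exitBlock q)

      smooth : ∀ {q} v → 0 < toℕ v → ι (θ v) ≈ ι (θ q) + s → θ v ≡ divert u w (res (ι (θ q) + s))
      smooth v 0<v e = trans (res-unique e) (sym (divert-off _ (λ e′ → θ≢u v 0<v (trans (res-unique e) e′))))

      -- Blocks m - 1 and m meet at position m of column 0, which holds w = θ (n - 1). Their
      -- untraded neighbours there are among u and w, and the diversion sends both to w.
      turning : ∀ q → suc (toℕ q) ≡ m ⊎ toℕ q ≡ m → exitBlock q ≡ fromℕ< m<n → ExitTarget q
      turning q h e = ℓ , trans (θ-last ℓ ℓ-last) (sym (case turn q h of λ
          { (inj₁ at-u) → divert-at _ (sym (res-unique at-u))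
          ; (inj₂ at-w) → divert-fixed _ (sym (res-unique at-w)) })) , trans (gap-end ℓ ℓ-last) (sym e)

      exit-target : ∀ q → ExitTarget q
      exit-target q with ℕₚ.<-cmp (toℕ q) m
      ... | tri< l _ _ with ℕₚ.m≤n⇒m<n∨m≡n l
      ...   | inj₁ l′ = next q , smooth (next q) (subst (0 <_) (sym q′≡) (s≤s z≤n)) (ascend q l′) ,
              trans (gap-below (next q) (subst (_< m) (sym q′≡) l′)) (sym (exit-below q l))
        where q′≡ = next-< q (ℕₚ.<-trans l′ m<n)
      ...   | inj₂ e = turning q (inj₁ e) (trans (exit-below q l) (Fₚ.toℕ-injective
              (trans (next-< q (below-end l)) (trans e (sym (Fₚ.toℕ-fromℕ< m<n))))))
      exit-target q | tri≈ _ e _ = turning q (inj₂ e) (trans (exit-above q (ℕₚ.≤-reflexive (sym e)))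
              (Fₚ.toℕ-injective (trans e (sym (Fₚ.toℕ-fromℕ< m<n)))))
      -- A backward block q > m holds in column 0 the vertex θ (q - 1), as `gap` moves that index up
      -- by one.
      exit-target q | tri> _ _ l = v , smooth v (ℕₚ.<-≤-trans 0<m m≤v) (subst (λ z → ι (θ v) ≈ ι (θ z) + s) next-v (descend v m≤v v<)) ,
              trans (gap-above v m≤v v<) (trans next-v (sym (exit-above q (ℕₚ.<⇒≤ l))))
        where
        instance
          q≢0 : NonZero (toℕ q)
          q≢0 = ℕ.>-nonZero (ℕₚ.≤-trans (s≤s z≤n) l)
        v<n : ℕ.pred (toℕ q) < n
        v<n = ℕₚ.≤-<-trans ℕₚ.pred[n]≤n (Fₚ.toℕ<n q)
        v : Fin n
        v = fromℕ< v<n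
        suc-v : suc (toℕ v) ≡ toℕ q
        suc-v = trans (cong suc (Fₚ.toℕ-fromℕ< v<n)) (ℕₚ.suc-pred (toℕ q))
        m≤v : m ≤ toℕ v
        m≤v = ℕ.s≤s⁻¹ (subst (suc m ≤_) (sym suc-v) l)
        v< : suc (toℕ v) < n
        v< = subst (_< n) (sym suc-v) (Fₚ.toℕ<n q)
        next-v : next v ≡ q
        next-v = Fₚ.toℕ-injective (trans (next-< v v<) suc-v)

      solve-gap : ∀ {a v q} → gap v ≡ q → (q ≡ gap (θ⁻¹ a)) ⇔ (a ≡ θ v)
      solve-gap {a} {v} refl = mk⇔ (λ e → Equivalence.to θ-solve (sym (gap-injective e)))
                                   (λ e → cong gap (sym (Equivalence.from θ-solve e)))

      sym⇔ : ∀ {A : Set} {x y : A} → (x ≡ y) ⇔ (y ≡ x)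
      sym⇔ = mk⇔ sym sym

      next≢0 : ∀ (x : Fin M) → suc (toℕ x) < M → toℕ (next x) ≢ 0
      next≢0 x l e = case trans (sym (next-< x l)) e of λ ()

      blocks : ∀ {x a b q r} → κ x a ≡ q → κ (next x) b ≡ r → HamRel m κ x a b ⇔ Steps x q r
      blocks refl refl = mk⇔ (λ h → h) (λ h → h)

      rel : ∀ x (pos : Position x) a b → HamRel m κ x a b ⇔ TurnedAt u w (shift x) pos a b
      rel x (first x≡0) a b with entry-target (θ⁻¹ (back (next x) b))
      ... | v , θv , gv =
        ≡-substʳ (trans θv (cong (divert w u) (trans (θθ⁻¹ _) (res-cong (≡⇒≈ (cong (λ z → ι b - z) shift≡)))))) ⇔-∘
        (solve-gap gv ⇔-∘ (sym⇔ ⇔-∘ (entry-steps x _ _ x≡0 ⇔-∘ blocks (κ-0 x a x≡0) (κ-+ (next x) b (next≢0 x (first⇒< x≡0))))))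
        where
        minus0 : ∀ p → p - 0ℤ ≡ p
        minus0 = solve-∀
        shift≡ : P (next x) ≡ shift x
        shift≡ = sym (trans (shift-< x (first⇒< x≡0)) (trans (cong (λ z → P (next x) - z) (P0 x x≡0)) (minus0 (P (next x)))))
      rel x (inner x≢0 l) a b =
        translate-inner x l ⇔-∘ (res≡⇔ ⇔-∘ (mk⇔ θ⁻¹-injective (cong θ⁻¹) ⇔-∘ (steps ⇔-∘ blocks (κ-+ x a x≢0) (κ-+ (next x) b (next≢0 x l)))))
        where
        q = θ⁻¹ (back x a)
        r = θ⁻¹ (back (next x) b)
        steps : Steps x q r ⇔ (q ≡ r)
        steps = mk⇔ (λ { (inj₁ (_ , e)) → trans (sym (carry-< q l)) e ; (inj₂ (_ , e)) → trans (sym e) (carryBack-+ x≢0) })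
          (λ e → case toℕ q <? m of λ
            { (yes q<m) → inj₁ (q<m , trans (carry-< q l) e)
            ; (no ¬q<m) → inj₂ (subst (λ z → m ≤ toℕ z) e (ℕₚ.≮⇒≥ ¬q<m) , trans (carryBack-+ x≢0) (sym e)) })
      rel x (final l) a b with exit-target (θ⁻¹ (back x a))
      ... | v , θv , gv =
        ≡-substʳ (trans θv (cong (divert u w) (res-cong (≈-trans (≈-+ {c = s} (≈-trans (≡⇒≈ (cong ι (θθ⁻¹ _))) (ι-res _)) ≈-refl)
          (≡⇒≈ (trans (lemma (ι a) (P x) s) (cong (λ z → ι a + z) (sym (shift-last x l)))))))))
        ⇔-∘ (solve-gap gv ⇔-∘ (sym⇔ ⇔-∘ (exit-steps x _ _ l ⇔-∘ blocks (κ-+ x a (final⇒≢0 l)) (κ-0 (next x) b (next-last x l)))))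
        where
        lemma : ∀ a p s → (a - p) + s ≡ a + (s - p)
        lemma = solve-∀

    Turned : EdgeRel M n
    Turned x = TurnedAt u w (shift x) (position x)

    turnedRow : FactorOn M n (M ℕ.* n) Turned
    turnedRow = mapEdges (λ x → rel x (position x)) (hamFactor M≥3 κ κ-injective m)

  -- Exchange of edges between two rows

  module _ {n : ℕ} (r₁ r₂ : Fin n) where

    partner : Fin n → Fin n
    partner r with r ≟ r₁ | r ≟ r₂
    ... | yes _ | _ = r₂
    ... | no _ | yes _ = r₁
    ... | no _ | no _ = r

    partner-r₁ : partner r₁ ≡ r₂
    partner-r₁ with r₁ ≟ r₁
    ... | yes _ = refl
    ... | no h = ⊥-elim (h refl)

    partner-r₂ : partner r₂ ≡ r₁
    partner-r₂ with r₂ ≟ r₁ | r₂ ≟ r₂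
    ... | yes e | _ = e
    ... | no _ | yes _ = refl
    ... | no _ | no h = ⊥-elim (h refl)

    partner-other : ∀ r → r ≢ r₁ → r ≢ r₂ → partner r ≡ r
    partner-other r h₁ h₂ with r ≟ r₁ | r ≟ r₂
    ... | yes e | _ = ⊥-elim (h₁ e)
    ... | no _ | yes e = ⊥-elim (h₂ e)
    ... | no _ | no _ = refl

    partner-involutive : ∀ r → partner (partner r) ≡ r
    partner-involutive r with r ≟ r₁ | r ≟ r₂
    ... | yes refl | _ = partner-r₂
    ... | no _ | yes refl = partner-r₁
    ... | no h₁ | no h₂ = partner-other r h₁ h₂

  -- Branches on a decision of an arbitrary `S`, so that proofs can generalise over the decision
  -- without unfolding `special?`.
  if-dec : ∀ {S : Set} {A : Set₁} → Dec S → A → A → A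
  if-dec (yes _) p q = p
  if-dec (no _)  p q = q

  module _ {n : ℕ} {{_ : NonZero n}} where
    open Residues n

    -- The edges that two rows exchange, for shifts t and t + 1 of the two rows.
    Special : Fin n → Fin n → ℤ → ∀ {M} {x : Fin M} → Position x → Fin n → Fin n → Set
    Special u w t (first _)   a b = res (ι b - t) ≡ w × (a ≡ u ⊎ a ≡ w)
    Special u w t (inner _ _) a b = ⊥
    Special u w t (final _)   a b = res (ι a + t) ≡ u × (b ≡ u ⊎ b ≡ w)

    special? : ∀ u w t {M} {x : Fin M} (pos : Position x) a b → Dec (Special u w t pos a b)
    special? u w t (first _)   a b = (res (ι b - t) ≟ w) ×-dec ((a ≟ u) ⊎-dec (a ≟ w))
    special? u w t (inner _ _) a b = no λ ()
    special? u w t (final _)   a b = (res (ι a + t) ≟ u) ×-dec ((b ≟ u) ⊎-dec (b ≟ w))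

    res≡⇔≈ι : ∀ {i c} → (res i ≡ c) ⇔ (i ≈ ι c)
    res≡⇔≈ι {i} {c} = mk⇔ (λ e → ≈-trans (≈-sym (ι-res i)) (≡⇒≈ (cong ι e))) (λ e → ι-injective (≈-trans (ι-res i) e))

    -- The exchanged 4-cycle looks the same from the other row once u and w change places: its
    -- vertex in column 1 is w + t = u + t′, and w - t′ = u - t likewise in the last column.
    special-sym : ∀ {u w t t′ M} {x : Fin M} (pos : Position x) a b → t′ ≈ t + 1ℤ → ι w ≈ ι u + 1ℤ →
      Special u w t pos a b ⇔ Special w u t′ pos a b
    special-sym {u} {w} {t} {t′} (first _) a b p q = mk⇔
      (λ (e , h) → Equivalence.from res≡⇔≈ι (lin₂ 1ℤ 1ℤ 0ℤ (Equivalence.to res≡⇔≈ι e) (≈-- q p) (f (ι u) (ι w) (ι b) t t′ (+ n))) , Sum.swap h)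
      (λ (e , h) → Equivalence.from res≡⇔≈ι (lin₂ 1ℤ (- 1ℤ) 0ℤ (Equivalence.to res≡⇔≈ι e) (≈-- q p) (g (ι u) (ι w) (ι b) t t′ (+ n))) , Sum.swap h)
      where
      f : ∀ u w b t t′ N → b - t′ - u ≡ 1ℤ * (b - t - w) + 1ℤ * ((w - t′) - ((u + 1ℤ) - (t + 1ℤ))) + 0ℤ * N
      f = solve-∀
      g : ∀ u w b t t′ N → b - t - w ≡ 1ℤ * (b - t′ - u) + - 1ℤ * ((w - t′) - ((u + 1ℤ) - (t + 1ℤ))) + 0ℤ * N
      g = solve-∀
    special-sym (inner _ _) a b p q = mk⇔ (λ h → h) (λ h → h)
    special-sym {u} {w} {t} {t′} (final _) a b p q = mk⇔
      (λ (e , h) → Equivalence.from res≡⇔≈ι (lin₂ 1ℤ (- 1ℤ) 0ℤ (Equivalence.to res≡⇔≈ι e) (≈-- q p) (f (ι u) (ι w) (ι a) t t′ (+ n))) , Sum.swap h)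
      (λ (e , h) → Equivalence.from res≡⇔≈ι (lin₂ 1ℤ 1ℤ 0ℤ (Equivalence.to res≡⇔≈ι e) (≈-- q p) (g (ι u) (ι w) (ι a) t t′ (+ n))) , Sum.swap h)
      where
      f : ∀ u w a t t′ N → a + t′ - w ≡ 1ℤ * (a + t - u) + - 1ℤ * ((w - t′) - ((u + 1ℤ) - (t + 1ℤ))) + 0ℤ * N
      f = solve-∀
      g : ∀ u w a t t′ N → a + t - u ≡ 1ℤ * (a + t′ - w) + 1ℤ * ((w - t′) - ((u + 1ℤ) - (t + 1ℤ))) + 0ℤ * N
      g = solve-∀

    module _ {u w : Fin n} {t t′ d : ℤ} (t′≈ : t′ ≈ t + d) (w≈ : ι w ≈ ι u + d) where

      private
        first-old : ∀ a b → (a ≡ res (ι b - t)) ⇔ (ι b ≈ ι a + t)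
        first-old a b = mk⇔ (λ e → lin₁ 1ℤ 0ℤ (Equivalence.to res≡⇔≈ι (sym e)) (fwd (ι a) (ι b) t (+ n)))
                            (λ e → sym (Equivalence.from res≡⇔≈ι (lin₁ 1ℤ 0ℤ e (bwd (ι a) (ι b) t (+ n)))))
          where
          fwd : ∀ a b t N → b - (a + t) ≡ 1ℤ * ((b - t) - a) + 0ℤ * N
          fwd = solve-∀
          bwd : ∀ a b t N → (b - t) - a ≡ 1ℤ * (b - (a + t)) + 0ℤ * N
          bwd = solve-∀

        final-old : ∀ a b → (b ≡ res (ι a + t)) ⇔ (ι b ≈ ι a + t)
        final-old a b = mk⇔ (λ e → ≈-sym (Equivalence.to res≡⇔≈ι (sym e))) (λ e → sym (Equivalence.from res≡⇔≈ι (≈-sym e)))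

        first-new : ∀ a b → res (ι b - t) ≡ w → (a ≡ u) ⇔ (ι b ≈ ι a + t′)
        first-new a b e = mk⇔ (λ { refl → onward })
            (λ h → ι-injective (lin₂ 1ℤ (- 1ℤ) 0ℤ onward h (lemma (ι a) (ι b) (ι u) t′ (+ n))))
          where
          add : ∀ b u w t t′ d N → b - (u + t′) ≡ 1ℤ * ((b - t) - w) + 1ℤ * ((w - t′) - ((u + d) - (t + d))) + 0ℤ * N
          add = solve-∀
          onward : ι b ≈ ι u + t′
          onward = lin₂ 1ℤ 1ℤ 0ℤ (Equivalence.to res≡⇔≈ι e) (≈-- w≈ t′≈) (add (ι b) (ι u) (ι w) t t′ d (+ n))
          lemma : ∀ a b u t N → a - u ≡ 1ℤ * (b - (u + t)) + - 1ℤ * (b - (a + t)) + 0ℤ * N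
          lemma = solve-∀

        final-new : ∀ a b → res (ι a + t) ≡ u → (b ≡ w) ⇔ (ι b ≈ ι a + t′)
        final-new a b e = mk⇔ (λ { refl → onward }) (λ h → ι-injective (≈-trans h (≈-sym onward)))
          where
          add : ∀ a u w t t′ d N → w - (a + t′) ≡ - 1ℤ * ((a + t) - u) + 1ℤ * ((w - t′) - ((u + d) - (t + d))) + 0ℤ * N
          add = solve-∀
          onward : ι w ≈ ι a + t′
          onward = lin₂ (- 1ℤ) 1ℤ 0ℤ (Equivalence.to res≡⇔≈ι e) (≈-- w≈ t′≈) (add (ι a) (ι u) (ι w) t t′ d (+ n))

      -- The diversion affects only the vertex whose old neighbour is w in the first layer, u in the
      -- last. Its new neighbour is the one that shift t′ of the partner row prescribes. The
      -- difference d is 1 for one row and -1 for the other.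
      turned-exchange : ∀ {S : Set} (D : Dec S) {M} {x : Fin M} (pos : Position x) a b → S ⇔ Special u w t pos a b →
        TurnedAt u w t pos a b ⇔ if-dec D (ι b ≈ ι a + t′) (ι b ≈ ι a + t)
      turned-exchange (yes p) (first _) a b S⇔ = first-new a b e ⇔-∘ ≡-substʳ (divert-at _ e)
        where e = proj₁ (Equivalence.to S⇔ p)
      turned-exchange (yes p) (inner _ _) a b S⇔ = ⊥-elim (Equivalence.to S⇔ p)
      turned-exchange (yes p) (final _) a b S⇔ = final-new a b e ⇔-∘ ≡-substʳ (divert-at _ e)
        where e = proj₁ (Equivalence.to S⇔ p)
      turned-exchange (no ¬p) (first _) a b S⇔ = case res (ι b - t) ≟ w of λ
        { (no ¬e) → first-old a b ⇔-∘ ≡-substʳ (divert-off _ ¬e)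
        ; (yes e) → mk⇔
            (λ h → ⊥-elim (¬p (Equivalence.from S⇔ (e , inj₁ (trans h (divert-at _ e))))))
            (λ h → ⊥-elim (¬p (Equivalence.from S⇔ (e , inj₂ (trans (Equivalence.from (first-old a b) h) e))))) }
      turned-exchange (no ¬p) (inner _ _) a b S⇔ = mk⇔ (λ h → h) (λ h → h)
      turned-exchange (no ¬p) (final _) a b S⇔ = case res (ι a + t) ≟ u of λ
        { (no ¬e) → final-old a b ⇔-∘ ≡-substʳ (divert-off _ ¬e)
        ; (yes e) → mk⇔
            (λ h → ⊥-elim (¬p (Equivalence.from S⇔ (e , inj₂ (trans h (divert-at _ e))))))
            (λ h → ⊥-elim (¬p (Equivalence.from S⇔ (e , inj₁ (trans (Equivalence.from (final-old a b) h) e))))) }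

  module Scheme {M n : ℕ} (M≥3 : 3 ≤ M) {{_ : NonZero n}}
    (P : Fin n → Fin M → ℤ) (P0 : ∀ r x → toℕ x ≡ 0 → P r x ≡ 0ℤ) (s : Fin n → ℤ) where
    open Residues n

    private
      module R (r : Fin n) = Row {M} {n} M≥3 (P r) (P0 r) (s r)

    shift : Fin M → Fin n → ℤ
    shift x r = R.shift r x

    Latin : Set
    Latin = ∀ x {r r′} → shift x r ≈ shift x r′ → r ≡ r′

    module _ {y : ℕ} (y≤n : y ≤ n) (latin : Latin) (closed : ∀ r → y ≤ toℕ r → s r ≈ 0ℤ) where

      -- The shifts of a layer are distinct, hence exhaust the residues, and exactly one of them is
      -- b - a.
      one : ∀ x a b → ExactlyOne (λ r → R.Translate r x a b)
      one x a b = t ,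
        lin₁ (- 1ℤ) 0ℤ (res-injective e) (fwd (ι a) (ι b) (shift x t) (+ n)) ,
        λ r h → latin x (lin₂ 1ℤ (- 1ℤ) 0ℤ (res-injective (sym e)) h (bwd (ι a) (ι b) (shift x r) (shift x t) (+ n)))
        where
        π : Fin n → Fin n
        π r = res (shift x r)
        π-injective : Injective _≡_ _≡_ π
        π-injective e = latin x (res-injective e)
        t = inv π π-injective (res (ι b - ι a))
        e = inv-right π π-injective (res (ι b - ι a))
        fwd : ∀ a b t N → b - (a + t) ≡ - 1ℤ * (t - (b - a)) + 0ℤ * N
        fwd = solve-∀
        bwd : ∀ a b r t N → r - t ≡ 1ℤ * ((b - a) - t) + - 1ℤ * (b - (a + r)) + 0ℤ * N
        bwd = solve-∀

      translations⇒InHWP : (∀ r → toℕ r < y → ∃[ σ ] σ * s r ≈ 1ℤ) → InHWP (lex (Cyc M) n) M (M ℕ.* n) (n ℕ.∸ y , y)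
      translations⇒InHWP unit = factors⇒InHWP y≤n R.Translate one
        (λ r y≤r → R.closedRow r (closed r y≤r)) (λ r r<y → R.unitRow r (proj₁ (unit r r<y)) (proj₂ (unit r r<y)))

      -- Rows r₁ and r₂ exchange the special edges.  Inside one row this replaces two edges
      -- u L, w R by w L, u R, where L and R lie in the columns M - 1 and 1.
      module _ (r₁ r₂ : Fin n) (r₁<y : toℕ r₁ < y) (r₂<y : toℕ r₂ < y) (u w : Fin n) (w≈u+1 : ι w ≈ ι u + 1ℤ)
        (outer-step : ∀ x → toℕ x ≡ 0 ⊎ suc (toℕ x) ≡ M → shift x r₂ ≈ shift x r₁ + 1ℤ)
        (T₁ : Turning n (s r₁) u w) (T₂ : Turning n (s r₂) w u)
        (unit : ∀ r → toℕ r < y → r ≢ r₁ → r ≢ r₂ → ∃[ σ ] σ * s r ≈ 1ℤ) where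
        private
          σ = partner r₁ r₂

          swap? : ∀ x a b → Dec (Special u w (shift x r₁) (position x) a b)
          swap? x a b = special? u w (shift x r₁) (position x) a b

          E : Fin n → EdgeRel M n
          E r x a b = if-dec (swap? x a b) (R.Translate (σ r) x a b) (R.Translate r x a b)

          -- At each pair a, b the rows are merely renamed, by a transposition or not at all.
          E-one : ∀ x a b → ExactlyOne (λ r → E r x a b)
          E-one x a b = go (swap? x a b) (one x a b)
            where
            go : ∀ {S : Set} (D : Dec S) → ExactlyOne (λ r → R.Translate r x a b) →
              ExactlyOne (λ r → if-dec D (R.Translate (σ r) x a b) (R.Translate r x a b))
            go (no _) h = h
            go (yes _) (t , h , unique) = σ t , subst (λ z → R.Translate z x a b) (sym (partner-involutive r₁ r₂ t)) h ,
              λ r e → trans (sym (partner-involutive r₁ r₂ r)) (cong σ (unique (σ r) e))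

          plain : ∀ r → r ≢ r₁ → r ≢ r₂ → ∀ {ℓ} → FactorOn M n ℓ (R.Translate r) → FactorOn M n ℓ (E r)
          plain r h₁ h₂ = mapEdges (λ x a b → go (swap? x a b) x a b)
            where
            go : ∀ {S : Set} (D : Dec S) x a b → R.Translate r x a b ⇔ if-dec D (R.Translate (σ r) x a b) (R.Translate r x a b)
            go (no _) x a b = mk⇔ (λ h → h) (λ h → h)
            go (yes _) x a b = mk⇔ (subst (λ z → R.Translate z x a b) (sym (partner-other r₁ r₂ r h₁ h₂)))
                                   (subst (λ z → R.Translate z x a b) (partner-other r₁ r₂ r h₁ h₂))

          turned : ∀ r r′ u′ w′ d → σ r ≡ r′ → ι w′ ≈ ι u′ + d →
            (∀ x → toℕ x ≡ 0 ⊎ suc (toℕ x) ≡ M → shift x r′ ≈ shift x r + d) →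
            (∀ x a b → Special u w (shift x r₁) (position x) a b ⇔ Special u′ w′ (shift x r) (position x) a b) →
            Turning n (s r) u′ w′ → FactorOn M n (M ℕ.* n) (E r)
          turned r r′ u′ w′ d refl w≈ step S⇔ T = mapEdges
            (λ x a b → go x a b (position x) (swap? x a b) (S⇔ x a b)) (TurnedRow.turnedRow {M} {n} M≥3 (P r) (P0 r) (s r) u′ w′ T)
            where
            go : ∀ x a b (pos : Position x) {S : Set} (D : Dec S) → S ⇔ Special u′ w′ (shift x r) pos a b →
              TurnedAt u′ w′ (shift x r) pos a b ⇔ if-dec D (R.Translate (σ r) x a b) (R.Translate r x a b)
            go x a b pos@(first e) D h = turned-exchange {u = u′} {w′} {shift x r} {shift x (σ r)} {d} (step x (inj₁ e)) w≈ D pos a b h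
            go x a b (inner _ _) (yes p) h = ⊥-elim (Equivalence.to h p)
            go x a b (inner _ _) (no _) h = mk⇔ (λ e → e) (λ e → e)
            go x a b pos@(final e) D h = turned-exchange {u = u′} {w′} {shift x r} {shift x (σ r)} {d} (step x (inj₂ e)) w≈ D pos a b h

          1-shift : ∀ {i j} → i ≈ j + 1ℤ → j ≈ i + - 1ℤ
          1-shift {i} {j} e = lin₁ (- 1ℤ) 0ℤ e (lemma i j (+ n))
            where
            lemma : ∀ i j N → j - (i + - 1ℤ) ≡ - 1ℤ * (i - (j + 1ℤ)) + 0ℤ * N
            lemma = solve-∀

          ham : ∀ r → toℕ r < y → FactorOn M n (M ℕ.* n) (E r)
          ham r r<y = case r ≟ r₁ of λ
            { (yes refl) → turned r₁ r₂ u w 1ℤ (partner-r₁ r₁ r₂) w≈u+1 outer-step (λ x a b → mk⇔ (λ h → h) (λ h → h)) T₁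
            ; (no h₁) → case r ≟ r₂ of λ
              { (yes refl) → turned r₂ r₁ w u (- 1ℤ) (partner-r₂ r₁ r₂) (1-shift w≈u+1) (λ x h → 1-shift (outer-step x h))
                  (λ x a b → sym-at x a b (position x)) T₂
              ; (no h₂) → plain r h₁ h₂ (R.unitRow r (proj₁ (unit r r<y h₁ h₂)) (proj₂ (unit r r<y h₁ h₂))) } }
            where
            sym-at : ∀ x a b (pos : Position x) → Special u w (shift x r₁) pos a b ⇔ Special w u (shift x r₂) pos a b
            sym-at x a b pos@(first e) = special-sym {u = u} {w} {shift x r₁} {shift x r₂} pos a b (outer-step x (inj₁ e)) w≈u+1
            sym-at x a b (inner _ _) = mk⇔ (λ h → h) (λ h → h)
            sym-at x a b pos@(final e) = special-sym {u = u} {w} {shift x r₁} {shift x r₂} pos a b (outer-step x (inj₂ e)) w≈u+1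

        trade⇒InHWP : InHWP (lex (Cyc M) n) M (M ℕ.* n) (n ℕ.∸ y , y)
        trade⇒InHWP = factors⇒InHWP y≤n E E-one
          (λ r y≤r → plain r (λ { refl → ℕₚ.<⇒≱ r₁<y y≤r }) (λ { refl → ℕₚ.<⇒≱ r₂<y y≤r }) (R.closedRow r (closed r y≤r))) ham

  -- Turnings for the row sums that occur

  module _ {n : ℕ} {{_ : NonZero n}} where
    open Residues n

    private
      o i : Fin n
      o = res 0ℤ
      i = res 1ℤ

    -- The map x ↦ 1 - x interchanges 0 and 1 and negates the shift. It serves the second row of a
    -- trade, where u and w have changed roles.
    reflect : ∀ {s s′} → s′ ≈ - s → Turning n s o i → Turning n s′ i o
    reflect {s} {s′} s′≈ T = record
      { θ = θ′
      ; θ-injective = λ {p} {q} e → θ-injective (ι-injective (lin₁ (- 1ℤ) 0ℤ (res-injective e) (f (ι (θ p)) (ι (θ q)) (+ n))))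
      ; m = m ; 0<m = 0<m ; m<n = m<n
      ; θ-first = λ q e → res-cong (lin₁ (- 1ℤ) 0ℤ (≈-trans (≡⇒≈ (cong ι (θ-first q e))) (ι-res 0ℤ)) (at-o (ι (θ q)) (+ n)))
      ; θ-last = λ q e → res-cong (lin₁ (- 1ℤ) 0ℤ (≈-trans (≡⇒≈ (cong ι (θ-last q e))) (ι-res 1ℤ)) (at-i (ι (θ q)) (+ n)))
      ; ascend = λ q l → step (θ q) (θ (next q)) (ascend q l)
      ; descend = λ q l l′ → step (θ (next q)) (θ q) (descend q l l′)
      ; turn = λ q h → case turn q h of λ
          { (inj₁ e) → inj₁ (≈-trans (≡⇒≈ (cong ι i≡)) (step (θ q) o e))
          ; (inj₂ e) → inj₂ (≈-trans (≡⇒≈ (cong ι o≡)) (step (θ q) i e)) }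
      }
      where
      open Turning T
      θ′ : Fin n → Fin n
      θ′ q = res (1ℤ - ι (θ q))
      f : ∀ p q N → p - q ≡ - 1ℤ * ((1ℤ - p) - (1ℤ - q)) + 0ℤ * N
      f = solve-∀
      at-o : ∀ x N → (1ℤ - x) - 1ℤ ≡ - 1ℤ * (x - 0ℤ) + 0ℤ * N
      at-o = solve-∀
      at-i : ∀ x N → (1ℤ - x) - 0ℤ ≡ - 1ℤ * (x - 1ℤ) + 0ℤ * N
      at-i = solve-∀
      i≡ : i ≡ res (1ℤ - ι o)
      i≡ = res-cong (lin₁ 1ℤ 0ℤ (ι-res 0ℤ) (g (ι o) (+ n)))
        where
        g : ∀ x N → 1ℤ - (1ℤ - x) ≡ 1ℤ * (x - 0ℤ) + 0ℤ * N
        g = solve-∀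
      o≡ : o ≡ res (1ℤ - ι i)
      o≡ = res-cong (lin₁ 1ℤ 0ℤ (ι-res 1ℤ) (g (ι i) (+ n)))
        where
        g : ∀ x N → 0ℤ - (1ℤ - x) ≡ 1ℤ * (x - 1ℤ) + 0ℤ * N
        g = solve-∀
      step : ∀ a b → ι b ≈ ι a + s → ι (res (1ℤ - ι b)) ≈ ι (res (1ℤ - ι a)) + s′
      step a b e = ≈-trans (ι-res _) (≈-trans (lin₂ (- 1ℤ) (- 1ℤ) 0ℤ e s′≈ (g (ι a) (ι b) s s′ (+ n)))
                     (≈-+ {c = s′} (≈-sym (ι-res (1ℤ - ι a))) ≈-refl))
        where
        g : ∀ a b s s′ N → (1ℤ - b) - ((1ℤ - a) + s′) ≡ - 1ℤ * (b - (a + s)) + - 1ℤ * (s′ - - s) + 0ℤ * N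
        g = solve-∀

    shift-turning : ∀ {s s′ u w} → s ≈ s′ → Turning n s u w → Turning n s′ u w
    shift-turning {s} {s′} e T = record
      { θ = θ ; θ-injective = θ-injective ; m = m ; 0<m = 0<m ; m<n = m<n ; θ-first = θ-first ; θ-last = θ-last
      ; ascend = λ q l → ≈-trans (ascend q l) (+s (ι (θ q)))
      ; descend = λ q l l′ → ≈-trans (descend q l l′) (+s (ι (θ (next q))))
      ; turn = λ q h → case turn q h of λ
          { (inj₁ e) → inj₁ (≈-trans e (+s (ι (θ q))))
          ; (inj₂ e) → inj₂ (≈-trans e (+s (ι (θ q)))) } }
      where
      open Turning T
      +s : ∀ a → a + s ≈ a + s′
      +s a = ≈-+ {a} ≈-refl e

    module Zigzag (s : ℤ) (m : ℕ) (0<m : 0 < m) (m<n : m < n) (turn-at : + m * s ≈ 1ℤ ⊎ + m * s ≈ 0ℤ)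
      (low : ∀ {j k} → j < m → k < m → + j * s ≈ + k * s → j ≡ k)
      (cross : ∀ {j k} → j < m → m ≤ k → k < n → ¬ (+ j * s ≈ 1ℤ - (1ℤ + + k) * s))
      (high : ∀ {j k} → m ≤ j → m ≤ k → j < n → k < n → (1ℤ + + j) * s ≈ (1ℤ + + k) * s → j ≡ k) where

      private
        -- The multiples of s from 0 upwards, followed by the points 1, 1 + s, ... in reverse. The
        -- `1ℤ +` makes the last term 1 - n s ≈ 1.
        height : ℕ → ℤ
        height k with k <? m
        ... | yes _ = + k * s
        ... | no _ = 1ℤ - (1ℤ + + k) * s

        height-low : ∀ {k} → k < m → height k ≡ + k * s
        height-low {k} l with k <? m
        ... | yes _ = refl
        ... | no ¬l = ⊥-elim (¬l l)

        height-high : ∀ {k} → m ≤ k → height k ≡ 1ℤ - (1ℤ + + k) * s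
        height-high {k} l with k <? m
        ... | yes l′ = ⊥-elim (ℕₚ.<⇒≱ l′ l)
        ... | no _ = refl

        height-injective : ∀ {j k} → j < n → k < n → height j ≈ height k → j ≡ k
        height-injective {j} {k} j<n k<n e with j <? m | k <? m
        ... | yes j<m | yes k<m = low j<m k<m e
        ... | yes j<m | no k≮m = ⊥-elim (cross j<m (ℕₚ.≮⇒≥ k≮m) k<n e)
        ... | no j≮m | yes k<m = ⊥-elim (cross k<m (ℕₚ.≮⇒≥ j≮m) j<n (≈-sym e))
        ... | no j≮m | no k≮m = high (ℕₚ.≮⇒≥ j≮m) (ℕₚ.≮⇒≥ k≮m) j<n k<n (lin₁ (- 1ℤ) 0ℤ e (f ((1ℤ + + j) * s) ((1ℤ + + k) * s) (+ n)))
          where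
          f : ∀ x y N → x - y ≡ - 1ℤ * ((1ℤ - x) - (1ℤ - y)) + 0ℤ * N
          f = solve-∀

        at-low : ∀ q → toℕ q < m → ι (res (height (toℕ q))) ≈ ι q * s
        at-low q l = ≈-trans (ι-res _) (≡⇒≈ (height-low l))

        at-high : ∀ q → m ≤ toℕ q → ι (res (height (toℕ q))) ≈ 1ℤ - (1ℤ + ι q) * s
        at-high q l = ≈-trans (ι-res _) (≡⇒≈ (height-high l))

        ι-suc : ∀ q → suc (toℕ q) < n → ι (next q) ≡ 1ℤ + ι q
        ι-suc q l = cong +_ (next-< q l)

      zigzag : Turning n s o i
      zigzag = record
        { θ = λ q → res (height (toℕ q))
        ; θ-injective = λ {p} {q} e → Fₚ.toℕ-injective (height-injective (Fₚ.toℕ<n p) (Fₚ.toℕ<n q) (res-injective e))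
        ; m = m ; 0<m = 0<m ; m<n = m<n
        ; θ-first = λ q e → res-cong (≡⇒≈ (trans (cong height e) (height-low 0<m)))
        ; θ-last = λ q e → res-cong (≈-trans (≡⇒≈ (height-high (ℕ.s≤s⁻¹ (subst (m <_) (sym e) m<n)))) (last q e))
        ; ascend = λ q l → ≈-trans (at-low (next q) (subst (_< m) (sym (next-< q (ℕₚ.<-trans l m<n))) l))
            (≈-trans (≡⇒≈ (trans (cong (_* s) (ι-suc q (ℕₚ.<-trans l m<n))) (asc (ι q) s)))
              (≈-+ {c = s} (≈-sym (at-low q (ℕₚ.<-trans (ℕₚ.n<1+n _) l))) ≈-refl))
        ; descend = λ q l l′ → ≈-trans (at-high q l) (≈-trans (≡⇒≈ (trans (desc (ι q) s) (cong (λ z → (1ℤ - (1ℤ + z) * s) + s) (sym (ι-suc q l′)))))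
              (≈-+ {c = s} (≈-sym (at-high (next q) (ℕₚ.≤-trans l (ℕₚ.≤-trans (ℕₚ.n≤1+n _) (ℕₚ.≤-reflexive (sym (next-< q l′))))))) ≈-refl))
        ; turn = λ q h → turn′ q h turn-at
        }
        where
        last : ∀ (q : Fin n) → suc (toℕ q) ≡ n → 1ℤ - (1ℤ + ι q) * s ≈ 1ℤ
        last q e = lin₁ (- s) 0ℤ n≈0 (trans (cong (λ z → (1ℤ - z * s) - 1ℤ) (cong +_ e)) (f (+ n) s))
          where
          f : ∀ N s → (1ℤ - N * s) - 1ℤ ≡ - s * (N - 0ℤ) + 0ℤ * N
          f = solve-∀
        asc : ∀ q s → (1ℤ + q) * s ≡ q * s + s
        asc = solve-∀
        desc : ∀ q s → 1ℤ - (1ℤ + q) * s ≡ (1ℤ - (1ℤ + (1ℤ + q)) * s) + s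
        desc = solve-∀
        at-m-1 : ∀ q {c} → suc (toℕ q) ≡ m → + m * s ≈ c → ι (res c) ≈ ι (res (height (toℕ q))) + s
        at-m-1 q {c} e h = ≈-trans (ι-res c) (≈-trans (≈-sym h) (≈-trans (≡⇒≈ (trans (cong (λ z → + z * s) (sym e)) (asc (ι q) s)))
          (≈-+ {c = s} (≈-sym (at-low q (ℕₚ.≤-reflexive e))) ≈-refl)))
        at-m : ∀ q {c d} → toℕ q ≡ m → + m * s ≈ c → d ≡ 1ℤ - c → ι (res d) ≈ ι (res (height (toℕ q))) + s
        at-m q {c} refl h refl = ≈-trans (ι-res _) (≈-trans (lin₁ 1ℤ 0ℤ h (f (ι q) s c (+ n)))
          (≈-+ {c = s} (≈-sym (at-high q ℕₚ.≤-refl)) ≈-refl))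
          where
          f : ∀ q s c N → (1ℤ - c) - ((1ℤ - (1ℤ + q) * s) + s) ≡ 1ℤ * (q * s - c) + 0ℤ * N
          f = solve-∀
        turn′ : ∀ q → suc (toℕ q) ≡ m ⊎ toℕ q ≡ m → + m * s ≈ 1ℤ ⊎ + m * s ≈ 0ℤ →
          ι o ≈ ι (res (height (toℕ q))) + s ⊎ ι i ≈ ι (res (height (toℕ q))) + s
        turn′ q (inj₁ e) (inj₁ h) = inj₂ (at-m-1 q e h)
        turn′ q (inj₁ e) (inj₂ h) = inj₁ (at-m-1 q e h)
        turn′ q (inj₂ e) (inj₁ h) = inj₁ (at-m q e h refl)
        turn′ q (inj₂ e) (inj₂ h) = inj₂ (at-m q e h refl)

    -- The orbit of 0 reaches 1 after m steps, and the remaining path is reversed. A collision j s ≈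
    -- 1 - (1 + k) s, multiplied by m, gives j + k + 1 ≈ m, but j < m ≤ k < n puts j + k + 1 - m
    -- strictly between 0 and n.
    unitTurning : ∀ s m → 0 < m → m < n → + m * s ≈ 1ℤ → Turning n s o i
    unitTurning s m 0<m m<n unit = Zigzag.zigzag s m 0<m m<n (inj₁ unit)
      (λ {j} {k} j<m k<m e → +-injective (ℕₚ.<-trans j<m m<n) (ℕₚ.<-trans k<m m<n) (divide {+ j} {+ k} e))
      (λ {j} {k} j<m m≤k k<n e → +≢≈0 {j ℕ.+ suc k ℕ.∸ m}
        (ℕₚ.m<n⇒0<n∸m (ℕₚ.<-≤-trans (s≤s m≤k) (ℕₚ.m≤n+m (suc k) j)))
        (ℕₚ.+-cancelʳ-< m _ _ (subst (_< n ℕ.+ m) (sym (ℕₚ.m∸n+n≡m (ℕₚ.≤-trans m≤k (ℕₚ.≤-trans (ℕₚ.n≤1+n k) (ℕₚ.m≤n+m (suc k) j)))))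
          (subst (j ℕ.+ suc k <_) (ℕₚ.+-comm m n) (ℕₚ.+-mono-<-≤ j<m k<n))))
        (crossing {j} {k} (ℕₚ.≤-trans m≤k (ℕₚ.≤-trans (ℕₚ.n≤1+n k) (ℕₚ.m≤n+m (suc k) j))) e))
      (λ {j} {k} _ _ j<n k<n e → +-injective j<n k<n (lin₁ 1ℤ 0ℤ (divide {1ℤ + + j} {1ℤ + + k} e) (f (+ j) (+ k) (+ n))))
      where
      divide : ∀ {x y} → x * s ≈ y * s → x ≈ y
      divide {x} {y} e = unit-cancel s (+ m) unit (subst₂ _≈_ (ℤₚ.*-comm x s) (ℤₚ.*-comm y s) e)
      f : ∀ j k N → j - k ≡ 1ℤ * ((1ℤ + j) - (1ℤ + k)) + 0ℤ * N
      f = solve-∀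
      crossing : ∀ {j k} → m ≤ j ℕ.+ suc k → + j * s ≈ 1ℤ - (1ℤ + + k) * s → + (j ℕ.+ suc k ℕ.∸ m) ≈ 0ℤ
      crossing {j} {k} l e = lin₂ (+ m) (- (+ j + (1ℤ + + k))) 0ℤ e unit (trans (cong (_- 0ℤ) rewritten) (g (+ j) (+ k) (+ m) s (+ n)))
        where
        rewritten : + (j ℕ.+ suc k ℕ.∸ m) ≡ + j + (1ℤ + + k) - + m
        rewritten = trans (sym (ℤₚ.⊖-≥ l)) (sym (ℤₚ.m-n≡m⊖n (j ℕ.+ suc k) m))
        g : ∀ j k m s N → j + (1ℤ + k) - m - 0ℤ ≡ m * (j * s - (1ℤ - (1ℤ + k) * s)) + - (j + (1ℤ + k)) * (m * s - 1ℤ) + 0ℤ * N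
        g = solve-∀

  -- Here s runs twice through the m = n / 2 residues of one parity.
  halfTurning : ∀ s m {{_ : NonZero m}} {{_ : NonZero (m ℕ.+ m)}} → let open Residues (m ℕ.+ m) in
    ∀ g → s ≡ + 2 * g → ∀ f → f * s ≈ + 2 → + m * s ≈ 0ℤ → Turning (m ℕ.+ m) s (res 0ℤ) (res 1ℤ)
  halfTurning s m g refl f f*s≈2 m*s≈0 = Zigzag.zigzag s m (ℕ.>-nonZero⁻¹ m) m<n (inj₂ m*s≈0)
    (λ {j} {k} j<m k<m e → Residues.+-injective m j<m k<m (halve {+ j} {+ k} e))
    (λ {j} {k} _ _ _ → cross {j} {k})
    (λ {j} {k} m≤j m≤k j<n k<n e → trans (sym (ℕₚ.m∸n+n≡m m≤j)) (trans
       (cong (ℕ._+ m) (Residues.+-injective m (under m≤j j<n) (under m≤k k<n) (lower m≤j m≤k (halve {1ℤ + + j} {1ℤ + + k} e)))) (ℕₚ.m∸n+n≡m m≤k)))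
    where
    open Residues (m ℕ.+ m)
    module H = Residues m
    m<n : m < m ℕ.+ m
    m<n = ℕₚ.m<m+n m (ℕ.>-nonZero⁻¹ m)
    under : ∀ {j} → m ≤ j → j < m ℕ.+ m → j ℕ.∸ m < m
    under {j} l l′ = ℕₚ.+-cancelʳ-< m _ _ (subst (_< m ℕ.+ m) (sym (ℕₚ.m∸n+n≡m l)) l′)
    -- The factor f replaces s by 2, and cancelling the 2 halves the modulus.
    halve : ∀ {x y} → x * s ≈ y * s → x H.≈ y
    halve {x} {y} e = H.mod (Residues._≈_.quot e₂) (ℤₚ.*-cancelˡ-≡ (+ 2) _ _
        (trans (split x y) (trans (Residues._≈_.difference e₂) (join (Residues._≈_.quot e₂) (+ m)))))
      where
      e₂ : x * + 2 ≈ y * + 2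
      e₂ = lin₂ f (y - x) 0ℤ e f*s≈2 (h x y f s (+ (m ℕ.+ m)))
        where
        h : ∀ x y f s N → x * + 2 - y * + 2 ≡ f * (x * s - y * s) + (y - x) * (f * s - + 2) + 0ℤ * N
        h = solve-∀
      split : ∀ x y → + 2 * (x - y) ≡ x * + 2 - y * + 2
      split = solve-∀
      join : ∀ q m → q * (m + m) ≡ + 2 * (q * m)
      join = solve-∀
    lower : ∀ {j k} → m ≤ j → m ≤ k → (1ℤ + + j) H.≈ (1ℤ + + k) → + (j ℕ.∸ m) H.≈ + (k ℕ.∸ m)
    lower {j} {k} l l′ e = subst₂ H._≈_ (minus l) (minus l′) (H.lin₁ 1ℤ 0ℤ e (h (+ j) (+ k) (+ m)))
      where
      minus : ∀ {j} → m ≤ j → + j - + m ≡ + (j ℕ.∸ m)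
      minus {j} l = trans (ℤₚ.m-n≡m⊖n j m) (ℤₚ.⊖-≥ l)
      h : ∀ j k m → (j - m) - (k - m) ≡ 1ℤ * ((1ℤ + j) - (1ℤ + k)) + 0ℤ * m
      h = solve-∀
    odd : ∀ z → + 2 * z ≢ 1ℤ
    odd z e = case ℕₚ.m*n≡1⇒m≡1 2 ∣ z ∣ (trans (sym (ℤₚ.abs-* (+ 2) z)) (cong ∣_∣ e)) of λ ()
    -- The left side is even and the right side odd, while the modulus is even.
    cross : ∀ {j k} → ¬ (+ j * s ≈ 1ℤ - (1ℤ + + k) * s)
    cross {j} {k} (mod q e) = odd (+ j * g + (1ℤ + + k) * g - q * + m) (trans (h (+ j) (+ k) g q (+ m)) (trans (cong (λ z → (z + 1ℤ) - q * (+ m + + m)) e) (h′ (q * (+ m + + m)))))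
      where
      h : ∀ j k g q m → + 2 * (j * g + (1ℤ + k) * g - q * m) ≡ ((j * (+ 2 * g) - (1ℤ - (1ℤ + k) * (+ 2 * g))) + 1ℤ) - q * (m + m)
      h = solve-∀
      h′ : ∀ x → (x + 1ℤ) - x ≡ 1ℤ
      h′ = solve-∀

  module _ {n : ℕ} {{_ : NonZero n}} where
    open Residues n

    minusOneTurning : 2 ≤ n → Turning n (- 1ℤ) (res 0ℤ) (res 1ℤ)
    minusOneTurning n≥2 = unitTurning (- 1ℤ) (ℕ.pred n) (ℕ.s≤s⁻¹ (subst (2 ≤_) (sym n≡) n≥2)) (ℕₚ.≤-reflexive n≡)
      (lin₁ (- 1ℤ) 0ℤ n≈0 (trans (h (+ ℕ.pred n) (+ n)) (cong (λ z → - 1ℤ * (z - 0ℤ) + 0ℤ * + n) (cong +_ n≡))))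
      where
      n≡ : suc (ℕ.pred n) ≡ n
      n≡ = ℕₚ.suc-pred n
      h : ∀ p N → p * - 1ℤ - 1ℤ ≡ - 1ℤ * ((1ℤ + p) - 0ℤ) + 0ℤ * N
      h = solve-∀

  module _ (h : ℕ) {{_ : NonZero h}} {{_ : NonZero (h ℕ.+ h)}} where
    open Residues (h ℕ.+ h)

    minusTwoTurning : Turning (h ℕ.+ h) (- + 2) (res 0ℤ) (res 1ℤ)
    minusTwoTurning = halfTurning (- + 2) h (- 1ℤ) refl (- 1ℤ) ≈-refl
      (mod (- 1ℤ) (f (+ h)))
      where
      f : ∀ h → h * - + 2 - 0ℤ ≡ - 1ℤ * (h + h)
      f = solve-∀

  -- For even h, (h - 1)² = h² - 2 h + 1 ≈ 1, so h - 1 is its own inverse mod 2 h. For odd h it is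
  -- even and -2 (h - 1) ≈ 2.
  halfMinusOneTurning : ∀ h {{_ : NonZero h}} {{_ : NonZero (h ℕ.+ h)}} → let open Residues (h ℕ.+ h) in
    Turning (h ℕ.+ h) (+ h - 1ℤ) (res 0ℤ) (res 1ℤ)
  halfMinusOneTurning h with halves h
    where
    halves : ∀ h {{_ : NonZero h}} → ∃[ k ] (h ≡ suc (suc (k ℕ.+ k)) ⊎ h ≡ suc (k ℕ.+ k))
    halves (suc zero) = 0 , inj₂ refl
    halves (suc (suc zero)) = 0 , inj₁ refl
    halves (suc (suc h@(suc _))) with halves h
    ... | k , inj₁ e = suc k , inj₁ (cong (λ z → suc (suc z)) (trans e (cong suc (sym (ℕₚ.+-suc k k)))))
    ... | k , inj₂ e = suc k , inj₂ (cong (λ z → suc (suc z)) (trans e (sym (ℕₚ.+-suc k k))))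
  ... | (k , inj₂ refl) = halfTurning (+ k + + k) (suc (k ℕ.+ k)) (+ k) (double (+ k)) (- + 2)
          (Residues.mod (- 1ℤ) (f (+ k))) (Residues.mod (+ k) (f′ (+ k)))
    where
    double : ∀ k → k + k ≡ + 2 * k
    double = solve-∀
    f : ∀ k → - + 2 * (k + k) - + 2 ≡ - 1ℤ * ((1ℤ + (k + k)) + (1ℤ + (k + k)))
    f = solve-∀
    f′ : ∀ k → (1ℤ + (k + k)) * (k + k) - 0ℤ ≡ k * ((1ℤ + (k + k)) + (1ℤ + (k + k)))
    f′ = solve-∀
  ... | (k , inj₁ refl) = unitTurning (+ suc (k ℕ.+ k)) (suc (k ℕ.+ k)) (s≤s z≤n)
          (ℕₚ.m≤m+n (suc (suc (k ℕ.+ k))) (suc (suc (k ℕ.+ k)))) (Residues.mod (+ k) (f (+ k)))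
    where
    f : ∀ k → (1ℤ + (k + k)) * (1ℤ + (k + k)) - 1ℤ ≡ k * ((+ 2 + (k + k)) + (+ 2 + (k + k)))
    f = solve-∀

  -- Arrangements of the shifts

  alternate : ℤ → ℤ → ℕ → ℤ
  alternate b c zero = b
  alternate b c (suc k) = alternate c b k

  alternate-even : ∀ b c k → alternate b c (k ℕ.* 2) ≡ b
  alternate-even b c zero = refl
  alternate-even b c (suc k) = alternate-even b c k

  -- Alternating between b and c from column 2 on leaves only c - b and its negative as further
  -- inner shifts, so four distinctness conditions cover every M.
  offset : ℤ → ℤ → ℤ → ℕ → ℤ
  offset a b c zero = 0ℤ
  offset a b c (suc zero) = a
  offset a b c (suc (suc k)) = alternate b c k

  module _ {n : ℕ} where
    open Residues n

    Distinct : (Fin n → ℤ) → Set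
    Distinct f = ∀ {r r′} → f r ≈ f r′ → r ≡ r′

    distinct-cong : ∀ {f g} → (∀ r → f r ≡ g r) → Distinct f → Distinct g
    distinct-cong e d {r} {r′} h = d (≈-trans (≡⇒≈ (e r)) (≈-trans h (≡⇒≈ (sym (e r′)))))

    distinct-neg : ∀ {f} → Distinct f → Distinct (λ r → - f r)
    distinct-neg d h = d (subst₂ _≈_ (ℤₚ.neg-involutive _) (ℤₚ.neg-involutive _) (≈-neg h))

    distinct-alternate : ∀ (b c : Fin n → ℤ) → Distinct (λ r → c r - b r) →
      ∀ k → Distinct (λ r → alternate (b r) (c r) (suc k) - alternate (b r) (c r) k)
    distinct-alternate b c d zero = d
    distinct-alternate b c d (suc k) = distinct-alternate c b (distinct-cong (λ r → flip (b r) (c r)) (distinct-neg d)) k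
      where
      flip : ∀ b c → - (c - b) ≡ b - c
      flip = solve-∀

    distinct-ℕ : (f : ℕ → ℕ) → (∀ {j} → j < n → f j < n) → (∀ {j k} → j < n → k < n → f j ≡ f k → j ≡ k) →
      Distinct (λ r → + f (toℕ r))
    distinct-ℕ f f<n f-inj {r} {r′} e = Fₚ.toℕ-injective (f-inj (Fₚ.toℕ<n r) (Fₚ.toℕ<n r′)
      (+-injective (f<n (Fₚ.toℕ<n r)) (f<n (Fₚ.toℕ<n r′)) e))

  module Layers {n : ℕ} {{_ : NonZero n}} (M′ : ℕ) (a b c s : Fin n → ℤ) where
    open Residues n

    M : ℕ
    M = 3 ℕ.+ M′

    M≥3 : 3 ≤ M
    M≥3 = ℕₚ.m≤m+n 3 M′

    P : Fin n → Fin M → ℤ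
    P r x = offset (a r) (b r) (c r) (toℕ x)

    P0 : ∀ r x → toℕ x ≡ 0 → P r x ≡ 0ℤ
    P0 r x e = cong (offset (a r) (b r) (c r)) e

    open Scheme {M} {n} M≥3 P P0 s public

    shift-first : ∀ x r → toℕ x ≡ 0 → shift x r ≡ a r
    shift-first x r e = trans (Row.shift-< {M} {n} M≥3 (P r) (P0 r) (s r) x (subst (λ z → suc z < M) (sym e) (s≤s (s≤s z≤n))))
      (trans (cong₂ (λ i j → offset (a r) (b r) (c r) i - offset (a r) (b r) (c r) j) next≡ e) (minus0 (a r)))
      where
      next≡ : toℕ (next x) ≡ 1
      next≡ = trans (next-< x (subst (λ z → suc z < M) (sym e) (s≤s (s≤s z≤n)))) (cong suc e)
      minus0 : ∀ z → z - 0ℤ ≡ z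
      minus0 = solve-∀

    shift-inner : ∀ x r k → toℕ x ≡ k → suc k < M → shift x r ≡ offset (a r) (b r) (c r) (suc k) - offset (a r) (b r) (c r) k
    shift-inner x r k refl l = trans (Row.shift-< {M} {n} M≥3 (P r) (P0 r) (s r) x l)
      (cong (λ i → offset (a r) (b r) (c r) i - P r x) (next-< x l))

    shift-final : ∀ x r → suc (toℕ x) ≡ M → shift x r ≡ s r - alternate (b r) (c r) M′
    shift-final x r e = trans (Row.shift-last {M} {n} M≥3 (P r) (P0 r) (s r) x e)
      (cong (λ i → s r - offset (a r) (b r) (c r) i) (ℕₚ.suc-injective e))

    latin : Distinct a → Distinct (λ r → b r - a r) → Distinct (λ r → c r - b r) →
            Distinct (λ r → s r - alternate (b r) (c r) M′) → Latin
    latin da dba dcb ds x = case last? x of λ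
      { (inj₂ l) → distinct-cong (λ r → sym (shift-final x r l)) ds
      ; (inj₁ l) → inner-layer (toℕ x) refl l }
      where
      inner-layer : ∀ k → toℕ x ≡ k → suc (toℕ x) < M → Distinct (shift x)
      inner-layer zero e _ = distinct-cong (λ r → sym (shift-first x r e)) da
      inner-layer (suc zero) e l = distinct-cong (λ r → sym (shift-inner x r 1 e (subst (λ z → suc z < M) e l))) dba
      inner-layer (suc (suc k)) e l = distinct-cong (λ r → sym (shift-inner x r (suc (suc k)) e (subst (λ z → suc z < M) e l)))
        (distinct-alternate b c dcb k)

  -- Replacing r by τ r in one layer changes a row sum r - r into r - τ r, which stays 0 wherever τ
  -- fixes r.
  record Shuffle (n y : ℕ) : Set where
    field
      τ           : ℕ → ℕ
      τ-injective : ∀ {j k} → τ j ≡ τ k → j ≡ k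
      τ-bound     : ∀ {j} → j < n → τ j < n
      τ-fixed     : ∀ {j} → y ≤ j → τ j ≡ j

  pairs : ℕ → ℕ → ℕ
  pairs zero j = j
  pairs (suc k) 0 = 1
  pairs (suc k) 1 = 0
  pairs (suc k) (suc (suc j)) = suc (suc (pairs k j))

  pairs-involutive : ∀ k j → pairs k (pairs k j) ≡ j
  pairs-involutive zero j = refl
  pairs-involutive (suc k) 0 = refl
  pairs-involutive (suc k) 1 = refl
  pairs-involutive (suc k) (suc (suc j)) = cong (λ z → suc (suc z)) (pairs-involutive k j)

  pairs-fixed : ∀ k {j} → k ℕ.* 2 ≤ j → pairs k j ≡ j
  pairs-fixed zero _ = refl
  pairs-fixed (suc k) (s≤s (s≤s l)) = cong (λ z → suc (suc z)) (pairs-fixed k l)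

  pairs-bound : ∀ k {n j} → k ℕ.* 2 ≤ n → j < n → pairs k j < n
  pairs-bound zero _ l = l
  pairs-bound (suc k) {j = 0} (s≤s (s≤s _)) _ = s≤s (s≤s z≤n)
  pairs-bound (suc k) {j = 1} (s≤s (s≤s _)) _ = s≤s z≤n
  pairs-bound (suc k) {j = suc (suc j)} (s≤s (s≤s h)) (s≤s (s≤s l)) = s≤s (s≤s (pairs-bound k h l))

  pairs-gap : ∀ k {j} → j < k ℕ.* 2 → pairs k j ≡ suc j ⊎ j ≡ suc (pairs k j)
  pairs-gap (suc k) {0} _ = inj₁ refl
  pairs-gap (suc k) {1} _ = inj₂ refl
  pairs-gap (suc k) {suc (suc j)} (s≤s (s≤s l)) with pairs-gap k l
  ... | inj₁ e = inj₁ (cong (λ z → suc (suc z)) e)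
  ... | inj₂ e = inj₂ (cong (λ z → suc (suc z)) e)

  pairShuffle : ∀ {n} k → k ℕ.* 2 ≤ n → Shuffle n (k ℕ.* 2)
  pairShuffle k l = record
    { τ = pairs k
    ; τ-injective = λ {i} {j} e → trans (sym (pairs-involutive k i)) (trans (cong (pairs k) e) (pairs-involutive k j))
    ; τ-bound = pairs-bound k l
    ; τ-fixed = pairs-fixed k }

  -- For odd y: a 3-cycle on the rows 0, 1, 2 and transpositions behind it. All moved rows get sum
  -- ±1 except row 2, which gets 2.
  triple : ℕ → ℕ → ℕ
  triple k 0 = 1
  triple k 1 = 2
  triple k 2 = 0
  triple k (suc (suc (suc j))) = 3 ℕ.+ pairs k j

  triple-gap : ∀ k {j} → j < 3 ℕ.+ k ℕ.* 2 → j ≢ 2 → triple k j ≡ suc j ⊎ j ≡ suc (triple k j)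
  triple-gap k {0} _ _ = inj₁ refl
  triple-gap k {1} _ _ = inj₁ refl
  triple-gap k {2} _ h = ⊥-elim (h refl)
  triple-gap k {suc (suc (suc j))} (s≤s (s≤s (s≤s l))) _ with pairs-gap k l
  ... | inj₁ e = inj₁ (cong (3 ℕ.+_) e)
  ... | inj₂ e = inj₂ (cong (3 ℕ.+_) e)

  tripleShuffle : ∀ {n} k → 3 ℕ.+ k ℕ.* 2 ≤ n → Shuffle n (3 ℕ.+ k ℕ.* 2)
  tripleShuffle {n} k y≤n = record
    { τ = triple k
    ; τ-injective = λ {i} {j} e → trans (sym (left i)) (trans (cong back e) (left j))
    ; τ-bound = bound y≤n
    ; τ-fixed = fixed }
    where
    back : ℕ → ℕ
    back 0 = 2
    back 1 = 0
    back 2 = 1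
    back (suc (suc (suc j))) = 3 ℕ.+ pairs k j
    left : ∀ j → back (triple k j) ≡ j
    left 0 = refl
    left 1 = refl
    left 2 = refl
    left (suc (suc (suc j))) = cong (3 ℕ.+_) (pairs-involutive k j)
    bound : ∀ {n j} → 3 ℕ.+ k ℕ.* 2 ≤ n → j < n → triple k j < n
    bound {j = 0} (s≤s (s≤s (s≤s _))) _ = s≤s (s≤s z≤n)
    bound {j = 1} (s≤s (s≤s (s≤s _))) _ = s≤s (s≤s (s≤s z≤n))
    bound {j = 2} (s≤s (s≤s (s≤s _))) _ = s≤s z≤n
    bound {j = suc (suc (suc j))} (s≤s (s≤s (s≤s h))) (s≤s (s≤s (s≤s l))) = s≤s (s≤s (s≤s (pairs-bound k h l)))
    fixed : ∀ {j} → 3 ℕ.+ k ℕ.* 2 ≤ j → triple k j ≡ j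
    fixed (s≤s (s≤s (s≤s l))) = cong (3 ℕ.+_) (pairs-fixed k l)

  module _ {n : ℕ} {{_ : NonZero n}} where
    open Residues n

    Unit : ℤ → Set
    Unit s = ∃[ σ ] σ * s ≈ 1ℤ

    unit-cong : ∀ {s t} → s ≈ t → Unit t → Unit s
    unit-cong e (σ , h) = σ , ≈-trans (≈-*ˡ σ e) h

    unit-1 : Unit 1ℤ
    unit-1 = 1ℤ , ≈-refl

    unit-−1 : Unit (- 1ℤ)
    unit-−1 = - 1ℤ , ≈-refl

    unit-gap : ∀ {j t} → t ≡ suc j ⊎ j ≡ suc t → Unit (+ j - + t)
    unit-gap {j} (inj₁ refl) = unit-cong (≡⇒≈ (f (+ j))) unit-−1
      where
      f : ∀ j → j - (1ℤ + j) ≡ - 1ℤ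
      f = solve-∀
    unit-gap {t = t} (inj₂ refl) = unit-cong (≡⇒≈ (f (+ t))) unit-1
      where
      f : ∀ t → (1ℤ + t) - t ≡ 1ℤ
      f = solve-∀

  module _ {n y : ℕ} {{_ : NonZero n}} (S : Shuffle n y) where
    open Residues n
    open Shuffle S

    τ̂ : Fin n → ℤ
    τ̂ r = + τ (toℕ r)

    τ̂-distinct : Distinct τ̂
    τ̂-distinct = distinct-ℕ τ τ-bound (λ _ _ → τ-injective)

    -- For even M the columns 0, 1, 2, 3, 4, … of row r are shifted by 0, r, 0, - τ r, 0, ….
    module EvenM (k : ℕ) where
      open Layers {n} (suc (k ℕ.* 2)) ι (λ _ → 0ℤ) (λ r → - τ̂ r) (λ r → ι r - τ̂ r) public

      final≡ : ∀ r → (ι r - τ̂ r) - alternate 0ℤ (- τ̂ r) (suc (k ℕ.* 2)) ≡ ι r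
      final≡ r = trans (cong (λ z → (ι r - τ̂ r) - z) (alternate-even (- τ̂ r) 0ℤ k)) (f (ι r) (τ̂ r))
        where
        f : ∀ r t → (r - t) - (- t) ≡ r
        f = solve-∀

      shift-end : ∀ x r → suc (toℕ x) ≡ M → shift x r ≡ ι r
      shift-end x r e = trans (shift-final x r e) (final≡ r)

      even-latin : Latin
      even-latin = latin ι-injective (distinct-cong (λ r → f (ι r)) (distinct-neg ι-injective))
        (distinct-cong (λ r → g (τ̂ r)) (distinct-neg τ̂-distinct)) (distinct-cong (λ r → sym (final≡ r)) ι-injective)
        where
        f : ∀ r → - r ≡ 0ℤ - r
        f = solve-∀
        g : ∀ t → - t ≡ - t - 0ℤ
        g = solve-∀

      even-closed : ∀ r → y ≤ toℕ r → ι r - τ̂ r ≈ 0ℤ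
      even-closed r l = ≡⇒≈ (trans (cong (λ z → ι r - + z) (τ-fixed l)) (ℤₚ.+-inverseʳ (ι r)))

    -- For odd M they are shifted by 0, - τ r, p r - τ r, - τ r, p r - τ r, …, and one turn by p r + q r - τ r.
    module OddM (k : ℕ) (p q : Fin n → ℤ) (p-distinct : Distinct p) (q-distinct : Distinct q) where
      open Layers {n} (k ℕ.* 2) (λ r → - τ̂ r) (λ r → p r - τ̂ r) (λ r → - τ̂ r) (λ r → p r + q r - τ̂ r) public

      final≡ : ∀ r → (p r + q r - τ̂ r) - alternate (p r - τ̂ r) (- τ̂ r) (k ℕ.* 2) ≡ q r
      final≡ r = trans (cong (λ z → (p r + q r - τ̂ r) - z) (alternate-even (p r - τ̂ r) (- τ̂ r) k)) (f (p r) (q r) (τ̂ r))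
        where
        f : ∀ p q t → (p + q - t) - (p - t) ≡ q
        f = solve-∀

      shift-end : ∀ x r → suc (toℕ x) ≡ M → shift x r ≡ q r
      shift-end x r e = trans (shift-final x r e) (final≡ r)

      odd-latin : Latin
      odd-latin = latin (distinct-neg τ̂-distinct) (distinct-cong (λ r → f (p r) (τ̂ r)) p-distinct)
        (distinct-cong (λ r → g (p r) (τ̂ r)) (distinct-neg p-distinct)) (distinct-cong (λ r → sym (final≡ r)) q-distinct)
        where
        f : ∀ p t → p ≡ (p - t) - (- t)
        f = solve-∀
        g : ∀ p t → - p ≡ (- t) - (p - t)
        g = solve-∀

      odd-closed : (∀ r → y ≤ toℕ r → p r + q r ≈ ι r) → ∀ r → y ≤ toℕ r → p r + q r - τ̂ r ≈ 0ℤ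
      odd-closed h r l = lin₁ 1ℤ 0ℤ (h r l) (trans (cong (λ z → (p r + q r - + z) - 0ℤ) (τ-fixed l)) (f (p r) (q r) (ι r) (+ n)))
        where
        f : ∀ p q r N → (p + q - r) - 0ℤ ≡ 1ℤ * (p + q - r) + 0ℤ * N
        f = solve-∀

  data Parity : ℕ → Set where
    even : ∀ k → Parity (k ℕ.* 2)
    odd  : ∀ k → Parity (suc (k ℕ.* 2))

  parity : ∀ j → Parity j
  parity zero = even 0
  parity (suc zero) = odd 0
  parity (suc (suc j)) with parity j
  ... | even k = even (suc k)
  ... | odd k = odd (suc k)

  half-< : ∀ {h} {k} → k ℕ.* 2 < h ℕ.+ h → k < h
  half-< {h} {k} l = ℕₚ.≰⇒> λ h≤k → ℕₚ.<⇒≱ l (subst (h ℕ.+ h ≤_)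
    (trans (cong (k ℕ.+_) (sym (ℕₚ.+-identityʳ k))) (ℕₚ.*-comm 2 k)) (ℕₚ.+-mono-≤ h≤k h≤k))

  -- Two permutations of ℤ_{2h} that add up to j in row j ≠ 0.  Row 0 then adds up to h, because
  -- 0 + 1 + … + (2h - 1) = h mod 2h.
  module _ (h : ℕ) where
    leftOf rightOf : ∀ {j} → Parity j → ℕ
    leftOf (even k) = k ℕ.+ h
    leftOf (odd k) = k
    rightOf (even zero) = 0
    rightOf (even (suc k)) = suc k ℕ.+ h
    rightOf (odd k) = suc k

    left right : ℕ → ℕ
    left j = leftOf (parity j)
    right j = rightOf (parity j)

    private
      odd-< : ∀ k → suc (k ℕ.* 2) < h ℕ.+ h → k < h
      odd-< k l = half-< {h} {k} (ℕₚ.<-trans (ℕₚ.n<1+n _) l)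

      clash : ∀ {k k′} → suc (k′ ℕ.* 2) < h ℕ.+ h → k ℕ.+ h ≢ k′
      clash {k} {k′} l e = ℕₚ.<⇒≱ (odd-< k′ l) (subst (h ≤_) e (ℕₚ.m≤n+m h k))

    left-bound : ∀ {j} → j < h ℕ.+ h → left j < h ℕ.+ h
    left-bound {j} = go (parity j)
      where
      go : ∀ {j} (p : Parity j) → j < h ℕ.+ h → leftOf p < h ℕ.+ h
      go (even k) l = ℕₚ.+-monoˡ-< h (half-< {h} {k} l)
      go (odd k) l = ℕₚ.<-≤-trans (odd-< k l) (ℕₚ.m≤m+n h h)

    right-bound : ∀ {j} → j < h ℕ.+ h → right j < h ℕ.+ h
    right-bound {j} = go (parity j)
      where
      go : ∀ {j} (p : Parity j) → j < h ℕ.+ h → rightOf p < h ℕ.+ h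
      go (even zero) l = l
      go (even (suc k)) l = ℕₚ.+-monoˡ-< h (half-< {h} {suc k} l)
      go (odd k) l = ℕₚ.≤-<-trans (odd-< k l) (ℕₚ.m<m+n h (ℕₚ.≤-trans (s≤s z≤n) (odd-< k l)))

    left-injective : ∀ {j k} → j < h ℕ.+ h → k < h ℕ.+ h → left j ≡ left k → j ≡ k
    left-injective {j} {k} = go (parity j) (parity k)
      where
      go : ∀ {j k} (p : Parity j) (q : Parity k) → j < h ℕ.+ h → k < h ℕ.+ h → leftOf p ≡ leftOf q → j ≡ k
      go (even k) (even k′) _ _ e = cong (ℕ._* 2) (ℕₚ.+-cancelʳ-≡ h _ _ e)
      go (even k) (odd k′) _ l e = ⊥-elim (clash {k} {k′} l e)
      go (odd k) (even k′) l _ e = ⊥-elim (clash {k′} {k} l (sym e))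
      go (odd k) (odd .k) _ _ refl = refl

    right-injective : ∀ {j k} → j < h ℕ.+ h → k < h ℕ.+ h → right j ≡ right k → j ≡ k
    right-injective {j} {k} = go (parity j) (parity k)
      where
      go : ∀ {j k} (p : Parity j) (q : Parity k) → j < h ℕ.+ h → k < h ℕ.+ h → rightOf p ≡ rightOf q → j ≡ k
      go (even zero) (even zero) _ _ _ = refl
      go (even (suc k)) (even (suc k′)) _ _ e = cong (ℕ._* 2) (ℕₚ.+-cancelʳ-≡ h _ _ e)
      go (even (suc k)) (odd k′) _ l e = ⊥-elim (clash {k} {k′} l (ℕₚ.suc-injective e))
      go (odd k) (even (suc k′)) l _ e = ⊥-elim (clash {k′} {k} l (sym (ℕₚ.suc-injective e)))
      go (odd k) (odd .k) _ _ refl = refl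

    open Residues (h ℕ.+ h)

    left+right : ∀ j → j ≢ 0 → + left j + + right j ≈ + j
    left+right j = go (parity j)
      where
      go : ∀ {j} (p : Parity j) → j ≢ 0 → + leftOf p + + rightOf p ≈ + j
      go (even zero) j≢0 = ⊥-elim (j≢0 refl)
      go (even (suc k)) _ = mod 1ℤ (trans (cong (λ z → + (suc k ℕ.+ h) + + (suc k ℕ.+ h) - z) (ℤₚ.pos-* (suc k) 2)) (f (+ suc k) (+ h)))
        where
        f : ∀ k h → (k + h) + (k + h) - k * + 2 ≡ 1ℤ * (h + h)
        f = solve-∀
      go (odd k) _ = ≡⇒≈ (trans (f (+ k)) (cong (λ z → 1ℤ + z) (sym (ℤₚ.pos-* k 2))))
        where
        f : ∀ k → k + (1ℤ + k) ≡ 1ℤ + k * + 2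
        f = solve-∀

  -- The cases by the parities of n, M and y

  Solution : ℕ → ℕ → ℕ → Set₁
  Solution M n y = InHWP (lex (Cyc M) n) M (M ℕ.* n) (n ∸ y , y)

  module _ {n : ℕ} {{_ : NonZero n}} where
    open Residues n

    zero-one : ι (res 1ℤ) ≈ ι (res 0ℤ) + 1ℤ
    zero-one = ≈-trans (ι-res 1ℤ) (≈-+ {c = 1ℤ} (≈-sym (ι-res 0ℤ)) ≈-refl)

    evenM-plain : ∀ {y} → y ≤ n → (S : Shuffle n y) → (∀ j → j < y → Unit {n} (+ j - + Shuffle.τ S j)) →
      ∀ k → Solution (4 ℕ.+ k ℕ.* 2) n y
    evenM-plain y≤n S unit k = translations⇒InHWP y≤n even-latin even-closed (λ r → unit (toℕ r))
      where open EvenM S k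

    oddM-plain : ∀ {y} → y ≤ n → (S : Shuffle n y) (p q : Fin n → ℤ) → Distinct p → Distinct q →
      (∀ r → y ≤ toℕ r → p r + q r ≈ ι r) → (∀ r → toℕ r < y → Unit {n} (p r + q r - + Shuffle.τ S (toℕ r))) →
      ∀ k → Solution (3 ℕ.+ k ℕ.* 2) n y
    oddM-plain y≤n S p q dp dq closed unit k = translations⇒InHWP y≤n odd-latin (odd-closed closed) unit
      where open OddM S k p q dp dq

    unit-sum : ∀ p q r t → p + q ≈ r → Unit {n} (r - t) → Unit {n} (p + q - t)
    unit-sum p q r t e = unit-cong (≈-- e (≈-refl {t}))

  module OddN (m : ℕ) where
    private
      n : ℕ
      n = suc (m ℕ.* 2)
    open Residues n

    private
      half-unit : + suc m * + 2 ≈ 1ℤ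
      half-unit = mod 1ℤ (trans (f (+ m)) (cong (λ z → 1ℤ * (1ℤ + z)) (sym (ℤₚ.pos-* m 2))))
        where
        f : ∀ m → (1ℤ + m) * + 2 - 1ℤ ≡ 1ℤ * (1ℤ + m * + 2)
        f = solve-∀

      -- Half of r modulo the odd n: used for both p and q, it adds up to r in every row.
      halved : Fin n → ℤ
      halved r = + suc m * ι r

      halved-distinct : Distinct halved
      halved-distinct e = ι-injective (unit-cancel (+ suc m) (+ 2) (subst (_≈ 1ℤ) (ℤₚ.*-comm (+ suc m) (+ 2)) half-unit) e)

      doubled : ∀ r → halved r + halved r ≈ ι r
      doubled r = lin₁ (ι r) 0ℤ half-unit (f (+ suc m) (ι r) (+ n))
        where
        f : ∀ h r N → (h * r + h * r) - r ≡ r * (h * + 2 - 1ℤ) + 0ℤ * N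
        f = solve-∀

      solution : ∀ {y} → y ≤ n → (S : Shuffle n y) → (∀ j → j < y → Unit {n} (+ j - + Shuffle.τ S j)) → ∀ M′ → Solution (3 ℕ.+ M′) n y
      solution y≤n S unit M′ with parity M′
      ... | even k = oddM-plain y≤n S halved halved halved-distinct halved-distinct (λ r _ → doubled r)
                       (λ r l → unit-sum (halved r) (halved r) (ι r) (+ Shuffle.τ S (toℕ r)) (doubled r) (unit (toℕ r) l)) k
      ... | odd k = evenM-plain y≤n S unit k

    oddN : ∀ y → y ≢ 1 → y ≤ n → ∀ M′ → Solution (3 ℕ.+ M′) n y
    oddN y y≢1 y≤n with parity y
    ... | even k = solution y≤n (pairShuffle k y≤n) (λ j l → unit-gap (pairs-gap k l))
    ... | odd zero = ⊥-elim (y≢1 refl)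
    ... | odd (suc k) = solution y≤n (tripleShuffle k y≤n) λ j l → case j ℕ.≟ 2 of λ
      -- Row 2 of the 3-cycle has sum 2, with inverse (n + 1)/2.
      { (yes refl) → + suc m , half-unit
      ; (no j≢2) → unit-gap (triple-gap k l j≢2) }

  module EvenN (h′ : ℕ) where
    private
      h n : ℕ
      h = suc h′
      n = h ℕ.+ h
    open Residues n

    private
      n≥2 : 2 ≤ n
      n≥2 = s≤s (ℕₚ.≤-trans (s≤s z≤n) (ℕₚ.m≤n+m h h′))

      left̂ right̂ : Fin n → ℤ
      left̂ r = + left h (toℕ r)
      right̂ r = + right h (toℕ r)

      left-distinct : Distinct left̂
      left-distinct = distinct-ℕ (left h) (left-bound h) (left-injective h)

      right-distinct : Distinct right̂
      right-distinct = distinct-ℕ (right h) (right-bound h) (right-injective h)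

      sum : ∀ r → toℕ r ≢ 0 → left̂ r + right̂ r ≈ ι r
      sum r = left+right h (toℕ r)

      sum′ : ∀ r → toℕ r ≢ 0 → right̂ r + left̂ r ≈ ι r
      sum′ r ne = subst (_≈ ι r) (ℤₚ.+-comm (left̂ r) (right̂ r)) (sum r ne)

      positive : ∀ {y} → 0 < y → ∀ {j} → y ≤ j → j ≢ 0
      positive 0<y y≤j refl = ℕₚ.<⇒≱ 0<y y≤j

      row : ∀ j → j < n → Fin n
      row j l = fromℕ< l

      other : ∀ {r : Fin n} {j} (l : j < n) → r ≢ row j l → toℕ r ≢ j
      other l ne e = ne (Fₚ.toℕ-injective (trans e (sym (Fₚ.toℕ-fromℕ< l))))

      at : ∀ {j} (l : j < n) (f : ℕ → ℤ) → f (toℕ (row j l)) ≡ f j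
      at l f = cong f (Fₚ.toℕ-fromℕ< l)

      rise : (g : Fin n → ℤ) (f : ℕ → ℤ) → (∀ r → g r ≡ f (toℕ r)) → ∀ {i j} (l : i < n) (l′ : j < n) →
        f j ≡ f i + 1ℤ → g (row j l′) ≈ g (row i l) + 1ℤ
      rise g f e l l′ up = ≡⇒≈ (trans (trans (e _) (at l′ f)) (trans up (cong (λ z → z + 1ℤ) (sym (trans (e _) (at l f))))))

      2≈ : ∀ (h : ℤ) → (1ℤ + h) + (1ℤ + h) - 0ℤ - + 2 ≡ 1ℤ * (h + h)
      2≈ = solve-∀

    evenN-evenM-even : ∀ k → k ℕ.* 2 ≤ n → ∀ M′ → Solution (4 ℕ.+ M′ ℕ.* 2) n (k ℕ.* 2)
    evenN-evenM-even k y≤n = evenM-plain y≤n (pairShuffle k y≤n) (λ j l → unit-gap (pairs-gap k l))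

    -- The bad sum 2 of row 2 is traded with row 1, of sum -1. Both outer layers shift row r by r,
    -- so these neighbours differ by 1 in each.
    evenN-evenM-odd : ∀ k → 3 ℕ.+ k ℕ.* 2 ≤ n → ∀ M′ → Solution (4 ℕ.+ M′ ℕ.* 2) n (3 ℕ.+ k ℕ.* 2)
    evenN-evenM-odd k y≤n M′ = trade⇒InHWP y≤n even-latin even-closed (row 1 1<n) (row 2 2<n)
      (subst (_< y) (sym (Fₚ.toℕ-fromℕ< 1<n)) (s≤s (s≤s z≤n))) (subst (_< y) (sym (Fₚ.toℕ-fromℕ< 2<n)) (s≤s (s≤s (s≤s z≤n))))
      (res 0ℤ) (res 1ℤ) zero-one
      (λ { x (inj₁ e) → rise (shift x) (λ j → + j) (λ r → shift-first x r e) 1<n 2<n refl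
         ; x (inj₂ e) → rise (shift x) (λ j → + j) (λ r → shift-end x r e) 1<n 2<n refl })
      (shift-turning (≡⇒≈ (sym (at 1<n (λ j → + j - + triple k j)))) (minusOneTurning n≥2))
      -- Reflection turns the turning for -2 into one for 2 with u and w interchanged.
      (reflect (≡⇒≈ (at 2<n (λ j → + j - + triple k j))) (minusTwoTurning h))
      (λ r l ne₁ ne₂ → unit-gap (triple-gap k l (other 2<n ne₂)))
      where
      y : ℕ
      y = 3 ℕ.+ k ℕ.* 2
      open EvenM (tripleShuffle k y≤n) M′
      1<n : 1 < n
      1<n = n≥2
      2<n : 2 < n
      2<n = ℕₚ.≤-trans (s≤s (s≤s (s≤s z≤n))) y≤n

    -- Rows 0 and 1 have the sums h - 1 and 1. From row 0 to row 1 the first layer goes from -1 to 0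
    -- and the last, `right`, from 0 to 1.
    evenN-oddM-even : ∀ k → suc k ℕ.* 2 ≤ n → ∀ M′ → Solution (3 ℕ.+ M′ ℕ.* 2) n (suc k ℕ.* 2)
    evenN-oddM-even k y≤n M′ = trade⇒InHWP y≤n odd-latin (odd-closed (λ r l → sum r (positive (s≤s z≤n) l))) (row 0 0<n) (row 1 1<n)
      (subst (_< y) (sym (Fₚ.toℕ-fromℕ< 0<n)) (s≤s z≤n)) (subst (_< y) (sym (Fₚ.toℕ-fromℕ< 1<n)) (s≤s (s≤s z≤n)))
      (res 0ℤ) (res 1ℤ) zero-one
      (λ { x (inj₁ e) → rise (shift x) (λ j → - + τ j) (λ r → shift-first x r e) 0<n 1<n refl
         ; x (inj₂ e) → rise (shift x) (λ j → + right h j) (λ r → shift-end x r e) 0<n 1<n refl })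
      (shift-turning (≡⇒≈ (sym (trans (at 0<n (λ j → + left h j + + right h j - + τ j)) (cong (λ z → + z - 1ℤ) (ℕₚ.+-identityʳ h))))) (halfMinusOneTurning h))
      (reflect (≡⇒≈ (at 1<n (λ j → + left h j + + right h j - + τ j))) (minusOneTurning n≥2))
      (λ r l ne₁ ne₂ → unit-sum (left̂ r) (right̂ r) (ι r) (+ τ (toℕ r)) (sum r (other 0<n ne₁)) (unit-gap (pairs-gap (suc k) l)))
      where
      y : ℕ
      y = suc k ℕ.* 2
      τ = pairs (suc k)
      open OddM (pairShuffle (suc k) y≤n) M′ left̂ right̂ left-distinct right-distinct
      0<n : 0 < n
      0<n = s≤s z≤n
      1<n : 1 < n
      1<n = n≥2

    -- The two bad rows, 0 with sum h - 1 and 2 with sum 2, trade with each other. The last layer is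
    -- `left` here, which goes from h to h + 1 between them, whereas `right` would go from 0 to h +
    -- 1.
    evenN-oddM-odd : ∀ k → 3 ℕ.+ k ℕ.* 2 ≤ n → ∀ M′ → Solution (3 ℕ.+ M′ ℕ.* 2) n (3 ℕ.+ k ℕ.* 2)
    evenN-oddM-odd k y≤n M′ = trade⇒InHWP y≤n odd-latin (odd-closed (λ r l → sum′ r (positive (s≤s z≤n) l))) (row 0 0<n) (row 2 2<n)
      (subst (_< y) (sym (Fₚ.toℕ-fromℕ< 0<n)) (s≤s z≤n)) (subst (_< y) (sym (Fₚ.toℕ-fromℕ< 2<n)) (s≤s (s≤s (s≤s z≤n))))
      (res 0ℤ) (res 1ℤ) zero-one
      (λ { x (inj₁ e) → rise (shift x) (λ j → - + τ j) (λ r → shift-first x r e) 0<n 2<n refl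
         ; x (inj₂ e) → rise (shift x) (λ j → + left h j) (λ r → shift-end x r e) 0<n 2<n (ℤₚ.+-comm 1ℤ (+ h)) })
      (shift-turning (≡⇒≈ (sym (at 0<n (λ j → + right h j + + left h j - + τ j)))) (halfMinusOneTurning h))
      (reflect (≈-trans (≡⇒≈ (at 2<n (λ j → + right h j + + left h j - + τ j))) (mod 1ℤ (2≈ (+ h)))) (minusTwoTurning h))
      (λ r l ne₁ ne₂ → unit-sum (right̂ r) (left̂ r) (ι r) (+ τ (toℕ r)) (sum′ r (other 0<n ne₁)) (unit-gap (triple-gap k l (other 2<n ne₂))))
      where
      y : ℕ
      y = 3 ℕ.+ k ℕ.* 2
      τ = triple k
      open OddM (tripleShuffle k y≤n) M′ right̂ left̂ right-distinct left-distinct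
      0<n : 0 < n
      0<n = s≤s z≤n
      2<n : 2 < n
      2<n = ℕₚ.≤-trans (s≤s (s≤s (s≤s z≤n))) y≤n

  -- For n = 2 the defect h = 1 is itself a unit: without any shuffling row 0 has sum 1 and row 1 is
  -- closed.
  oneTwo : ∀ M′ → Solution (3 ℕ.+ M′ ℕ.* 2) 2 1
  oneTwo = oddM-plain (s≤s z≤n) record { τ = λ j → j ; τ-injective = λ e → e ; τ-bound = λ l → l ; τ-fixed = λ _ → refl }
    (λ r → + left 1 (toℕ r)) (λ r → + right 1 (toℕ r))
    (distinct-ℕ (left 1) (left-bound 1) (left-injective 1)) (distinct-ℕ (right 1) (right-bound 1) (right-injective 1))
    (λ r l → left+right 1 (toℕ r) (λ e → ℕₚ.<⇒≱ (s≤s z≤n) (subst (1 ≤_) e l)))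
    (λ { zero _ → unit-1 ; (suc _) (s≤s ()) })

  evenN : ∀ h y → y ≤ suc h ℕ.+ suc h → ∀ M′ → let n = suc h ℕ.+ suc h ; M = 3 ℕ.+ M′ in
    ¬ (y ≡ 1 × ¬ (n ≡ 2 × M % 2 ≡ 1)) → ¬ (((y ≡ 0 × n ≡ 2) ⊎ (y ≡ 0 × n ≡ 6)) × M % 2 ≡ 1) → Solution M n y
  evenN h y y≤n M′ ¬one ¬zero with parity y | parity M′
  -- As M = 3 + M′, the pattern `odd k` for M′ means that M is even.
  ... | odd zero | odd k = ⊥-elim (¬one (refl , λ (_ , e) → case trans (sym (m*n%n≡0 (2 ℕ.+ k) 2)) e of λ ()))
  ... | odd zero | even k with h
  ...   | zero = oneTwo k
  ...   | suc h′ = ⊥-elim (¬one (refl , λ (e , _) → case trans (sym (cong (λ z → suc (suc z)) (ℕₚ.+-suc h′ (suc h′)))) e of λ ()))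
  evenN h y y≤n M′ ¬one ¬zero | odd (suc j) | odd k = EvenN.evenN-evenM-odd h j y≤n k
  evenN h y y≤n M′ ¬one ¬zero | odd (suc j) | even k = EvenN.evenN-oddM-odd h j y≤n k
  evenN h y y≤n M′ ¬one ¬zero | even j | odd k = EvenN.evenN-evenM-even h j y≤n k
  evenN h y y≤n M′ ¬one ¬zero | even (suc j) | even k = EvenN.evenN-oddM-even h j y≤n k
  evenN h y y≤n M′ ¬one ¬zero | even zero | even k = subst (λ n → Solution (3 ℕ.+ k ℕ.* 2) n 0) n≡
      (evenInHWP (suc h) (ℕₚ.m≤m+n 3 (k ℕ.* 2)) (λ ())
        (λ e → ¬zero (inj₁ (refl , trans (sym n≡) e) , oddM)) (λ e → ¬zero (inj₂ (refl , trans (sym n≡) e) , oddM)))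
    where
    n≡ : suc h ℕ.* 2 ≡ suc h ℕ.+ suc h
    n≡ = trans (ℕₚ.*-comm (suc h) 2) (cong (suc h ℕ.+_) (ℕₚ.+-identityʳ (suc h)))
    oddM : (3 ℕ.+ k ℕ.* 2) % 2 ≡ 1
    oddM = [m+kn]%n≡m%n 1 (suc k) 2

open import Data.Nat using (_*_)

theorem3p5 : (n M y : ℕ) → 2 ≤ n → 3 ≤ M → y ≤ n →
    ¬ (y ≡ 1 × ¬ (n ≡ 2 × M % 2 ≡ 1)) →
    ¬ (y ≡ 2 × 3 ≤ n × n % 4 ≡ 2 × M % 2 ≡ 1) →
    ¬ (((y ≡ 0 × n ≡ 2) ⊎ (y ≡ 0 × n ≡ 6)) × M % 2 ≡ 1) →
    InHWP (lex (Cyc M) n) M (M * n) (n ∸ y , y)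
theorem3p5 n (suc (suc (suc M′))) y n≥2 (s≤s (s≤s (s≤s _))) y≤n ¬one _ ¬zero with parity n
... | odd m = OddN.oddN m y (λ { refl → ¬one (refl , λ (e , _) → odd≢2 m e) }) y≤n M′
  where
  odd≢2 : ∀ m → suc (m ℕ.* 2) ≢ 2
  odd≢2 zero ()
  odd≢2 (suc m) ()
... | even zero = ⊥-elim (ℕₚ.<⇒≱ n≥2 z≤n)
... | even (suc h) = go (trans (ℕₚ.*-comm (suc h) 2) (cong (suc h ℕ.+_) (ℕₚ.+-identityʳ (suc h)))) y≤n ¬one ¬zero
  where
  go : ∀ {n} → n ≡ suc h ℕ.+ suc h → y ≤ n → ¬ (y ≡ 1 × ¬ (n ≡ 2 × (3 ℕ.+ M′) % 2 ≡ 1)) →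
    ¬ (((y ≡ 0 × n ≡ 2) ⊎ (y ≡ 0 × n ≡ 6)) × (3 ℕ.+ M′) % 2 ≡ 1) → Solution (3 ℕ.+ M′) n y
  go refl y≤n = evenN h y y≤n M′
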